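{- Let $1<k\le n$ be integers. Every interval $[\sigma,\tau]=\{\pi : \sigma\le\pi\le\tau\}$ (with $\sigma\le\tau$) in the poset $\mathrm{Poset}(\mathrm{PF}_{n,k})$ is isomorphic, as a poset, either to $\mathrm{Poset}(\mathrm{PF}_{r,r})\times\prod_{i=1}^{j}\mathrm{NC}_{m_i}$ for some integers $r\ge 2$, $j\ge 1$ and $m_1,\dots,m_j\ge 1$, or to $\prod_{i=1}^{j}\mathrm{NC}_{m_i}$ for some integers $j\ge 1$ and $m_1,\dots,m_j\ge 1$.
   Context: Write $[n]=\{1,\dots,n\}$. A parking function of length $n$ is an $n$-tuple $(a_1,\dots,a_n)$ of positive integers whose weakly increasing rearrangement $b_1\le\dots\le b_n$ satisfies $b_i\le i$ for all $i$; $\mathrm{PF}_n$ is the set of these. For $1<k\le n$, $\mathrm{PF}_{n,k}$ is the set of $a\in\mathrm{PF}_n$ such that $k$ is not an entry of $a$ but each of $k+1,\dots,n$ is an entry of $a$. $\mathrm{NC}_m$ is the lattice of noncrossing partitions of $[m]$ (partitions for which, placing $1,\dots,m$ in clockwise order on a circle, the convex hulls of the blocks are pairwise disjoint), ordered by refinement, with the finer partition being smaller. Each covering relation $\sigma<\tau$ in $\mathrm{NC}_{n+1}$ merges two blocks $B_1,B_2$ of $\sigma$ into one block $B=B_1\cup B_2$ of $\tau$; name them so that $\min B\in B_1$, and label the covering relation by the largest element of $B_1$ that is less than every element of $B_2$. Reading the labels of a maximal chain of $\mathrm{NC}_{n+1}$ from bottom to top gives a parking function of length $n$, and this is a (known)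 bijection from maximal chains of $\mathrm{NC}_{n+1}$ to $\mathrm{PF}_n$. $\mathrm{Poset}(\mathrm{PF}_{n,k})$ is the poset whose Hasse diagram is the union of the maximal chains of $\mathrm{NC}_{n+1}$ corresponding to elements of $\mathrm{PF}_{n,k}$: its elements are the noncrossing partitions lying on at least one of these chains, and its order is the reflexive-transitive closure of the covering relations occurring in these chains (it need not be an induced subposet of $\mathrm{NC}_{n+1}$). -}

module Defs where

open import Level using (Level; _⊔_; 0ℓ) renaming (suc to lsuc)
open import Data.Nat.Base as ℕ using (ℕ; zero; suc)
open import Data.Fin.Base as Fin using (Fin; toℕ; fromℕ; inject₁)
open import Data.Product.Base using (Σ; Σ-syntax; ∃; ∃-syntax; _×_; _,_; proj₁; proj₂)
open import Data.Sum.Base using (_⊎_; inj₁; inj₂; [_,_]′)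
open import Data.Vec.Functional using (Vector)
open import Data.Vec.Functional.Relation.Binary.Permutation using (_↭_)
open import Function.Base using (_∘_)
open import Relation.Binary.Bundles using (Poset)
open import Relation.Binary.Core using (Rel; _⇒_; _Preserves_⟶_)
open import Relation.Binary.Definitions using (Minimum; Maximum)
open import Relation.Binary.Structures using (IsDecEquivalence)
open import Relation.Binary.Construct.Closure.ReflexiveTransitive
  using (Star; _◅◅_; return; fold)
import Relation.Binary.Construct.On as On
open import Relation.Binary.Morphism.Structures using (IsOrderIsomorphism)
import Relation.Binary.Properties.Poset as PosetProperties
open import Relation.Binary.PropositionalEquality.Core using (_≡_; _≢_)
open import Relation.Nullary.Negation.Core using (¬_)

private
  variable
    p₁ p₂ p₃ q₁ q₂ q₃ : Level

_≅_ : Poset p₁ p₂ p₃ → Poset q₁ q₂ q₃ → Set (p₁ ⊔ p₂ ⊔ p₃ ⊔ q₁ ⊔ q₂ ⊔ q₃)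
P ≅ Q = ∃[ f ] IsOrderIsomorphism P._≈_ Q._≈_ P._≤_ Q._≤_ f
  where
  module P = Poset P
  module Q = Poset Q

infix 4 _≅_

Interval : (P : Poset p₁ p₂ p₃) (x y : Poset.Carrier P) → Poset (p₁ ⊔ p₃) p₂ p₃
Interval P x y = On.poset P (proj₁ {B = λ z → x ≤ z × z ≤ y})
  where open Poset P using (_≤_)

∏ : {j : ℕ} → (Fin j → Poset p₁ p₂ p₃) → Poset p₁ p₂ p₃
∏ {j = j} P = record
  { Carrier        = (i : Fin j) → P.Carrier i
  ; _≈_            = λ x y → ∀ i → P._≈_ i (x i) (y i)
  ; _≤_            = λ x y → ∀ i → P._≤_ i (x i) (y i)
  ; isPartialOrder = record
    { isPreorder = record
      { isEquivalence = record
        { refl  = λ i → P.Eq.refl i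
        ; sym   = λ p i → P.Eq.sym i (p i)
        ; trans = λ p q i → P.Eq.trans i (p i) (q i)
        }
      ; reflexive = λ p i → P.reflexive i (p i)
      ; trans     = λ p q i → P.trans i (p i) (q i)
      }
    ; antisym = λ p q i → P.antisym i (p i) (q i)
    }
  }
  where module P i = Poset (P i)

Covers : (P : Poset p₁ p₂ p₃) → Rel (Poset.Carrier P) (p₁ ⊔ p₂ ⊔ p₃)
Covers P x y = x < y × (∀ z → ¬ (x < z × z < y))
  where open PosetProperties P using (_<_)

-- A partition of [m] is given by its "same block" relation.  The element
-- i : Fin m stands for the integer suc (toℕ i).
record NoncrossingPartition (m : ℕ) : Set (lsuc 0ℓ) where
  field
    SameBlock        : Rel (Fin m) 0ℓ
    isDecEquivalence : IsDecEquivalence SameBlock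
    -- For points in convex position, the convex hulls of two distinct blocks
    -- meet iff a chord of one crosses a chord of the other.
    noncrossing      : ∀ {a b c d} → a Fin.< b → b Fin.< c → c Fin.< d →
                       SameBlock a c → SameBlock b d → SameBlock a b

open NoncrossingPartition using (SameBlock) public

NC : ℕ → Poset (lsuc 0ℓ) 0ℓ 0ℓ
NC m = record
  { Carrier        = NoncrossingPartition m
  ; _≈_            = λ σ τ → σ ⊑ τ × τ ⊑ σ
  ; _≤_            = _⊑_
  ; isPartialOrder = record
    { isPreorder = record
      { isEquivalence = record
        { refl  = (λ p → p) , (λ p → p)
        ; sym   = λ (p , q) → q , p
        ; trans = λ (p , q) (p′ , q′) → (λ r → p′ (p r)) , (λ r → q (q′ r))
        }
      ; reflexive = proj₁
      ; trans     = λ p q r → q (p r)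
      }
    ; antisym = _,_
    }
  }
  where
  _⊑_ : Rel (NoncrossingPartition m) 0ℓ
  σ ⊑ τ = SameBlock σ ⇒ SameBlock τ

_⋖_ : {m : ℕ} → Rel (NoncrossingPartition m) (lsuc 0ℓ)
_⋖_ {m} = Covers (NC m)

infix 4 _⋖_

-- For a covering relation σ ⋖ τ merging the blocks B₁ and B₂ of σ into the
-- block B of τ, with x = min B ∈ B₁ and y any element of B₂.
record IsLabel {m : ℕ} (σ τ : NoncrossingPartition m) (ℓ : ℕ) : Set where
  field
    x y            : Fin m
  B₁ = SameBlock σ x
  B₂ = SameBlock σ y
  B  = SameBlock τ x
  field
    B₁≢B₂          : ¬ SameBlock σ x y
    B⊆B₁∪B₂        : ∀ z → B z → B₁ z ⊎ B₂ z
    B₁∪B₂⊆B        : ∀ z → B₁ z ⊎ B₂ z → B z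
    x-minimum      : ∀ z → B z → x Fin.≤ z
    i              : Fin m
    i∈B₁           : B₁ i
    i<B₂           : ∀ z → B₂ z → i Fin.< z
    i-largest      : ∀ i′ → B₁ i′ → (∀ z → B₂ z → i′ Fin.< z) → i′ Fin.≤ i
    ℓ≡i            : ℓ ≡ suc (toℕ i)

-- NC (suc n) is graded of rank n, so its maximal chains are exactly the
-- saturated chains with n + 1 elements from its minimum to its maximum.
record MaximalChain (n : ℕ) : Set (lsuc 0ℓ) where
  open Poset (NC (suc n)) using (_≤_)
  field
    element : Fin (suc n) → NoncrossingPartition (suc n)
    bottom  : Minimum _≤_ (element Fin.zero)
    top     : Maximum _≤_ (element (fromℕ n))
    covers  : (i : Fin n) → element (inject₁ i) ⋖ element (Fin.suc i)

open MaximalChain using (element; covers) public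

record IsParkingFunction {n : ℕ} (a : Vector ℕ n) : Set where
  field
    positive   : ∀ i → 1 ℕ.≤ a i
    b          : Vector ℕ n
    rearranged : b ↭ a
    increasing : b Preserves Fin._≤_ ⟶ ℕ._≤_
    bounded    : ∀ i → b i ℕ.≤ suc (toℕ i)

_isEntryOf_ : {n : ℕ} → ℕ → Vector ℕ n → Set
j isEntryOf a = ∃[ i ] a i ≡ j

record PF (n k : ℕ) (a : Vector ℕ n) : Set where
  field
    isParkingFunction : IsParkingFunction a
    k-missing         : ¬ (k isEntryOf a)
    others-present    : ∀ j → k ℕ.< j → j ℕ.≤ n → j isEntryOf a

_CorrespondsTo_ : {n : ℕ} → MaximalChain n → Vector ℕ n → Set
c CorrespondsTo a = ∀ i → IsLabel (element c (inject₁ i)) (element c (Fin.suc i)) (a i)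

PFChain : ℕ → ℕ → Set (lsuc 0ℓ)
PFChain n k = Σ[ c ∈ MaximalChain n ] ∃[ a ] (PF n k a × c CorrespondsTo a)

module _ (n k : ℕ) where
  open Poset (NC (suc n))

  OnPFChain : NoncrossingPartition (suc n) → Set (lsuc 0ℓ)
  OnPFChain σ = Σ[ (c , _) ∈ PFChain n k ] ∃[ i ] σ ≈ element c i

  PFElement : Set (lsuc 0ℓ)
  PFElement = Σ (NoncrossingPartition (suc n)) OnPFChain

  PFEdge : Rel PFElement (lsuc 0ℓ)
  PFEdge (σ , _) (τ , _) = Σ[ (c , _) ∈ PFChain n k ] ∃[ i ]
    (σ ≈ element c (inject₁ i) × τ ≈ element c (Fin.suc i))

  -- Star is reflexive only up to _≡_, hence the closure also includes _≈_.
  PFOrder : Rel PFElement (lsuc 0ℓ)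
  PFOrder = Star λ σ τ → proj₁ σ ≈ proj₁ τ ⊎ PFEdge σ τ

  private
    edge⇒≤ : ∀ {σ τ} → PFEdge σ τ → proj₁ σ ≤ proj₁ τ
    edge⇒≤ {σ , _} {τ , _} ((c , _) , i , σ≈ , τ≈) =
      trans {σ} {element c (inject₁ i)} {τ} (proj₁ σ≈)
        (trans {element c (inject₁ i)} {element c (Fin.suc i)} {τ}
          (proj₁ (proj₁ (covers c i))) (proj₂ τ≈))

  PFOrder⇒≤ : ∀ {σ τ} → PFOrder σ τ → proj₁ σ ≤ proj₁ τ
  PFOrder⇒≤ = fold (λ σ τ → proj₁ σ ≤ proj₁ τ)
    (λ {σ} {ρ} {τ} s ρ≤τ → trans {proj₁ σ} {proj₁ ρ} {proj₁ τ}
      ([ proj₁ , edge⇒≤ {σ} {ρ} ]′ s) ρ≤τ)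
    (λ p → p)

  PosetPF : Poset (lsuc 0ℓ) 0ℓ (lsuc 0ℓ)
  PosetPF = record
    { Carrier        = PFElement
    ; _≈_            = λ σ τ → proj₁ σ ≈ proj₁ τ
    ; _≤_            = PFOrder
    ; isPartialOrder = record
      { isPreorder = record
        { isEquivalence = On.isEquivalence proj₁ isEquivalence
        ; reflexive     = λ σ≈τ → return (inj₁ σ≈τ)
        ; trans         = _◅◅_
        }
      ; antisym = λ p q → PFOrder⇒≤ p , PFOrder⇒≤ q
      }
    }

{-# OPTIONS --safe #-}
module Submission where

-- A step of a maximal chain merges two blocks; let m be the smaller of their two
-- maxima.  Along the chain m takes each value in [n] once, and the label is at
-- most m, with equality iff neither block is nested in the other.  Hence the
-- label word lies in PF(n,k) iff blocks with an element > k are never nested in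
-- other blocks and no step merges a block with maximum k into one with minimum
-- k + 1.  So Poset(PF(n,k)) consists of the partitions whose blocks are convex
-- above k, ordered by refinement except for the pairs (σ , τ) between which such
-- a forbidden merge is unavoidable (BadPair).
--
-- Restricting to [n] and to {n , n + 1} splits off a factor NC₂ while n > k.  For
-- n = k an interval [σ , τ] is cut along a window [I , J) for which either I and J
-- are in one block of σ or the window is a union of blocks of τ: it is the product
-- of the intervals of the restrictions, and the exception concerns only the factor
-- that contains k and k + 1.  When no cut is left, σ is the minimum and τ the
-- maximum, and the factors are NCₘ or, once at most, Poset(PF(r,r)).

open import Defs
open import Level using (Level; _⊔_; 0ℓ) renaming (suc to lsuc)
open import Data.Nat.Base as ℕ using (ℕ; zero; suc; z≤n; s≤s; _<_; _≤_; _+_)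
import Data.Nat.Properties as ℕₚ
open import Data.Nat.Induction using (<-wellFounded)
open import Data.Fin.Base as Fin using (Fin; toℕ; fromℕ; fromℕ<; inject₁; punchIn)
import Data.Fin.Properties as Finₚ
open import Data.Fin.Permutation using (insert; _⟨$⟩ʳ_; _⟨$⟩ˡ_)
import Data.Fin.Permutation as Perm
open import Data.Fin.Subset using (Subset; _⊂_) renaming (_∈_ to _∈ˢ_)
open import Data.Fin.Subset.Induction using (⊂-wellFounded)
open import Data.Bool.Base using (Bool; true; false)
import Data.Bool.Properties as Boolₚ
open import Data.Empty using (⊥; ⊥-elim)
open import Data.Unit.Base using (⊤; tt)
open import Data.Product.Base using (Σ-syntax; ∃; ∃-syntax; _×_; _,_; proj₁; proj₂)
open import Data.Product.Relation.Binary.Pointwise.NonDependent using (×-poset)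
open import Data.Sum.Base using (_⊎_; inj₁; inj₂; [_,_]′)
open import Data.Vec.Base using (tabulate)
open import Data.Vec.Properties using (lookup⇒[]=; []=⇒lookup; lookup∘tabulate)
open import Data.Vec.Functional using (Vector; _∷_)
open import Data.Vec.Functional.Relation.Binary.Permutation using (_↭_)
open import Function.Base using (_∘_; id)
open import Induction.WellFounded using (Acc; acc)
open import Relation.Binary.Bundles using (Poset)
open import Relation.Binary.Definitions using (Tri; tri<; tri≈; tri>)
open import Relation.Binary.Structures using (IsDecEquivalence)
open import Relation.Binary.Construct.Closure.ReflexiveTransitive using (ε; _◅_; _◅◅_)
import Relation.Binary.Construct.On as On
open import Relation.Binary.Morphism.Structures using (IsOrderIsomorphism)
import Relation.Binary.Morphism.Construct.Composition as Composition
open import Relation.Binary.PropositionalEquality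
  using (_≡_; _≢_; refl; sym; trans; cong; subst; subst₂)
open import Relation.Nullary using (¬_; Dec; yes; no; does)
open import Relation.Nullary.Decidable using (toSum; _×-dec_; _⊎-dec_; _→-dec_; ¬?; map′; dec-true; dec-false; decidable-stable)
open import Relation.Nullary.Negation using (contradiction)
open import Relation.Unary using (Pred; Decidable)

-- The order of Poset(PF(n,k)) is not induced from refinement, so it must first be decided from the
-- endpoints alone. A step between convex partitions has label k exactly when `u` lies in the block
-- with the minimum of the union and `v` is the minimum of the other block. Let `u` and `v` end up
-- in a block of τ with minimum x. If x is not yet with `u`, one joins x to the block of `v` first;
-- then `v` is no longer a minimum and the forbidden merge cannot occur any more. If x is with `u`
-- and `v` is a minimum, noncrossingness keeps `v` a minimum until it meets `u`. Hence `BadPair`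
-- involves only σ and τ, and a bad composite has a bad half, which is transitivity.
--
-- For n = k the windows are taken with J ≤ `u`, so that `u` and `v` survive as the last two points
-- of the outer factor. This is possible because an interval contains no bad pair at all if `v` is
-- not a minimum in σ or if `u` and `v` are apart in τ. What is finally left has r + 1 points, and r
-- ≥ 2 because on two points the pair of minimum and maximum is itself bad.

private
  variable
    p₁ p₂ p₃ q₁ q₂ q₃ r₁ r₂ r₃ s₁ s₂ s₃ : Level
    N M n L L′ : ℕ

-- Isomorphisms and products of posets

infix 4 _≃_

-- Unlike P ≅ Q, which unfolds, this lets P and Q be inferred.
record _≃_ (P : Poset p₁ p₂ p₃) (Q : Poset q₁ q₂ q₃) : Set (p₁ ⊔ p₂ ⊔ p₃ ⊔ q₁ ⊔ q₂ ⊔ q₃) where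
  constructor ⟨_⟩
  field iso : P ≅ Q

open _≃_

module _ (P : Poset p₁ p₂ p₃) (Q : Poset q₁ q₂ q₃) where
  private
    module P = Poset P
    module Q = Poset Q

  mk≃ : (to : P.Carrier → Q.Carrier) (from : Q.Carrier → P.Carrier) →
        (∀ {x y} → x P.≤ y → to x Q.≤ to y) →
        (∀ {x y} → to x Q.≤ to y → x P.≤ y) →
        (∀ y → to (from y) Q.≈ y) → P ≃ Q
  mk≃ to from mono cancel to∘from = ⟨ to , record
    { isOrderMonomorphism = record
      { isOrderHomomorphism = record { cong = cong′ ; mono = mono }
      ; injective = λ e → P.antisym (cancel (Q.reflexive e)) (cancel (Q.reflexive (Q.Eq.sym e)))
      ; cancel = cancel
      }
    ; surjective = λ y → from y , λ e → Q.Eq.trans (cong′ e) (to∘from y)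
    } ⟩
    where
    cong′ : ∀ {x y} → x P.≈ y → to x Q.≈ to y
    cong′ e = Q.antisym (mono (P.reflexive e)) (mono (P.reflexive (P.Eq.sym e)))

module _ {P : Poset p₁ p₂ p₃} {Q : Poset q₁ q₂ q₃} (P≃Q : P ≃ Q) where
  private
    module P = Poset P
    module Q = Poset Q
    module I = IsOrderIsomorphism (proj₂ (iso P≃Q))

    from : Q.Carrier → P.Carrier
    from y = proj₁ (I.surjective y)

    to∘from : ∀ y → proj₁ (iso P≃Q) (from y) Q.≈ y
    to∘from y = proj₂ (I.surjective y) P.Eq.refl

  ≃-sym : Q ≃ P
  ≃-sym = mk≃ Q P from (proj₁ (iso P≃Q))
    (λ {x} {y} x≤y → I.cancel (Q.trans (Q.reflexive (to∘from x))
      (Q.trans x≤y (Q.reflexive (Q.Eq.sym (to∘from y))))))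
    (λ {x} {y} p → Q.trans (Q.reflexive (Q.Eq.sym (to∘from x)))
      (Q.trans (I.mono p) (Q.reflexive (to∘from y))))
    (λ x → I.injective (to∘from (proj₁ (iso P≃Q) x)))

  Interval-≃ : ∀ x y → Interval P x y ≃ Interval Q (proj₁ (iso P≃Q) x) (proj₁ (iso P≃Q) y)
  Interval-≃ x y = mk≃ (Interval P x y) (Interval Q (proj₁ (iso P≃Q) x) (proj₁ (iso P≃Q) y))
    (λ (z , p , q) → proj₁ (iso P≃Q) z , I.mono p , I.mono q)
    (λ (w , p , q) → from w
      , I.cancel (Q.trans p (Q.reflexive (Q.Eq.sym (to∘from w))))
      , I.cancel (Q.trans (Q.reflexive (to∘from w)) q))
    I.mono I.cancel (λ (w , _) → to∘from w)

≃-trans : {P : Poset p₁ p₂ p₃} {Q : Poset q₁ q₂ q₃} {R : Poset r₁ r₂ r₃} →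
          P ≃ Q → Q ≃ R → P ≃ R
≃-trans {R = R} ⟨ f , F ⟩ ⟨ g , G ⟩ =
  ⟨ g ∘ f , Composition.isOrderIsomorphism (Poset.Eq.trans R) F G ⟩

×-≃ : {P : Poset p₁ p₂ p₃} {Q : Poset q₁ q₂ q₃} {R : Poset r₁ r₂ r₃} {S : Poset s₁ s₂ s₃} →
      P ≃ R → Q ≃ S → ×-poset P Q ≃ ×-poset R S
×-≃ {P = P} {Q} {R} {S} ⟨ f , F ⟩ ⟨ g , G ⟩ = mk≃ (×-poset P Q) (×-poset R S)
  (λ (x , y) → f x , g y)
  (λ (x , y) → proj₁ (F.surjective x) , proj₁ (G.surjective y))
  (λ (p , q) → F.mono p , G.mono q)
  (λ (p , q) → F.cancel p , G.cancel q)
  (λ (x , y) → proj₂ (F.surjective x) (Poset.Eq.refl P) , proj₂ (G.surjective y) (Poset.Eq.refl Q))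
  where
  module F = IsOrderIsomorphism F
  module G = IsOrderIsomorphism G

×-assoc-≃ : (P : Poset p₁ p₂ p₃) (Q : Poset q₁ q₂ q₃) (R : Poset r₁ r₂ r₃) →
            ×-poset (×-poset P Q) R ≃ ×-poset P (×-poset Q R)
×-assoc-≃ P Q R = mk≃ (×-poset (×-poset P Q) R) (×-poset P (×-poset Q R))
  (λ ((x , y) , z) → x , y , z) (λ (x , y , z) → (x , y) , z)
  (λ ((p , q) , r) → p , q , r) (λ (p , q , r) → (p , q) , r)
  (λ _ → Poset.Eq.refl P , Poset.Eq.refl Q , Poset.Eq.refl R)

×-comm-≃ : (P : Poset p₁ p₂ p₃) (Q : Poset q₁ q₂ q₃) → ×-poset P Q ≃ ×-poset Q P
×-comm-≃ P Q = mk≃ (×-poset P Q) (×-poset Q P)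
  (λ (x , y) → y , x) (λ (x , y) → y , x)
  (λ (p , q) → q , p) (λ (p , q) → q , p)
  (λ _ → Poset.Eq.refl Q , Poset.Eq.refl P)

-- Up to its equivalence `U` is a point. It will be the empty product, or the product whose only
-- factor is `NC 1`.
×-identityʳ-≃ : (P : Poset p₁ p₂ p₃) (U : Poset q₁ q₂ q₃) (u : Poset.Carrier U) →
                (∀ x y → Poset._≤_ U x y) → P ≃ ×-poset P U
×-identityʳ-≃ P U u total = mk≃ P (×-poset P U) (λ x → x , u) proj₁
  (λ p → p , Poset.refl U) proj₁
  (λ y → Poset.Eq.refl P , Poset.antisym U (total _ _) (total _ _))

Interval-× : (P : Poset p₁ p₂ p₃) (Q : Poset q₁ q₂ q₃) (x y : Poset.Carrier (×-poset P Q)) →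
             Interval (×-poset P Q) x y ≃
             ×-poset (Interval P (proj₁ x) (proj₁ y)) (Interval Q (proj₂ x) (proj₂ y))
Interval-× P Q x y =
  mk≃ (Interval (×-poset P Q) x y)
      (×-poset (Interval P (proj₁ x) (proj₁ y)) (Interval Q (proj₂ x) (proj₂ y)))
  (λ ((z , w) , (p , q) , (r , s)) → (z , p , r) , (w , q , s))
  (λ ((z , p , r) , (w , q , s)) → (z , w) , (p , q) , (r , s))
  id id (λ _ → Poset.Eq.refl P , Poset.Eq.refl Q)

module _ (P : Poset p₁ p₂ p₃) where
  open Poset P renaming (_≤_ to _≤ᴾ_; trans to ≤-trans)

  Interval-Interval : ∀ {x y} (z w : Poset.Carrier (Interval P x y)) →
                      Interval (Interval P x y) z w ≃ Interval P (proj₁ z) (proj₁ w)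
  Interval-Interval {x} {y} z@(_ , x≤z , _) w@(_ , _ , w≤y) =
    mk≃ (Interval (Interval P x y) z w) (Interval P (proj₁ z) (proj₁ w))
    (λ ((v , _) , p , q) → v , p , q)
    (λ (v , p , q) → (v , ≤-trans x≤z p , ≤-trans q w≤y) , p , q)
    id id (λ _ → Eq.refl)

  Interval-≈ : ∀ {x x′ y y′} → x ≈ x′ → y ≈ y′ → Interval P x y ≃ Interval P x′ y′
  Interval-≈ {x} {x′} {y} {y′} e f = mk≃ (Interval P x y) (Interval P x′ y′)
    (λ (v , p , q) → v , ≤-trans (reflexive (Eq.sym e)) p , ≤-trans q (reflexive f))
    (λ (v , p , q) → v , ≤-trans (reflexive e) p , ≤-trans q (reflexive (Eq.sym f)))
    id id (λ _ → Eq.refl)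

IsNCProduct : Poset p₁ p₂ p₃ → Set (lsuc 0ℓ ⊔ p₁ ⊔ p₂ ⊔ p₃)
IsNCProduct P = ∃[ j ] Σ[ m ∈ (Fin j → ℕ) ]
  1 ≤ j × ((i : Fin j) → 1 ≤ m i) × P ≃ ∏ (λ i → NC (m i))

IsPF×NCProduct : Poset p₁ p₂ p₃ → Set (lsuc 0ℓ ⊔ p₁ ⊔ p₂ ⊔ p₃)
IsPF×NCProduct P = ∃[ r ] ∃[ j ] Σ[ m ∈ (Fin j → ℕ) ]
  2 ≤ r × 1 ≤ j × ((i : Fin j) → 1 ≤ m i) ×
  P ≃ ×-poset (PosetPF r r) (∏ (λ i → NC (m i)))

Decomposes : Poset p₁ p₂ p₃ → Set (lsuc 0ℓ ⊔ p₁ ⊔ p₂ ⊔ p₃)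
Decomposes P = IsPF×NCProduct P ⊎ IsNCProduct P

∏-cons : ∀ {j} (m₀ : ℕ) (m : Fin j → ℕ) →
         ×-poset (NC m₀) (∏ (λ i → NC (m i))) ≃ ∏ (λ i → NC ((m₀ ∷ m) i))
∏-cons m₀ m = mk≃ (×-poset (NC m₀) (∏ (λ i → NC (m i)))) (∏ (λ i → NC ((m₀ ∷ m) i)))
  (λ { (x , y) Fin.zero → x ; (x , y) (Fin.suc i) → y i })
  (λ z → z Fin.zero , λ i → z (Fin.suc i))
  (λ { (p , q) Fin.zero → p ; (p , q) (Fin.suc i) → q i })
  (λ p → p Fin.zero , λ i → p (Fin.suc i))
  (λ { z Fin.zero → id , id ; z (Fin.suc i) → id , id })

≃-refl : {P : Poset p₁ p₂ p₃} → P ≃ P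
≃-refl {P = P} = mk≃ P P id id id id (λ _ → Poset.Eq.refl P)

∏-× : ∀ j {j′} (m : Fin j → ℕ) (m′ : Fin j′ → ℕ) →
      (∀ i → 1 ≤ m i) → (∀ i → 1 ≤ m′ i) →
      Σ[ m″ ∈ (Fin (j + j′) → ℕ) ] (∀ i → 1 ≤ m″ i) ×
      ×-poset (∏ (λ i → NC (m i))) (∏ (λ i → NC (m′ i))) ≃ ∏ (λ i → NC (m″ i))
∏-× zero m m′ _ m′≥1 = m′ , m′≥1 ,
  ≃-trans (×-comm-≃ (∏ (λ i → NC (m i))) (∏ (λ i → NC (m′ i))))
          (≃-sym (×-identityʳ-≃ (∏ (λ i → NC (m′ i))) (∏ (λ i → NC (m i))) (λ ()) (λ _ _ ())))
∏-× (suc j) m m′ m≥1 m′≥1 with ∏-× j (m ∘ Fin.suc) m′ (m≥1 ∘ Fin.suc) m′≥1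
... | m″ , m″≥1 , ∏×∏≃∏ = (m Fin.zero ∷ m″)
  , (λ { Fin.zero → m≥1 Fin.zero ; (Fin.suc i) → m″≥1 i })
  , ≃-trans (×-≃ uncons ≃-refl)
    (≃-trans (×-assoc-≃ (NC (m Fin.zero)) (∏ (λ i → NC (m (Fin.suc i)))) (∏ (λ i → NC (m′ i))))
    (≃-trans (×-≃ ≃-refl ∏×∏≃∏) (∏-cons (m Fin.zero) m″)))
  where
  uncons : ∏ (λ i → NC (m i)) ≃ ×-poset (NC (m Fin.zero)) (∏ (λ i → NC (m (Fin.suc i))))
  uncons = mk≃ (∏ (λ i → NC (m i))) (×-poset (NC (m Fin.zero)) (∏ (λ i → NC (m (Fin.suc i)))))
    (λ z → z Fin.zero , λ i → z (Fin.suc i))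
    (λ { (x , y) Fin.zero → x ; (x , y) (Fin.suc i) → y i })
    (λ p → p Fin.zero , λ i → p (Fin.suc i))
    (λ { (p , q) Fin.zero → p ; (p , q) (Fin.suc i) → q i })
    (λ _ → (id , id) , λ _ → id , id)

IsNCProduct-resp-≃ : {P : Poset p₁ p₂ p₃} {Q : Poset q₁ q₂ q₃} → P ≃ Q → IsNCProduct Q → IsNCProduct P
IsNCProduct-resp-≃ e (j , m , j≥1 , m≥1 , f) = j , m , j≥1 , m≥1 , ≃-trans e f

IsNCProduct-NC : ∀ {m} → 1 ≤ m → IsNCProduct (NC m)
IsNCProduct-NC {m} m≥1 = 1 , (λ _ → m) , ℕₚ.≤-refl , (λ _ → m≥1) ,
  mk≃ (NC m) (∏ (λ _ → NC m)) (λ x _ → x) (λ f → f Fin.zero) (λ p _ → p) (λ p → p Fin.zero)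
    (λ { _ Fin.zero → id , id })

IsNCProduct-× : {P : Poset p₁ p₂ p₃} {Q : Poset q₁ q₂ q₃} →
                IsNCProduct P → IsNCProduct Q → IsNCProduct (×-poset P Q)
IsNCProduct-× (j , m , j≥1 , m≥1 , e) (j′ , m′ , _ , m′≥1 , f) =
  let m″ , m″≥1 , g = ∏-× j m m′ m≥1 m′≥1 in
  j + j′ , m″ , ℕₚ.≤-trans j≥1 (ℕₚ.m≤m+n j j′) , m″≥1 , ≃-trans (×-≃ e f) g

Decomposes-resp-≃ : {P : Poset p₁ p₂ p₃} {Q : Poset q₁ q₂ q₃} → P ≃ Q → Decomposes Q → Decomposes P
Decomposes-resp-≃ e (inj₁ (r , j , m , r≥2 , j≥1 , m≥1 , f)) =
  inj₁ (r , j , m , r≥2 , j≥1 , m≥1 , ≃-trans e f)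
Decomposes-resp-≃ e (inj₂ q) = inj₂ (IsNCProduct-resp-≃ e q)

-- The theorem asks for at least one factor, so the one-element lattice `NC 1` is supplied.
Decomposes-PosetPF : ∀ {r} → 2 ≤ r → Decomposes (PosetPF r r)
Decomposes-PosetPF {r} r≥2 = inj₁ (r , 1 , (λ _ → 1) , r≥2 , ℕₚ.≤-refl , (λ _ → ℕₚ.≤-refl) ,
  ×-identityʳ-≃ (PosetPF r r) (∏ (λ _ → NC 1)) (λ _ → discrete)
    (λ _ y i → λ { {Fin.zero} {Fin.zero} _ → IsDecEquivalence.refl (isDecEquivalence (y i)) }))
  where
  open NoncrossingPartition using (isDecEquivalence)
  discrete : NoncrossingPartition 1
  discrete = record
    { SameBlock        = _≡_
    ; isDecEquivalence = Finₚ.≡-isDecEquivalence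
    ; noncrossing      = λ { {a = Fin.zero} {Fin.zero} () }
    }

Decomposes-× : {P : Poset p₁ p₂ p₃} {Q : Poset q₁ q₂ q₃} →
               Decomposes P → IsNCProduct Q → Decomposes (×-poset P Q)
Decomposes-× {P = P} {Q} (inj₁ (r , j , m , r≥2 , j≥1 , m≥1 , e)) (j′ , m′ , _ , m′≥1 , f) =
  let m″ , m″≥1 , g = ∏-× j m m′ m≥1 m′≥1 in
  inj₁ (r , j + j′ , m″ , r≥2 , ℕₚ.≤-trans j≥1 (ℕₚ.m≤m+n j j′) , m″≥1 ,
    ≃-trans (×-≃ e f)
    (≃-trans (×-assoc-≃ (PosetPF r r) (∏ (λ i → NC (m i))) (∏ (λ i → NC (m′ i))))
    (×-≃ ≃-refl g)))
Decomposes-× (inj₂ p) q = inj₂ (IsNCProduct-× p q)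

-- Noncrossing partitions and marked orders on them

least : {P : Pred (Fin N) 0ℓ} → Decidable P → ∃ P → ∃[ x ] P x × (∀ {y} → P y → x Fin.≤ y)
least {zero} P? (() , _)
least {suc N} P? (w , Pw) with P? Fin.zero
... | yes P0 = Fin.zero , P0 , λ _ → z≤n
least {suc N} P? (Fin.zero , Pw)  | no ¬P0 = contradiction Pw ¬P0
least {suc N} P? (Fin.suc w , Pw) | no ¬P0 with least (P? ∘ Fin.suc) (w , Pw)
... | x , Px , x-least = Fin.suc x , Px ,
  λ { {Fin.zero} P0 → contradiction P0 ¬P0 ; {Fin.suc y} Py → s≤s (x-least Py) }

greatest : {P : Pred (Fin N) 0ℓ} → Decidable P → ∃ P → ∃[ x ] P x × (∀ {y} → P y → y Fin.≤ x)
greatest {zero} P? (() , _)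
greatest {suc N} P? (w , Pw) with Finₚ.any? (P? ∘ Fin.suc)
... | yes ∃P = let x , Px , x-greatest = greatest (P? ∘ Fin.suc) ∃P in
  Fin.suc x , Px , λ { {Fin.zero} _ → z≤n ; {Fin.suc y} Py → s≤s (x-greatest Py) }
greatest {suc N} P? (Fin.zero , Pw)  | no ∄P =
  Fin.zero , Pw , λ { {Fin.zero} _ → z≤n ; {Fin.suc y} Py → contradiction (y , Py) ∄P }
greatest {suc N} P? (Fin.suc w , Pw) | no ∄P = contradiction (w , Pw) ∄P

≤⇒<∨≡ : {x y : Fin N} → x Fin.≤ y → x Fin.< y ⊎ x ≡ y
≤⇒<∨≡ x≤y with ℕₚ.m≤n⇒m<n∨m≡n x≤y
... | inj₁ x<y = inj₁ x<y
... | inj₂ x≡y = inj₂ (Finₚ.toℕ-injective x≡y)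

infix 4 _[_~_] _⊑_

_[_~_] : NoncrossingPartition N → Fin N → Fin N → Set
σ [ x ~ y ] = SameBlock σ x y

module _ (σ : NoncrossingPartition N) where
  private
    module σ = NoncrossingPartition σ
    module E = IsDecEquivalence σ.isDecEquivalence

  ~-refl : ∀ {x} → σ [ x ~ x ]
  ~-refl = E.refl

  ~-sym : ∀ {x y} → σ [ x ~ y ] → σ [ y ~ x ]
  ~-sym = E.sym

  ~-trans : ∀ {x y z} → σ [ x ~ y ] → σ [ y ~ z ] → σ [ x ~ z ]
  ~-trans = E.trans

  ~-dec : ∀ x y → Dec (σ [ x ~ y ])
  ~-dec = E._≟_

  ~-reflexive : ∀ {x y} → x ≡ y → σ [ x ~ y ]
  ~-reflexive refl = ~-refl

  -- The weak inequalities make it applicable to images under maps that are monotone but not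
  -- injective, as in `pullback`.
  cross : ∀ {w x y z} → w Fin.≤ x → x Fin.≤ y → y Fin.≤ z →
          σ [ w ~ y ] → σ [ x ~ z ] → σ [ w ~ x ]
  cross w≤x x≤y y≤z w~y x~z with ≤⇒<∨≡ w≤x | ≤⇒<∨≡ x≤y | ≤⇒<∨≡ y≤z
  ... | inj₁ w<x  | inj₁ x<y  | inj₁ y<z  = σ.noncrossing w<x x<y y<z w~y x~z
  ... | inj₂ refl | _         | _         = ~-refl
  ... | inj₁ _    | inj₂ refl | _         = w~y
  ... | inj₁ _    | inj₁ _    | inj₂ refl = ~-trans w~y (~-sym x~z)

-- A record, unlike the order of `NC`, which unfolds to an implication, lets both partitions be
-- inferred.
record _⊑_ (σ τ : NoncrossingPartition N) : Set where
  constructor ⊑⟨_⟩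
  field apply : ∀ {x y} → σ [ x ~ y ] → τ [ x ~ y ]

open _⊑_

⊑-refl : {σ : NoncrossingPartition N} → σ ⊑ σ
⊑-refl = ⊑⟨ id ⟩

⊑-trans : {σ π τ : NoncrossingPartition N} → σ ⊑ π → π ⊑ τ → σ ⊑ τ
⊑-trans p q = ⊑⟨ apply q ∘ apply p ⟩

0̂ 1̂ : NoncrossingPartition N
0̂ = record
  { SameBlock        = _≡_
  ; isDecEquivalence = Finₚ.≡-isDecEquivalence
  ; noncrossing      = λ { a<b b<c _ refl _ → contradiction (ℕₚ.<-trans a<b b<c) (ℕₚ.<-irrefl refl) }
  }
1̂ = record
  { SameBlock        = λ _ _ → ⊤
  ; isDecEquivalence = record
    { isEquivalence = record { refl = tt ; sym = λ _ → tt ; trans = λ _ _ → tt }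
    ; _≟_           = λ _ _ → yes tt
    }
  ; noncrossing      = λ _ _ _ _ _ → tt
  }

0̂-minimum : {σ : NoncrossingPartition N} → 0̂ ⊑ σ
0̂-minimum {σ = σ} = ⊑⟨ ~-reflexive σ ⟩

1̂-maximum : {σ : NoncrossingPartition N} → σ ⊑ 1̂
1̂-maximum = ⊑⟨ (λ _ → tt) ⟩

pullback : (h : Fin M → Fin N) → (∀ {x y} → x Fin.≤ y → h x Fin.≤ h y) →
           NoncrossingPartition N → NoncrossingPartition M
pullback h h-mono σ = record
  { SameBlock        = λ x y → σ [ h x ~ h y ]
  ; isDecEquivalence = record
    { isEquivalence = record { refl = ~-refl σ ; sym = ~-sym σ ; trans = ~-trans σ }
    ; _≟_           = λ x y → ~-dec σ (h x) (h y)
    }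
  ; noncrossing      = λ a<b b<c c<d →
      cross σ (h-mono (ℕₚ.<⇒≤ a<b)) (h-mono (ℕₚ.<⇒≤ b<c)) (h-mono (ℕₚ.<⇒≤ c<d))
  }

infixl 7 _⊓_

_⊓_ : NoncrossingPartition N → NoncrossingPartition N → NoncrossingPartition N
σ ⊓ τ = record
  { SameBlock        = λ x y → σ [ x ~ y ] × τ [ x ~ y ]
  ; isDecEquivalence = record
    { isEquivalence = record
      { refl  = ~-refl σ , ~-refl τ
      ; sym   = λ (p , q) → ~-sym σ p , ~-sym τ q
      ; trans = λ (p , q) (p′ , q′) → ~-trans σ p p′ , ~-trans τ q q′
      }
    ; _≟_           = λ x y → ~-dec σ x y ×-dec ~-dec τ x y
    }
  ; noncrossing      = λ a<b b<c c<d (p , q) (p′ , q′) →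
      NoncrossingPartition.noncrossing σ a<b b<c c<d p p′ ,
      NoncrossingPartition.noncrossing τ a<b b<c c<d q q′
  }

-- Pairs to be removed from the refinement order. `irrefl` keeps the rest reflexive, and `cut` is
-- its transitivity in contrapositive form.
record Marking (N : ℕ) : Set₁ where
  field
    Bad    : NoncrossingPartition N → NoncrossingPartition N → Set
    irrefl : ∀ {σ τ} → τ ⊑ σ → ¬ Bad σ τ
    cut    : ∀ {σ π τ} → σ ⊑ π → π ⊑ τ → Bad σ τ → Bad σ π ⊎ Bad π τ

open Marking using (Bad)

⟦_⟧ : Marking N → Poset (lsuc 0ℓ) 0ℓ 0ℓ
⟦_⟧ {N} 𝓜 = record
  { Carrier        = NoncrossingPartition N
  ; _≈_            = λ σ τ → σ ⊑ τ × τ ⊑ σ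
  ; _≤_            = λ σ τ → σ ⊑ τ × ¬ Bad 𝓜 σ τ
  ; isPartialOrder = record
    { isPreorder = record
      { isEquivalence = record
        { refl  = ⊑-refl , ⊑-refl
        ; sym   = λ (p , q) → q , p
        ; trans = λ (p , q) (p′ , q′) → ⊑-trans p p′ , ⊑-trans q′ q
        }
      ; reflexive = λ (p , q) → p , Marking.irrefl 𝓜 q
      ; trans     = λ (p , ¬p) (q , ¬q) → ⊑-trans p q , λ b → [ ¬p , ¬q ]′ (Marking.cut 𝓜 p q b)
      }
    ; antisym = λ (p , _) (q , _) → p , q
    }
  }

unmarked : Marking N
unmarked = record { Bad = λ _ _ → ⊥ ; irrefl = λ _ () ; cut = λ _ _ () }

-- The chains of PF(n,k) never merge a block with maximum u = k into the block
-- with minimum v = k + 1.  For BadPair u v σ τ such a merge is unavoidable on the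
-- way from σ to τ, because the block of u already contains the minimum of the
-- block of τ in which u and v end up.
record BadPair (u v : Fin N) (σ τ : NoncrossingPartition N) : Set where
  field
    v-min : ∀ {y} → σ [ v ~ y ] → v Fin.≤ y
    u~v   : τ [ u ~ v ]
    x     : Fin N
    x~u   : σ [ x ~ u ]
    x-min : ∀ {y} → τ [ u ~ y ] → x Fin.≤ y

mark : (u v : Fin N) → toℕ v ≡ suc (toℕ u) → Marking N
mark u v v≡1+u = record { Bad = BadPair u v ; irrefl = irr ; cut = cut }
  where
  u<v : u Fin.< v
  u<v = ℕₚ.≤-reflexive (sym v≡1+u)

  irr : ∀ {σ τ} → τ ⊑ σ → ¬ BadPair u v σ τ
  irr {σ} τ⊑σ B = ℕₚ.<⇒≱ u<v (B.v-min (~-sym σ (apply τ⊑σ B.u~v)))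
    where module B = BadPair B

  -- While `u` and `v` are apart in π, an element `y < v` of the block of `v` would lie between `x`
  -- and `u`, and the chords from `x` to `u` and from `y` to `v` would cross. So `v` is still a
  -- minimum in π, and the badness passes to the half in which `u` and `v` meet.
  cut : ∀ {σ π τ} → σ ⊑ π → π ⊑ τ → BadPair u v σ τ → BadPair u v σ π ⊎ BadPair u v π τ
  cut {σ} {π} {τ} σ⊑π π⊑τ B with ~-dec π u v
  ... | yes u~v = inj₁ record
    { v-min = B.v-min ; u~v = u~v ; x = B.x ; x~u = B.x~u ; x-min = B.x-min ∘ apply π⊑τ }
    where module B = BadPair B
  ... | no u≁v = inj₂ record
    { v-min = v-min ; u~v = B.u~v ; x = B.x ; x~u = apply σ⊑π B.x~u ; x-min = B.x-min }
    where
    module B = BadPair B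
    v-min : ∀ {y} → π [ v ~ y ] → v Fin.≤ y
    v-min {y} v~y = ℕₚ.≮⇒≥ λ y<v →
      let y≤u = ℕₚ.m<1+n⇒m≤n (subst (toℕ y <_) v≡1+u y<v)
          x≤y = B.x-min (~-trans τ B.u~v (apply π⊑τ v~y))
          x~u = apply σ⊑π B.x~u
          x~y = cross π x≤y y≤u (ℕₚ.<⇒≤ u<v) x~u (~-sym π v~y)
      in u≁v (~-trans π (~-sym π x~u) (~-trans π x~y (~-sym π v~y)))

-- Cutting intervals into products

record Enumeration {N : ℕ} (P : Pred (Fin N) 0ℓ) : Set where
  field
    size  : ℕ
    at    : Fin size → Fin N
    mono  : ∀ {x y} → x Fin.< y → at x Fin.< at y
    at∈   : ∀ x → P (at x)
    index : ∀ {y} → P y → ∃[ x ] at x ≡ y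

  reflects-≤ : ∀ {x y} → at x Fin.≤ at y → x Fin.≤ y
  reflects-≤ p = ℕₚ.≮⇒≥ λ y<x → ℕₚ.<⇒≱ (mono y<x) p

  preserves-≤ : ∀ {x y} → x Fin.≤ y → at x Fin.≤ at y
  preserves-≤ p with ≤⇒<∨≡ p
  ... | inj₁ x<y  = ℕₚ.<⇒≤ (mono x<y)
  ... | inj₂ refl = ℕₚ.≤-refl

  injective : ∀ {x y} → at x ≡ at y → x ≡ y
  injective e = Finₚ.toℕ-injective
    (ℕₚ.≤-antisym (reflects-≤ (ℕₚ.≤-reflexive (cong toℕ e))) (reflects-≤ (ℕₚ.≤-reflexive (cong toℕ (sym e)))))

  -- Prepending the missed `y` to the enumeration leaves it injective. This makes both factors of a
  -- cut smaller, as the induction on `N` requires.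
  size<N : ∀ {y} → ¬ P y → size < N
  size<N {y} ¬Py = Finₚ.injective⇒≤ {f = at⁺} at⁺-injective
    where
    at⁺ : Fin (suc size) → Fin N
    at⁺ Fin.zero    = y
    at⁺ (Fin.suc x) = at x
    at⁺-injective : ∀ {x z} → at⁺ x ≡ at⁺ z → x ≡ z
    at⁺-injective {Fin.zero}  {Fin.zero}  _ = refl
    at⁺-injective {Fin.zero}  {Fin.suc z} e = contradiction (subst P (sym e) (at∈ z)) ¬Py
    at⁺-injective {Fin.suc x} {Fin.zero}  e = contradiction (subst P e (at∈ x)) ¬Py
    at⁺-injective {Fin.suc x} {Fin.suc z} e = cong Fin.suc (injective e)

enumerate : {P : Pred (Fin N) 0ℓ} → Decidable P → Enumeration P
enumerate {zero} P? = record
  { size = 0 ; at = λ () ; mono = λ { {()} } ; at∈ = λ () ; index = λ { {()} } }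
enumerate {suc N} P? with P? Fin.zero | enumerate (P? ∘ Fin.suc)
... | yes P0 | E = record
  { size  = suc E.size
  ; at    = λ { Fin.zero → Fin.zero ; (Fin.suc x) → Fin.suc (E.at x) }
  ; mono  = λ { {Fin.zero} {Fin.suc y} _ → s≤s z≤n ; {Fin.suc x} {Fin.suc y} (s≤s x<y) → s≤s (E.mono x<y) }
  ; at∈   = λ { Fin.zero → P0 ; (Fin.suc x) → E.at∈ x }
  ; index = λ { {Fin.zero} _ → Fin.zero , refl
              ; {Fin.suc y} Py → let x , e = E.index Py in Fin.suc x , cong Fin.suc e }
  }
  where module E = Enumeration E
... | no ¬P0 | E = record
  { size  = E.size
  ; at    = Fin.suc ∘ E.at
  ; mono  = s≤s ∘ E.mono
  ; at∈   = E.at∈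
  ; index = λ { {Fin.zero} P0 → contradiction P0 ¬P0
              ; {Fin.suc y} Py → let x , e = E.index Py in x , cong Fin.suc e }
  }
  where module E = Enumeration E

true≢false : {A : Set} {b : Bool} → b ≡ true → b ≡ false → A
true≢false refl ()

-- A cut of [N] into an interval (side ≡ true) and its complement.  A partition
-- for which either the two sides are unrelated or I and J are in one block is
-- determined by its restrictions to the two sides.
record Cut (N : ℕ) : Set₁ where
  field
    side   : Fin N → Bool
    convex : ∀ {x y z} → x Fin.≤ y → y Fin.≤ z → side x ≡ true → side z ≡ true → side y ≡ true
    I J    : Fin N
    I∈     : side I ≡ true
    J∉     : side J ≡ false
    I-min  : ∀ {x} → side x ≡ true → I Fin.≤ x
    J-adjacentʳ : ∀ {x y} → side x ≡ true → side y ≡ false → x Fin.≤ y → J Fin.≤ y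
    J-adjacentˡ : ∀ {x y} → side x ≡ true → side y ≡ false → y Fin.≤ x → y Fin.≤ J
    bridge : ∀ π {x y} → side x ≡ true → side y ≡ false → π [ I ~ J ] → π [ x ~ y ] → π [ x ~ I ]

  side? : ∀ x → side x ≡ true ⊎ side x ≡ false
  side? x with side x
  ... | true  = inj₁ refl
  ... | false = inj₂ refl

  private
    In : Enumeration (λ x → side x ≡ true)
    In = enumerate (λ x → side x Boolₚ.≟ true)

    Out : Enumeration (λ x → side x ≡ false)
    Out = enumerate (λ x → side x Boolₚ.≟ false)

  module In = Enumeration In
  module Out = Enumeration Out

  s c : ℕ
  s = In.size
  c = Out.size

  s<N : s < N
  s<N = In.size<N (λ p → true≢false p J∉)

  c<N : c < N
  c<N = Out.size<N (λ p → true≢false I∈ p)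

  f : Fin s → Fin N
  f = In.at

  g : Fin c → Fin N
  g = Out.at

  i : Fin s
  i = proj₁ (In.index I∈)

  j : Fin c
  j = proj₁ (Out.index J∉)

  fi≡I : f i ≡ I
  fi≡I = proj₂ (In.index I∈)

  gj≡J : g j ≡ J
  gj≡J = proj₂ (Out.index J∉)

  locate : ∀ x → (side x ≡ true × ∃[ y ] f y ≡ x) ⊎ (side x ≡ false × ∃[ z ] g z ≡ x)
  locate x with side? x
  ... | inj₁ p = inj₁ (p , In.index p)
  ... | inj₂ n = inj₂ (n , Out.index n)

  -- `q` and `h` retract [N] onto the two sides and send the opposite side to the junction point `i`
  -- or `j`. Outside this block they are known only through the four equations that follow them.
  abstract
    q : Fin N → Fin s
    q x = [ (λ (_ , y , _) → y) , (λ _ → i) ]′ (locate x)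

    h : Fin N → Fin c
    h x = [ (λ _ → j) , (λ (_ , z , _) → z) ]′ (locate x)

    f∘q : ∀ {x} → side x ≡ true → f (q x) ≡ x
    f∘q {x} p with locate x
    ... | inj₁ (_ , _ , e) = e
    ... | inj₂ (n , _)     = true≢false p n

    g∘h : ∀ {x} → side x ≡ false → g (h x) ≡ x
    g∘h {x} n with locate x
    ... | inj₁ (p , _)     = true≢false p n
    ... | inj₂ (_ , _ , e) = e

    q-out : ∀ {x} → side x ≡ false → q x ≡ i
    q-out {x} n with locate x
    ... | inj₁ (p , _) = true≢false p n
    ... | inj₂ _       = refl

    h-in : ∀ {x} → side x ≡ true → h x ≡ j
    h-in {x} p with locate x
    ... | inj₁ _       = refl
    ... | inj₂ (n , _) = true≢false p n

  q∘f : ∀ y → q (f y) ≡ y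
  q∘f y = In.injective (f∘q (In.at∈ y))

  h∘g : ∀ z → h (g z) ≡ z
  h∘g z = Out.injective (g∘h (Out.at∈ z))

  i-min : ∀ y → i Fin.≤ y
  i-min y = In.reflects-≤ (subst (Fin._≤ f y) (sym fi≡I) (I-min (In.at∈ y)))

  q-mono : ∀ {x y} → side x ≡ true → side y ≡ true → x Fin.≤ y → q x Fin.≤ q y
  q-mono p p′ x≤y = In.reflects-≤ (subst₂ Fin._≤_ (sym (f∘q p)) (sym (f∘q p′)) x≤y)

  -- The inner side is contracted to `J`; by the two adjacency conditions no other outer element
  -- lies between it and `J`.
  h-mono : ∀ {x y} → x Fin.≤ y → h x Fin.≤ h y
  h-mono {x} {y} x≤y with side? x | side? y
  ... | inj₁ ex | inj₁ ey = ℕₚ.≤-reflexive (cong toℕ (trans (h-in ex) (sym (h-in ey))))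
  ... | inj₁ ex | inj₂ ey = subst (Fin._≤ h y) (sym (h-in ex))
    (Out.reflects-≤ (subst₂ Fin._≤_ (sym gj≡J) (sym (g∘h ey)) (J-adjacentʳ ex ey x≤y)))
  ... | inj₂ ex | inj₁ ey = subst (h x Fin.≤_) (sym (h-in ey))
    (Out.reflects-≤ (subst₂ Fin._≤_ (sym (g∘h ex)) (sym gj≡J) (J-adjacentˡ ey ex x≤y)))
  ... | inj₂ ex | inj₂ ey =
    Out.reflects-≤ (subst₂ Fin._≤_ (sym (g∘h ex)) (sym (g∘h ey)) x≤y)

  infix 8 _∣f _∣g

  _∣f : NoncrossingPartition N → NoncrossingPartition s
  π ∣f = pullback f In.preserves-≤ π

  _∣g : NoncrossingPartition N → NoncrossingPartition c
  π ∣g = pullback g Out.preserves-≤ π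

  -- The pullback along q, which is only cyclically monotone.
  collapse : NoncrossingPartition s → NoncrossingPartition N
  collapse α = record
    { SameBlock        = λ x y → α [ q x ~ q y ]
    ; isDecEquivalence = record
      { isEquivalence = record { refl = ~-refl α ; sym = ~-sym α ; trans = ~-trans α }
      ; _≟_           = λ x y → ~-dec α (q x) (q y)
      }
    ; noncrossing      = λ a<b b<c c<d → noncrossing (ℕₚ.<⇒≤ a<b) (ℕₚ.<⇒≤ b<c) (ℕₚ.<⇒≤ c<d)
    }
    where
    out : ∀ {x} → side x ≡ false → ∀ {y} → α [ y ~ q x ] → α [ y ~ i ]
    out n {y} = subst (λ w → α [ y ~ w ]) (q-out n)

    out′ : ∀ {x} → side x ≡ false → ∀ {y} → α [ y ~ i ] → α [ y ~ q x ]
    out′ n {y} = subst (λ w → α [ y ~ w ]) (sym (q-out n))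

    noncrossing : ∀ {w x y z} → w Fin.≤ x → x Fin.≤ y → y Fin.≤ z →
                  α [ q w ~ q y ] → α [ q x ~ q z ] → α [ q w ~ q x ]
    noncrossing {w} {x} {y} {z} w≤x x≤y y≤z wy xz
      with side? w | side? x | side? y | side? z
    ... | inj₂ ew | inj₂ ex | _ | _ = ~-reflexive α (trans (q-out ew) (sym (q-out ex)))
    ... | inj₁ ew | inj₂ ex | inj₁ ey | _ = true≢false (convex w≤x x≤y ew ey) ex
    ... | inj₁ ew | inj₂ ex | inj₂ ey | _ = out′ ex (out ey wy)
    ... | inj₂ ew | inj₁ ex | _ | inj₂ ez = ~-sym α (out′ ew (out ez xz))
    ... | inj₂ ew | inj₁ ex | inj₂ ey | inj₁ ez = true≢false (convex x≤y y≤z ex ez) ey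
    ... | inj₂ ew | inj₁ ex | inj₁ ey | inj₁ ez =
      ~-sym α (out′ ew (~-sym α (cross α (i-min (q x)) (q-mono ex ey x≤y) (q-mono ey ez y≤z)
        (~-sym α (out ew (~-sym α wy))) xz)))
    ... | inj₁ ew | inj₁ ex | inj₂ ey | inj₁ ez = true≢false (convex x≤y y≤z ex ez) ey
    ... | inj₁ ew | inj₁ ex | inj₂ ey | inj₂ ez = ~-trans α (out ey wy) (~-sym α (out ez xz))
    ... | inj₁ ew | inj₁ ex | inj₁ ey | inj₁ ez =
      cross α (q-mono ew ex w≤x) (q-mono ex ey x≤y) (q-mono ey ez y≤z) wy xz
    -- The outer point `z` comes last but is sent to the least point `i`, so noncrossingness is
    -- applied to the four points after a rotation.
    ... | inj₁ ew | inj₁ ex | inj₁ ey | inj₂ ez =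
      let x~i = out ez xz
          i~w = cross α (i-min (q w)) (q-mono ew ex w≤x) (q-mono ex ey x≤y) (~-sym α x~i) wy
      in ~-sym α (~-trans α x~i i~w)

  sides : NoncrossingPartition N
  sides = record
    { SameBlock        = λ x y → side x ≡ side y
    ; isDecEquivalence = record
      { isEquivalence = record { refl = refl ; sym = sym ; trans = trans }
      ; _≟_           = λ x y → side x Boolₚ.≟ side y
      }
    ; noncrossing      = λ a<b b<c c<d → noncrossing (ℕₚ.<⇒≤ a<b) (ℕₚ.<⇒≤ b<c) (ℕₚ.<⇒≤ c<d)
    }
    where
    noncrossing : ∀ {w x y z} → w Fin.≤ x → x Fin.≤ y → y Fin.≤ z →
                  side w ≡ side y → side x ≡ side z → side w ≡ side x
    noncrossing {w} {x} w≤x x≤y y≤z wy xz with side w in ew | side x in ex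
    ... | true  | true  = refl
    ... | false | false = refl
    ... | true  | false = true≢false (convex w≤x x≤y ew (sym wy)) ex
    ... | false | true  = true≢false (convex x≤y y≤z ex (sym xz)) (sym wy)

  separator : {A : Set} → Dec A → NoncrossingPartition N
  separator (yes _) = 1̂
  separator (no _)  = sides

  -- The finest partition restricting to α and β with, if A holds, I ~ J.
  glue : NoncrossingPartition s → NoncrossingPartition c → {A : Set} → Dec A → NoncrossingPartition N
  glue α β A? = separator A? ⊓ collapse α ⊓ pullback h h-mono β

  separator-side : {A : Set} (A? : Dec A) → ∀ {x y} → side x ≡ side y → separator A? [ x ~ y ]
  separator-side (yes _) _ = tt
  separator-side (no _)  e = e

  glue-∣f : ∀ α β {A : Set} (A? : Dec A) → glue α β A? ∣f ⊑ α × α ⊑ glue α β A? ∣f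
  glue-∣f α β A? =
    ⊑⟨ (λ {y} {y′} ((_ , p) , _) → subst₂ (α [_~_]) (q∘f y) (q∘f y′) p) ⟩ ,
    ⊑⟨ (λ {y} {y′} p →
      ( separator-side A? (trans (In.at∈ y) (sym (In.at∈ y′)))
      , subst₂ (α [_~_]) (sym (q∘f y)) (sym (q∘f y′)) p)
      , ~-reflexive β (trans (h-in (In.at∈ y)) (sym (h-in (In.at∈ y′))))) ⟩

  glue-∣g : ∀ α β {A : Set} (A? : Dec A) → glue α β A? ∣g ⊑ β × β ⊑ glue α β A? ∣g
  glue-∣g α β A? =
    ⊑⟨ (λ {z} {z′} (_ , p) → subst₂ (β [_~_]) (h∘g z) (h∘g z′) p) ⟩ ,
    ⊑⟨ (λ {z} {z′} p →
      ( separator-side A? (trans (Out.at∈ z) (sym (Out.at∈ z′)))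
      , ~-reflexive α (trans (q-out (Out.at∈ z)) (sym (q-out (Out.at∈ z′)))))
      , subst₂ (β [_~_]) (sym (h∘g z)) (sym (h∘g z′)) p) ⟩

  Linked Separated Determined : NoncrossingPartition N → Set
  Linked π     = π [ I ~ J ]
  Separated π  = ∀ x y → side x ≡ true → side y ≡ false → ¬ π [ x ~ y ]
  Determined π = Linked π ⊎ Separated π

  glue-linked : ∀ α β {A : Set} (A? : Dec A) → A → Linked (glue α β A?)
  glue-linked α β (yes _) _ =
    (tt , ~-reflexive α (trans (trans (cong q (sym fi≡I)) (q∘f i)) (sym (q-out J∉)))) ,
    ~-reflexive β (trans (h-in I∈) (sym (trans (cong h (sym gj≡J)) (h∘g j))))
  glue-linked α β (no ¬A) a = contradiction a ¬A

  glue-separated : ∀ α β {A : Set} (A? : Dec A) → ¬ A → Separated (glue α β A?)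
  glue-separated α β (yes a) ¬A = contradiction a ¬A
  glue-separated α β (no _) _ x y p n ((e , _) , _) = true≢false p (trans e n)

  glue-determined : ∀ α β {A : Set} (A? : Dec A) → Determined (glue α β A?)
  glue-determined α β A?@(yes a) = inj₁ (glue-linked α β A? a)
  glue-determined α β A?@(no ¬A) = inj₂ (glue-separated α β A? ¬A)

  glue-linked⁻¹ : ∀ α β {A : Set} (A? : Dec A) → Linked (glue α β A?) → A
  glue-linked⁻¹ α β (yes a) _ = a
  glue-linked⁻¹ α β A?@(no ¬A) l = ⊥-elim (glue-separated α β A? ¬A I J I∈ J∉ l)

  ∣f-mono : ∀ {π ρ} → π ⊑ ρ → π ∣f ⊑ ρ ∣f
  ∣f-mono p = ⊑⟨ apply p ⟩

  ∣g-mono : ∀ {π ρ} → π ⊑ ρ → π ∣g ⊑ ρ ∣g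
  ∣g-mono p = ⊑⟨ apply p ⟩

  -- In a linked π a relation across the cut factors by `bridge` as `x ~ I ~ J ~ y`. Its outer parts
  -- are seen by the restrictions, its middle part by the linkage hypothesis.
  determined-⊑ : ∀ {π ρ} → Determined π → (Linked π → Linked ρ) →
                 π ∣f ⊑ ρ ∣f → π ∣g ⊑ ρ ∣g → π ⊑ ρ
  determined-⊑ {π} {ρ} D π⇒ρ πf πg = ⊑⟨ go ⟩
    where
    inside : ∀ {x y} → side x ≡ true → side y ≡ true → π [ x ~ y ] → ρ [ x ~ y ]
    inside ex ey p = subst₂ (ρ [_~_]) (f∘q ex) (f∘q ey)
      (apply πf (subst₂ (π [_~_]) (sym (f∘q ex)) (sym (f∘q ey)) p))

    outside : ∀ {x y} → side x ≡ false → side y ≡ false → π [ x ~ y ] → ρ [ x ~ y ]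
    outside ex ey p = subst₂ (ρ [_~_]) (g∘h ex) (g∘h ey)
      (apply πg (subst₂ (π [_~_]) (sym (g∘h ex)) (sym (g∘h ey)) p))

    across : ∀ {x y} → side x ≡ true → side y ≡ false → π [ x ~ y ] → ρ [ x ~ y ]
    across {x} {y} ex ey p = [ linked , (λ separated → contradiction p (separated x y ex ey)) ]′ D
      where
      linked : Linked π → _
      linked I~J =
        let x~I = bridge π ex ey I~J p
            J~y = ~-trans π (~-sym π I~J) (~-trans π (~-sym π x~I) p)
        in ~-trans ρ (inside ex I∈ x~I) (~-trans ρ (π⇒ρ I~J) (outside J∉ ey J~y))

    go : ∀ {x y} → π [ x ~ y ] → ρ [ x ~ y ]
    go {x} {y} p with side? x | side? y
    ... | inj₁ ex | inj₁ ey = inside ex ey p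
    ... | inj₁ ex | inj₂ ey = across ex ey p
    ... | inj₂ ex | inj₁ ey = ~-sym ρ (across ey ex (~-sym π p))
    ... | inj₂ ex | inj₂ ey = outside ex ey p

module _ {N : ℕ} (C : Cut N) (𝓜 : Marking N) (𝓜′ : Marking (Cut.c C))
         (σ τ : NoncrossingPartition N) where
  open Cut C

  -- `Linked σ` passes upwards and `Separated τ` passes downwards, so linkage is constant on the
  -- interval and all its members are determined by their restrictions. The inverse is therefore
  -- `glue` with the decision for σ.
  Interval-cut :
    Linked σ ⊎ Separated τ →
    (∀ {π ρ} → σ ⊑ π → π ⊑ ρ → ρ ⊑ τ →
      (Bad 𝓜 π ρ → Bad 𝓜′ (π ∣g) (ρ ∣g)) × (Bad 𝓜′ (π ∣g) (ρ ∣g) → Bad 𝓜 π ρ)) →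
    σ ⊑ τ →
    Interval ⟦ 𝓜 ⟧ σ τ ≃ ×-poset (Interval ⟦ unmarked ⟧ (σ ∣f) (τ ∣f)) (Interval ⟦ 𝓜′ ⟧ (σ ∣g) (τ ∣g))
  Interval-cut D Bad⇔Bad σ⊑τ = mk≃ (Interval ⟦ 𝓜 ⟧ σ τ)
    (×-poset (Interval ⟦ unmarked ⟧ (σ ∣f) (τ ∣f)) (Interval ⟦ 𝓜′ ⟧ (σ ∣g) (τ ∣g)))
    to from
    (λ { {π , (σ⊑π , _) , _} {ρ , _ , (ρ⊑τ , _)} (π⊑ρ , ¬bad) →
      (∣f-mono π⊑ρ , id) , (∣g-mono π⊑ρ , ¬bad ∘ proj₂ (Bad⇔Bad σ⊑π π⊑ρ ρ⊑τ)) })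
    (λ { {π , (σ⊑π , _) , (π⊑τ , _)} {ρ , (σ⊑ρ , _) , (ρ⊑τ , _)} ((πf , _) , (πg , ¬bad)) →
      let π⊑ρ = determined-⊑ (determined σ⊑π π⊑τ) (linked π⊑τ σ⊑ρ) πf πg in
      π⊑ρ , ¬bad ∘ proj₁ (Bad⇔Bad σ⊑π π⊑ρ ρ⊑τ) })
    (λ ((α , _) , (β , _)) → glue-∣f α β linked? , glue-∣g α β linked?)
    where
    linked? : Dec (Linked σ)
    linked? = ~-dec σ I J

    determined : ∀ {π} → σ ⊑ π → π ⊑ τ → Determined π
    determined σ⊑π π⊑τ = [ (λ l → inj₁ (apply σ⊑π l)) , (λ s → inj₂ (λ x y p n r → s x y p n (apply π⊑τ r))) ]′ D

    linked : ∀ {π ρ} → π ⊑ τ → σ ⊑ ρ → Linked π → Linked ρ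
    linked π⊑τ σ⊑ρ l = [ apply σ⊑ρ , (λ s → contradiction (apply π⊑τ l) (s I J I∈ J∉)) ]′ D

    to : Poset.Carrier (Interval ⟦ 𝓜 ⟧ σ τ) →
         Poset.Carrier (×-poset (Interval ⟦ unmarked ⟧ (σ ∣f) (τ ∣f)) (Interval ⟦ 𝓜′ ⟧ (σ ∣g) (τ ∣g)))
    to (π , (σ⊑π , ¬σπ) , (π⊑τ , ¬πτ)) =
      (π ∣f , (∣f-mono σ⊑π , id) , (∣f-mono π⊑τ , id)) ,
      (π ∣g , (∣g-mono σ⊑π , ¬σπ ∘ proj₂ (Bad⇔Bad ⊑-refl σ⊑π π⊑τ)) ,
              (∣g-mono π⊑τ , ¬πτ ∘ proj₂ (Bad⇔Bad σ⊑π π⊑τ ⊑-refl)))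

    from : Poset.Carrier (×-poset (Interval ⟦ unmarked ⟧ (σ ∣f) (τ ∣f)) (Interval ⟦ 𝓜′ ⟧ (σ ∣g) (τ ∣g))) →
           Poset.Carrier (Interval ⟦ 𝓜 ⟧ σ τ)
    from ((α , (σα , _) , (ατ , _)) , (β , (σβ , ¬σβ) , (βτ , ¬βτ))) =
      π , (σ⊑π , proj₂ σ≤π∣g ∘ proj₁ (Bad⇔Bad ⊑-refl σ⊑π π⊑τ)) ,
          (π⊑τ , proj₂ π∣g≤τ ∘ proj₁ (Bad⇔Bad σ⊑π π⊑τ ⊑-refl))
      where
      module P = Poset ⟦ 𝓜′ ⟧
      π = glue α β linked?
      π∣g = glue-∣g α β linked?
      σ⊑π : σ ⊑ π
      σ⊑π = determined-⊑ (determined ⊑-refl σ⊑τ) (glue-linked α β linked?)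
        (⊑-trans σα (proj₂ (glue-∣f α β linked?))) (⊑-trans σβ (proj₂ π∣g))
      π⊑τ : π ⊑ τ
      π⊑τ = determined-⊑ (glue-determined α β linked?) (apply σ⊑τ ∘ glue-linked⁻¹ α β linked?)
        (⊑-trans (proj₁ (glue-∣f α β linked?)) ατ) (⊑-trans (proj₁ π∣g) βτ)
      σ≤π∣g : (σ ∣g) P.≤ (π ∣g)
      σ≤π∣g = P.trans (σβ , ¬σβ) (P.reflexive (proj₂ π∣g , proj₁ π∣g))
      π∣g≤τ : (π ∣g) P.≤ (τ ∣g)
      π∣g≤τ = P.trans (P.reflexive π∣g) (βτ , ¬βτ)

does-true : {A : Set} (A? : Dec A) → does A? ≡ true → A
does-true (yes a) _ = a

does-false : {A : Set} (A? : Dec A) → does A? ≡ false → ¬ A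
does-false (no ¬a) _ = ¬a

-- Cuts along a half-open window

module Window {N : ℕ} (I J : Fin N) (I<J : I Fin.< J) where
  window? : (x : Fin N) → Dec (I Fin.≤ x × x Fin.< J)
  window? x = (I Finₚ.≤? x) ×-dec (x Finₚ.<? J)

  side : Fin N → Bool
  side x = does (window? x)

  inside : ∀ {x : Fin N} → side x ≡ true → I Fin.≤ x × x Fin.< J
  inside {x} = does-true (window? x)

  outside : ∀ {x : Fin N} → side x ≡ false → x Fin.< I ⊎ J Fin.≤ x
  outside {x} n with x Finₚ.<? I
  ... | yes x<I = inj₁ x<I
  ... | no x≮I  = inj₂ (ℕₚ.≮⇒≥ λ x<J → does-false (window? x) n (ℕₚ.≮⇒≥ x≮I , x<J))

  -- The window contains `I` but not `J`, so a block through both is represented in each factor, by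
  -- `I` inside and by `J` outside. `bridge` holds because an outer `y` lies on the other side of
  -- the chord from `I` to `J`.
  cut : Cut N
  cut = record
    { side        = side
    ; convex      = λ {x} {y} {z} x≤y y≤z p r → dec-true (window? y)
        (ℕₚ.≤-trans (proj₁ (inside {x} p)) x≤y , ℕₚ.≤-<-trans y≤z (proj₂ (inside {z} r)))
    ; I           = I
    ; J           = J
    ; I∈          = dec-true (window? I) (ℕₚ.≤-refl , I<J)
    ; J∉          = dec-false (window? J) (λ (_ , J<J) → ℕₚ.<-irrefl refl J<J)
    ; I-min       = λ {x} p → proj₁ (inside {x} p)
    ; J-adjacentʳ = λ {x} {y} p n x≤y →
        [ (λ y<I → contradiction (ℕₚ.≤-trans (proj₁ (inside {x} p)) x≤y) (ℕₚ.<⇒≱ y<I)) , id ]′ (outside {y} n)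
    ; J-adjacentˡ = λ {x} p _ y≤x → ℕₚ.≤-trans y≤x (ℕₚ.<⇒≤ (proj₂ (inside {x} p)))
    ; bridge      = λ π {x} {y} p n I~J x~y → let I≤x , x<J = inside {x} p in
        [ (λ y<I → ~-trans π x~y (cross π (ℕₚ.<⇒≤ y<I) I≤x (ℕₚ.<⇒≤ x<J) (~-sym π x~y) I~J))
        , (λ J≤y → ~-sym π (cross π I≤x (ℕₚ.<⇒≤ x<J) J≤y I~J x~y))
        ]′ (outside {y} n)
    }

  open Cut cut public hiding (side; I; J; convex)

successor : {y v : Fin N} → y Fin.< v → ∃[ J ] toℕ {N} J ≡ suc (toℕ y)
successor {v = v} y<v = fromℕ< 1+y<N , Finₚ.toℕ-fromℕ< 1+y<N
  where 1+y<N = ℕₚ.≤-<-trans y<v (Finₚ.toℕ<n v)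

-- The window runs from the minimum of the block of y to y, where y is the
-- greatest element outside the block of the last element v.
separate : (τ : NoncrossingPartition N) {v : Fin N} → ((x : Fin N) → x Fin.≤ v) →
           ∃[ x ] ¬ τ [ x ~ v ] →
           Σ[ I ∈ Fin N ] Σ[ J ∈ Fin N ] Σ[ I<J ∈ I Fin.< J ] Window.Separated I J I<J τ ×
             ∃[ y ] ¬ τ [ y ~ v ] × toℕ J ≡ suc (toℕ y)
separate {N} τ {v} v-last apart with greatest (λ x → ¬? (~-dec τ x v)) apart
... | y , y≁v , y-greatest with least (λ x → ~-dec τ x y) (y , ~-refl τ)
... | I , I~y , I-least with ≤⇒<∨≡ (v-last y)
... | inj₂ refl = contradiction (~-refl τ) y≁v
... | inj₁ y<v with successor y<v
... | J , J≡1+y = I , J , I<J , separated , y , y≁v , J≡1+y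
  where
  I<J : I Fin.< J
  I<J = subst (toℕ I <_) (sym J≡1+y) (s≤s (I-least (~-refl τ)))

  open Window I J I<J

  separated : Separated τ
  separated x w x∈ w∉ x~w = [ below , above ]′ (outside {w} w∉)
    where
    I≤x = proj₁ (inside {x} x∈)
    x≤y : x Fin.≤ y
    x≤y = ℕₚ.m<1+n⇒m≤n (subst (toℕ x <_) J≡1+y (proj₂ (inside {x} x∈)))

    below : ¬ w Fin.< I
    below w<I = ℕₚ.<⇒≱ w<I (I-least (~-trans τ
      (cross τ (ℕₚ.<⇒≤ w<I) I≤x x≤y (~-sym τ x~w) I~y) I~y))

    -- By the choice of `y` everything from `J` on is with `v`. Then `x ~ v`, and its chord crosses
    -- the one from `I` to `y`, putting `y` with `v`.
    above : ¬ J Fin.≤ w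
    above J≤w = y≁v (~-trans τ (~-sym τ I~y)
      (~-trans τ (cross τ I≤x x≤y (v-last y) I~y x~v) x~v))
      where
      w~v : τ [ w ~ v ]
      w~v = decidable-stable (~-dec τ w v) λ w≁v →
        ℕₚ.<⇒≱ (subst (_≤ toℕ w) J≡1+y J≤w) (y-greatest w≁v)
      x~v = ~-trans τ x~w w~v

-- Factorisation of unmarked intervals

linkedPair? : (σ : NoncrossingPartition N) → Dec (∃[ x ] ∃[ y ] x Fin.< y × σ [ x ~ y ])
linkedPair? σ = Finₚ.any? λ x → Finₚ.any? λ y → (x Finₚ.<? y) ×-dec ~-dec σ x y

unlinked⇒⊑0̂ : {σ : NoncrossingPartition N} → ¬ (∃[ x ] ∃[ y ] x Fin.< y × σ [ x ~ y ]) → σ ⊑ 0̂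
unlinked⇒⊑0̂ {σ = σ} ¬linked = ⊑⟨ (λ {x} {y} → go x y) ⟩
  where
  go : ∀ x y → σ [ x ~ y ] → x ≡ y
  go x y x~y with Finₚ.<-cmp x y
  ... | tri< x<y _ _ = contradiction (x , y , x<y , x~y) ¬linked
  ... | tri≈ _ x≡y _ = x≡y
  ... | tri> _ _ y<x = contradiction (y , x , y<x , ~-sym σ x~y) ¬linked

all~⇒1̂⊑ : {τ : NoncrossingPartition N} {v : Fin N} → ¬ (∃[ x ] ¬ τ [ x ~ v ]) → 1̂ ⊑ τ
all~⇒1̂⊑ {τ = τ} {v} ¬∃ = ⊑⟨ (λ {x} {y} _ → ~-trans τ (x~v x) (~-sym τ (x~v y))) ⟩
  where
  x~v : ∀ x → τ [ x ~ v ]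
  x~v x = decidable-stable (~-dec τ x v) (λ x≁v → ¬∃ (x , x≁v))

Interval-0̂-1̂ : Interval ⟦ unmarked ⟧ 0̂ 1̂ ≃ NC N
Interval-0̂-1̂ {N} = mk≃ (Interval ⟦ unmarked ⟧ 0̂ 1̂) (NC N) proj₁
  (λ π → π , (0̂-minimum , id) , (1̂-maximum , id))
  (λ (p , _) → apply p) (λ p → ⊑⟨ p ⟩ , id) (λ _ → id , id)

1≤size : Fin N → 1 ≤ N
1≤size {suc N} _ = s≤s z≤n

-- This is the classical fact that intervals of `NC` are products of full lattices `NC`. A related
-- pair of σ, or an element outside the τ-block of the last point, yields a cut into two smaller
-- problems.
unmarkedInterval : (σ τ : NoncrossingPartition N) → 1 ≤ N → σ ⊑ τ →
                   IsNCProduct (Interval ⟦ unmarked ⟧ σ τ)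
unmarkedInterval {N} σ τ = go σ τ (<-wellFounded N)
  where
  go : ∀ {N} (σ τ : NoncrossingPartition N) → Acc _<_ N → 1 ≤ N → σ ⊑ τ →
       IsNCProduct (Interval ⟦ unmarked ⟧ σ τ)
  go {suc n} σ τ (acc rs) _ σ⊑τ =
    cases (linkedPair? σ) (Finₚ.any? (λ x → ¬? (~-dec τ x (fromℕ n))))
    where
    cut : (C : Cut (suc n)) → Cut.Linked C σ ⊎ Cut.Separated C τ →
          IsNCProduct (Interval ⟦ unmarked ⟧ σ τ)
    cut C D = IsNCProduct-resp-≃
      (Interval-cut C unmarked unmarked σ τ D (λ _ _ _ → id , id) σ⊑τ)
      (IsNCProduct-× (go (σ ∣f) (τ ∣f) (rs s<N) (1≤size i) (∣f-mono σ⊑τ))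
                     (go (σ ∣g) (τ ∣g) (rs c<N) (1≤size j) (∣g-mono σ⊑τ)))
      where open Cut C

    cases : Dec (∃[ x ] ∃[ y ] x Fin.< y × σ [ x ~ y ]) → Dec (∃[ x ] ¬ τ [ x ~ fromℕ n ]) →
            IsNCProduct (Interval ⟦ unmarked ⟧ σ τ)
    cases (yes (I , J , I<J , I~J)) _ = cut (Window.cut I J I<J) (inj₁ I~J)
    cases (no _) (yes apart) =
      let I , J , I<J , separated , _ = separate τ Finₚ.≤fromℕ apart
      in cut (Window.cut I J I<J) (inj₂ separated)
    cases (no ¬linked) (no ¬apart) = IsNCProduct-resp-≃
      (≃-trans (Interval-≈ ⟦ unmarked ⟧ (unlinked⇒⊑0̂ ¬linked , 0̂-minimum)
                                        (1̂-maximum , all~⇒1̂⊑ ¬apart))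
               Interval-0̂-1̂)
      (IsNCProduct-NC (s≤s z≤n))

-- Parking functions and labels

argmin : (a : Vector ℕ (suc n)) → ∃[ i ] ∀ k → a i ≤ a k
argmin {zero} a = Fin.zero , λ { Fin.zero → ℕₚ.≤-refl }
argmin {suc n} a with argmin (a ∘ Fin.suc)
... | i , i-min with ℕₚ.≤-total (a Fin.zero) (a (Fin.suc i))
... | inj₁ a₀≤aᵢ = Fin.zero ,
  λ { Fin.zero → ℕₚ.≤-refl ; (Fin.suc k) → ℕₚ.≤-trans a₀≤aᵢ (i-min k) }
... | inj₂ aᵢ≤a₀ = Fin.suc i , λ { Fin.zero → aᵢ≤a₀ ; (Fin.suc k) → i-min k }

-- Selection sort, carried out together with the permutation that `IsParkingFunction` asks for as a
-- witness.
sort : (a : Vector ℕ n) → Σ[ b ∈ Vector ℕ n ] b ↭ a × (∀ {i j} → i Fin.≤ j → b i ≤ b j)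
sort {zero} a = a , (Perm.id , λ ()) , λ { {()} }
sort {suc n} a with argmin a
... | i₀ , i₀-min with sort (a ∘ punchIn i₀)
... | b , (ρ , b↭a) , b-mono = b⁺ , (insert i₀ Fin.zero ρ , b⁺↭a) , b⁺-mono
  where
  b⁺ : Vector ℕ (suc n)
  b⁺ = a i₀ ∷ b

  b⁺↭a : ∀ k → b⁺ (insert i₀ Fin.zero ρ ⟨$⟩ʳ k) ≡ a k
  b⁺↭a k with i₀ Finₚ.≟ k
  ... | yes i₀≡k = cong a i₀≡k
  ... | no i₀≢k  = trans (b↭a (Fin.punchOut i₀≢k)) (cong a (Finₚ.punchIn-punchOut i₀≢k))

  b⁺-mono : ∀ {i j} → i Fin.≤ j → b⁺ i ≤ b⁺ j
  b⁺-mono {Fin.zero}  {Fin.zero}  _ = ℕₚ.≤-refl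
  b⁺-mono {Fin.zero}  {Fin.suc j} _ = subst (a i₀ ≤_)
    (trans (sym (b↭a (ρ ⟨$⟩ˡ j))) (cong b (Perm.inverseʳ ρ))) (i₀-min _)
  b⁺-mono {Fin.suc i} {Fin.suc j} (s≤s i≤j) = b-mono i≤j

-- If b i > i + 1 in the sorted sequence, then sending the positions before i to
-- themselves and the position p ≥ i to the bound of b p misses the value i.
isParkingFunction : (a : Vector ℕ n) (m : Fin n → Fin n) → (∀ {i j} → m i ≡ m j → i ≡ j) →
                    (∀ i → 1 ≤ a i) → (∀ i → a i ≤ suc (toℕ (m i))) → IsParkingFunction a
isParkingFunction {n} a m m-injective 1≤a a≤m = record
  { positive   = 1≤a
  ; b          = b
  ; rearranged = ρ , b↭a
  ; increasing = b-mono
  ; bounded    = λ i → ℕₚ.≮⇒≥ λ i<b →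
      ℕₚ.1+n≰n (Finₚ.injective⇒≤ {f = F i} (λ {p} {p′} → F-injective i i<b p p′))
  }
  where
  b = proj₁ (sort a)
  ρ = proj₁ (proj₁ (proj₂ (sort a)))
  b↭a = proj₂ (proj₁ (proj₂ (sort a)))
  b-mono : ∀ {i j} → i Fin.≤ j → b i ≤ b j
  b-mono = proj₂ (proj₂ (sort a))

  F : Fin n → Fin (suc n) → Fin n
  F i Fin.zero    = i
  F i (Fin.suc p) with p Finₚ.<? i
  ... | yes _ = p
  ... | no _  = m (ρ ⟨$⟩ˡ p)

  large : ∀ i → suc (toℕ i) < b i → ∀ p → ¬ p Fin.< i → i Fin.< m (ρ ⟨$⟩ˡ p)
  large i i<b p p≮i = ℕₚ.≤-pred (ℕₚ.≤-trans i<b (ℕₚ.≤-trans (b-mono (ℕₚ.≮⇒≥ p≮i))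
    (subst (_≤ suc (toℕ (m (ρ ⟨$⟩ˡ p))))
      (trans (sym (b↭a (ρ ⟨$⟩ˡ p))) (cong b (Perm.inverseʳ ρ))) (a≤m (ρ ⟨$⟩ˡ p)))))

  F-injective : ∀ i → suc (toℕ i) < b i → ∀ p p′ → F i p ≡ F i p′ → p ≡ p′
  F-injective i i<b Fin.zero Fin.zero _ = refl
  F-injective i i<b Fin.zero (Fin.suc p) e with p Finₚ.<? i
  ... | yes p<i = contradiction (subst (p Fin.<_) e p<i) (ℕₚ.<-irrefl refl)
  ... | no p≮i  = contradiction (subst (Fin._< _) e (large i i<b p p≮i)) (ℕₚ.<-irrefl refl)
  F-injective i i<b (Fin.suc p) Fin.zero e with p Finₚ.<? i
  ... | yes p<i = contradiction (subst (Fin._< i) e p<i) (ℕₚ.<-irrefl refl)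
  ... | no p≮i  = contradiction (subst (i Fin.<_) e (large i i<b p p≮i)) (ℕₚ.<-irrefl refl)
  F-injective i i<b (Fin.suc p) (Fin.suc p′) e with p Finₚ.<? i | p′ Finₚ.<? i
  ... | yes _   | yes _    = cong Fin.suc e
  ... | yes p<i | no p′≮i  =
    contradiction (ℕₚ.<-trans p<i (large i i<b p′ p′≮i)) (ℕₚ.<-irrefl (cong toℕ e))
  ... | no p≮i  | yes p′<i =
    contradiction (ℕₚ.<-trans p′<i (large i i<b p p≮i)) (ℕₚ.<-irrefl (cong toℕ (sym e)))
  ... | no _    | no _     = cong Fin.suc (trans (sym (Perm.inverseʳ ρ))
    (trans (cong (ρ ⟨$⟩ʳ_) (m-injective e)) (Perm.inverseʳ ρ)))

-- Labelled covers and merges of two blocks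

record Step (σ τ : NoncrossingPartition N) (ℓ : ℕ) : Set where
  field
    isLabel : IsLabel σ τ ℓ
    σ⊑τ     : σ ⊑ τ
  open IsLabel isLabel public
  field
    -- `IsLabel` describes only the block `B`; this confines the change to it, and so replaces the
    -- quantification over all intermediate partitions in a cover.
    local   : ∀ {v w} → τ [ v ~ w ] → σ [ v ~ w ] ⊎ (τ [ x ~ v ] × τ [ x ~ w ])

IsMaxOf : NoncrossingPartition N → Fin N → Set
IsMaxOf σ z = ∀ {w} → σ [ z ~ w ] → w Fin.≤ z

-- m is the smaller of the maxima of the two blocks that are merged.
record Merged (σ τ : NoncrossingPartition N) (ℓ : ℕ) : Set where
  field
    m        : Fin N
    m-max    : IsMaxOf σ m
    m⁺       : Fin N
    m<m⁺     : m Fin.< m⁺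
    m~m⁺     : τ [ m ~ m⁺ ]
    unique   : ∀ {z w} → IsMaxOf σ z → z Fin.< w → τ [ z ~ w ] → z ≡ m
    label    : ℓ ≡ suc (toℕ m) ⊎
               (ℓ < suc (toℕ m) ×
                 ∃[ a ] ∃[ b ] a Fin.< m × m Fin.< b × σ [ a ~ b ] × ¬ σ [ a ~ m ])
  label≤ : ℓ ≤ suc (toℕ m)
  label≤ = [ ℕₚ.≤-reflexive , ℕₚ.<⇒≤ ∘ proj₁ ]′ label

abstract
  -- Let `p` and `r` be the maxima of `B₁` and `B₂`. If `p < r`, an element of `B₂` below `p` would
  -- cross `B₁`, so `B₂` lies above `p` and the label comes from `p`. If `r < p`, the chord from `i`
  -- to `p` passes over `r`, and the label is smaller.
  merged : {σ τ : NoncrossingPartition N} {ℓ : ℕ} → Step σ τ ℓ → Merged σ τ ℓ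
  merged {N} {σ} {τ} {ℓ} S with greatest (λ z → ~-dec σ (Step.x S) z) (Step.x S , ~-refl σ)
                              | greatest (λ z → ~-dec σ (Step.y S) z) (Step.y S , ~-refl σ)
  ... | p , x~p , p-max | r , y~r , r-max = cases (Finₚ.<-cmp p r)
    where
    open Step S
    p~r : τ [ p ~ r ]
    p~r = ~-trans τ (~-sym τ (B₁∪B₂⊆B p (inj₁ x~p))) (B₁∪B₂⊆B r (inj₂ y~r))

    B₁∩B₂≡∅ : ∀ {z w} → σ [ x ~ z ] → σ [ y ~ w ] → ¬ σ [ z ~ w ]
    B₁∩B₂≡∅ x~z y~w z~w = B₁≢B₂ (~-trans σ x~z (~-trans σ z~w (~-sym σ y~w)))

    inB : ∀ {z w} → IsMaxOf σ z → z Fin.< w → τ [ z ~ w ] → τ [ x ~ z ] × τ [ x ~ w ]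
    inB z-max z<w z~w with local z~w
    ... | inj₁ σz~w = contradiction (z-max σz~w) (ℕₚ.<⇒≱ z<w)
    ... | inj₂ b    = b

    unique′ : ∀ {z w} → IsMaxOf σ z → z Fin.< w → τ [ z ~ w ] →
              (z ≡ p × p Fin.< r) ⊎ (z ≡ r × r Fin.< p)
    unique′ {z} {w} z-max z<w z~w with inB z-max z<w z~w
    ... | x~z , x~w with B⊆B₁∪B₂ z x~z | B⊆B₁∪B₂ w x~w
    ... | inj₁ xz | inj₁ xw = contradiction (z-max (~-trans σ (~-sym σ xz) xw)) (ℕₚ.<⇒≱ z<w)
    ... | inj₂ yz | inj₂ yw = contradiction (z-max (~-trans σ (~-sym σ yz) yw)) (ℕₚ.<⇒≱ z<w)
    ... | inj₁ xz | inj₂ yw with Finₚ.toℕ-injective (ℕₚ.≤-antisym (p-max xz) (z-max (~-trans σ (~-sym σ xz) x~p)))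
    ...   | refl = inj₁ (refl , ℕₚ.<-≤-trans z<w (r-max yw))
    unique′ {z} {w} z-max z<w z~w | x~z , x~w | inj₂ yz | inj₁ xw with Finₚ.toℕ-injective (ℕₚ.≤-antisym (r-max yz) (z-max (~-trans σ (~-sym σ yz) y~r)))
    ...   | refl = inj₂ (refl , ℕₚ.<-≤-trans z<w (p-max xw))

    cases : Tri (p Fin.< r) (p ≡ r) (r Fin.< p) → Merged σ τ ℓ
    cases (tri≈ _ p≡r _) = contradiction (~-reflexive σ p≡r) (B₁∩B₂≡∅ x~p y~r)
    cases (tri< p<r _ r≮p) = record
      { m = p ; m-max = p-max ∘ ~-trans σ x~p ; m⁺ = r ; m<m⁺ = p<r ; m~m⁺ = p~r
      ; unique = λ z-max z<w z~w → [ proj₁ , (λ (_ , r<p) → contradiction r<p r≮p) ]′ (unique′ z-max z<w z~w)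
      ; label = inj₁ (trans ℓ≡i (cong suc (ℕₚ.≤-antisym (p-max i∈B₁) (i-largest p x~p p<B₂))))
      }
      where
      p<B₂ : ∀ w → σ [ y ~ w ] → p Fin.< w
      p<B₂ w y~w = ℕₚ.≰⇒> λ w≤p → B₁∩B₂≡∅ i∈B₁ y~w
        (cross σ (ℕₚ.<⇒≤ (i<B₂ w y~w)) w≤p (ℕₚ.<⇒≤ p<r)
          (~-trans σ (~-sym σ i∈B₁) x~p) (~-trans σ (~-sym σ y~w) y~r))
    cases (tri> p≮r _ r<p) = record
      { m = r ; m-max = r-max ∘ ~-trans σ y~r ; m⁺ = p ; m<m⁺ = r<p ; m~m⁺ = ~-sym τ p~r
      ; unique = λ z-max z<w z~w → [ (λ (_ , p<r) → contradiction p<r p≮r) , proj₁ ]′ (unique′ z-max z<w z~w)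
      ; label = inj₂ (subst (_< suc (toℕ r)) (sym ℓ≡i) (s≤s (i<B₂ r y~r)) ,
          i , p , i<B₂ r y~r , r<p , ~-trans σ (~-sym σ i∈B₁) x~p , B₁∩B₂≡∅ i∈B₁ y~r)
      }

-- Carries out the merging of τ inside the single τ-block of `x`. The result lies between σ and τ,
-- so under a cover that changes the block of `x` it has to be τ; this gives `local`.
coarsen : (σ τ : NoncrossingPartition N) → σ ⊑ τ → Fin N → NoncrossingPartition N
coarsen σ τ σ⊑τ x = record
  { SameBlock        = λ v w → σ [ v ~ w ] ⊎ (τ [ x ~ v ] × τ [ x ~ w ])
  ; isDecEquivalence = record
    { isEquivalence = record
      { refl  = inj₁ (~-refl σ)
      ; sym   = λ { (inj₁ p) → inj₁ (~-sym σ p) ; (inj₂ (p , q)) → inj₂ (q , p) }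
      ; trans = λ { (inj₁ p) (inj₁ q) → inj₁ (~-trans σ p q)
                  ; (inj₁ p) (inj₂ (q , r)) → inj₂ (~-trans τ q (~-sym τ (apply σ⊑τ p)) , r)
                  ; (inj₂ (p , q)) (inj₁ r) → inj₂ (p , ~-trans τ q (apply σ⊑τ r))
                  ; (inj₂ (p , _)) (inj₂ (_ , q)) → inj₂ (p , q) }
      }
    ; _≟_           = λ v w → ~-dec σ v w ⊎-dec (~-dec τ x v ×-dec ~-dec τ x w)
    }
  ; noncrossing      = λ a<b b<c c<d → noncrossing (ℕₚ.<⇒≤ a<b) (ℕₚ.<⇒≤ b<c) (ℕₚ.<⇒≤ c<d)
  }
  where
  Merge : Fin _ → Fin _ → Set
  Merge v w = σ [ v ~ w ] ⊎ (τ [ x ~ v ] × τ [ x ~ w ])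

  noncrossing : ∀ {a b c d} → a Fin.≤ b → b Fin.≤ c → c Fin.≤ d → Merge a c → Merge b d → Merge a b
  noncrossing a≤b b≤c c≤d (inj₁ ac) (inj₁ bd) = inj₁ (cross σ a≤b b≤c c≤d ac bd)
  noncrossing a≤b b≤c c≤d (inj₂ (xa , _)) (inj₂ (xb , _)) = inj₂ (xa , xb)
  noncrossing a≤b b≤c c≤d (inj₁ ac) (inj₂ (xb , xd)) =
    let ab = cross τ a≤b b≤c c≤d (apply σ⊑τ ac) (~-trans τ (~-sym τ xb) xd)
    in inj₂ (~-trans τ xb (~-sym τ ab) , xb)
  noncrossing a≤b b≤c c≤d (inj₂ (xa , xc)) (inj₁ bd) =
    let ab = cross τ a≤b b≤c c≤d (~-trans τ (~-sym τ xa) xc) (apply σ⊑τ bd)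
    in inj₂ (xa , ~-trans τ xa ab)

cover⇒step : {σ τ : NoncrossingPartition N} {ℓ : ℕ} → σ ⋖ τ → IsLabel σ τ ℓ → Step σ τ ℓ
cover⇒step {N} {σ} {τ} ((σ≤τ , _) , between) isLabel = record
  { isLabel = isLabel ; σ⊑τ = σ⊑τ ; local = local }
  where
  open IsLabel isLabel
  σ⊑τ : σ ⊑ τ
  σ⊑τ = ⊑⟨ σ≤τ ⟩

  π : NoncrossingPartition N
  π = coarsen σ τ σ⊑τ x

  local : ∀ {v w} → τ [ v ~ w ] → σ [ v ~ w ] ⊎ (τ [ x ~ v ] × τ [ x ~ w ])
  local {v} {w} v~w = decidable-stable (~-dec π v w) λ v≁w → between π
    ( (inj₁ , λ (_ , π≤σ) → B₁≢B₂ (π≤σ (inj₂ (~-refl τ , B₁∪B₂⊆B y (inj₂ (~-refl σ))))))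
    , ([ apply σ⊑τ , (λ (p , q) → ~-trans τ (~-sym τ p) q) ]′ , λ (_ , τ≤π) → v≁w (τ≤π v~w)))

step⇒cover : {σ τ : NoncrossingPartition N} {ℓ : ℕ} → Step σ τ ℓ → σ ⋖ τ
step⇒cover {N} {σ} {τ} S =
  (apply σ⊑τ , λ (_ , τ≤σ) → B₁≢B₂ (τ≤σ x~y)) ,
  λ π ((σ≤π , σ≉π) , (π≤τ , π≉τ)) → [ (λ p → π≉τ (π≤τ , τ≤π π σ≤π p)) , (λ n → σ≉π (σ≤π , π≤σ π σ≤π π≤τ n)) ]′
    (toSum (~-dec π x y))
  where
  open Step S
  x~y : τ [ x ~ y ]
  x~y = B₁∪B₂⊆B y (inj₂ (~-refl σ))

  τ≤π : ∀ π → (∀ {v w} → σ [ v ~ w ] → π [ v ~ w ]) → π [ x ~ y ] → ∀ {v w} → τ [ v ~ w ] → π [ v ~ w ]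
  τ≤π π σ≤π p {v} {w} v~w with local v~w
  ... | inj₁ r = σ≤π r
  ... | inj₂ (xv , xw) = ~-trans π (~-sym π (up v xv)) (up w xw)
    where
    up : ∀ z → τ [ x ~ z ] → π [ x ~ z ]
    up z xz = [ σ≤π , (λ yz → ~-trans π p (σ≤π yz)) ]′ (B⊆B₁∪B₂ z xz)

  π≤σ : ∀ π → (∀ {v w} → σ [ v ~ w ] → π [ v ~ w ]) → (∀ {v w} → π [ v ~ w ] → τ [ v ~ w ]) →
        ¬ π [ x ~ y ] → ∀ {v w} → π [ v ~ w ] → σ [ v ~ w ]
  π≤σ π σ≤π π≤τ n {v} {w} v~w with local (π≤τ v~w)
  ... | inj₁ r = r
  ... | inj₂ (xv , xw) with B⊆B₁∪B₂ v xv | B⊆B₁∪B₂ w xw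
  ... | inj₁ p | inj₁ q = ~-trans σ (~-sym σ p) q
  ... | inj₂ p | inj₂ q = ~-trans σ (~-sym σ p) q
  ... | inj₁ p | inj₂ q = contradiction (~-trans π (σ≤π p) (~-trans π v~w (~-sym π (σ≤π q)))) n
  ... | inj₂ p | inj₁ q = contradiction (~-trans π (σ≤π q) (~-trans π (~-sym π v~w) (~-sym π (σ≤π p)))) n

-- The union of two blocks can only be crossed by a chord that separates `s` from `t` or one that
-- already crosses σ. `chord` therefore asks that a chord leaving the gap between `s` and `t`
-- belongs to one of the two blocks.
module Merge (σ : NoncrossingPartition N) (s t : Fin N) (s<t : s Fin.< t) (s≁t : ¬ σ [ s ~ t ])
             (chord : ∀ {u w} → σ [ u ~ w ] → s Fin.< u → u Fin.< t → w Fin.< s ⊎ t Fin.< w →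
                      σ [ s ~ u ] ⊎ σ [ t ~ u ]) where
  In : Fin N → Set
  In u = σ [ s ~ u ] ⊎ σ [ t ~ u ]

  In? : ∀ u → Dec (In u)
  In? u = ~-dec σ s u ⊎-dec ~-dec σ t u

  In-resp : ∀ {u w} → σ [ u ~ w ] → In u → In w
  In-resp r (inj₁ p) = inj₁ (~-trans σ p r)
  In-resp r (inj₂ p) = inj₂ (~-trans σ p r)

  straddle : ∀ {p r z w} → σ [ p ~ r ] → p Fin.≤ z → z Fin.≤ r → w Fin.< p ⊎ r Fin.< w →
             σ [ z ~ w ] → σ [ z ~ p ]
  straddle p~r p≤z z≤r (inj₁ w<p) z~w =
    ~-trans σ z~w (cross σ (ℕₚ.<⇒≤ w<p) p≤z z≤r (~-sym σ z~w) p~r)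
  straddle p~r p≤z z≤r (inj₂ r<w) z~w = ~-sym σ (cross σ p≤z z≤r (ℕₚ.<⇒≤ r<w) p~r z~w)

  inside? : (p r z : Fin N) → (p Fin.≤ z × z Fin.≤ r) ⊎ (z Fin.< p ⊎ r Fin.< z)
  inside? p r z with p Finₚ.≤? z | z Finₚ.≤? r
  ... | yes p≤z | yes z≤r = inj₁ (p≤z , z≤r)
  ... | no p≰z  | _       = inj₂ (inj₁ (ℕₚ.≰⇒> p≰z))
  ... | yes _   | no z≰r  = inj₂ (inj₂ (ℕₚ.≰⇒> z≰r))

  separated : ∀ {p r e e′} → σ [ p ~ r ] → p Fin.≤ e → e Fin.≤ r → e′ Fin.< p ⊎ r Fin.< e′ →
              (s ≡ e × t ≡ e′) ⊎ (t ≡ e × s ≡ e′) → In p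
  separated p~r p≤s s≤r (inj₁ t<p) (inj₁ (refl , refl)) =
    contradiction (ℕₚ.<-≤-trans t<p p≤s) (ℕₚ.<-asym s<t)
  separated p~r p≤s s≤r (inj₂ r<t) (inj₁ (refl , refl)) with ≤⇒<∨≡ p≤s | ≤⇒<∨≡ s≤r
  ... | inj₂ refl | _         = inj₁ (~-refl σ)
  ... | inj₁ _    | inj₂ refl = inj₁ (~-sym σ p~r)
  ... | inj₁ p<s  | inj₁ s<r  = In-resp (~-sym σ p~r) (chord (~-sym σ p~r) s<r r<t (inj₁ p<s))
  separated p~r p≤t t≤r (inj₂ r<s) (inj₂ (refl , refl)) =
    contradiction (ℕₚ.≤-<-trans t≤r r<s) (ℕₚ.<-asym s<t)
  separated p~r p≤t t≤r (inj₁ s<p) (inj₂ (refl , refl)) with ≤⇒<∨≡ p≤t | ≤⇒<∨≡ t≤r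
  ... | inj₂ refl | _         = inj₂ (~-refl σ)
  ... | inj₁ _    | inj₂ refl = inj₂ (~-sym σ p~r)
  ... | inj₁ p<t  | inj₁ t<r  = chord p~r s<p p<t (inj₂ t<r)

  -- If `z` and `w` are in the same block, that block crosses the chord from `p` to `r` within σ.
  -- Otherwise either one of the two blocks has points on both sides of the chord, or the chord
  -- separates `s` from `t` and `separated` applies.
  In-straddle : ∀ {p r z w} → σ [ p ~ r ] → p Fin.≤ z → z Fin.≤ r → w Fin.< p ⊎ r Fin.< w →
                In z → In w → In p
  In-straddle {p} {r} {z} {w} p~r p≤z z≤r out = λ
    { (inj₁ sz) (inj₁ sw) → inj₁ (~-trans σ sz (straddle p~r p≤z z≤r out (~-trans σ (~-sym σ sz) sw)))
    ; (inj₂ tz) (inj₂ tw) → inj₂ (~-trans σ tz (straddle p~r p≤z z≤r out (~-trans σ (~-sym σ tz) tw)))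
    ; (inj₁ sz) (inj₂ tw) → ends (inj₁ refl) (inj₂ refl) sz tw (inj₁ (refl , refl))
    ; (inj₂ tz) (inj₁ sw) → ends (inj₂ refl) (inj₁ refl) tz sw (inj₂ (refl , refl))
    }
    where
    end : ∀ {e u} → s ≡ e ⊎ t ≡ e → σ [ e ~ u ] → In u
    end (inj₁ refl) = inj₁
    end (inj₂ refl) = inj₂

    ends : ∀ {e e′} → s ≡ e ⊎ t ≡ e → s ≡ e′ ⊎ t ≡ e′ → σ [ e ~ z ] → σ [ e′ ~ w ] →
           (s ≡ e × t ≡ e′) ⊎ (t ≡ e × s ≡ e′) → In p
    ends {e} {e′} ie ie′ ez e′w st with inside? p r e | inside? p r e′
    ... | inj₂ e-out | _ = end ie (~-trans σ ez (straddle p~r p≤z z≤r e-out (~-sym σ ez)))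
    ... | inj₁ _ | inj₁ (p≤e′ , e′≤r) = end ie′ (straddle p~r p≤e′ e′≤r out e′w)
    ... | inj₁ (p≤e , e≤r) | inj₂ e′-out = separated p~r p≤e e≤r e′-out st

  merge : NoncrossingPartition N
  merge = record
    { SameBlock        = λ v w → σ [ v ~ w ] ⊎ (In v × In w)
    ; isDecEquivalence = record
      { isEquivalence = record
        { refl  = inj₁ (~-refl σ)
        ; sym   = λ { (inj₁ p) → inj₁ (~-sym σ p) ; (inj₂ (p , q)) → inj₂ (q , p) }
        ; trans = λ { (inj₁ p) (inj₁ q) → inj₁ (~-trans σ p q)
                    ; (inj₁ p) (inj₂ (q , r)) → inj₂ (In-resp (~-sym σ p) q , r)
                    ; (inj₂ (p , q)) (inj₁ r) → inj₂ (p , In-resp r q)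
                    ; (inj₂ (p , _)) (inj₂ (_ , q)) → inj₂ (p , q) }
        }
      ; _≟_           = λ v w → ~-dec σ v w ⊎-dec (In? v ×-dec In? w)
      }
    ; noncrossing      = λ
      { a<b b<c c<d (inj₁ ac) (inj₁ bd) → inj₁ (NoncrossingPartition.noncrossing σ a<b b<c c<d ac bd)
      ; a<b b<c c<d (inj₂ (Ia , _)) (inj₂ (Ib , _)) → inj₂ (Ia , Ib)
      ; a<b b<c c<d (inj₁ ac) (inj₂ (Ib , Id)) →
          inj₂ (In-straddle ac (ℕₚ.<⇒≤ a<b) (ℕₚ.<⇒≤ b<c) (inj₂ c<d) Ib Id , Ib)
      ; a<b b<c c<d (inj₂ (Ia , Ic)) (inj₁ bd) →
          inj₂ (Ia , In-straddle bd (ℕₚ.<⇒≤ b<c) (ℕₚ.<⇒≤ c<d) (inj₁ a<b) Ic Ia)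
      }
    }

  σ⊑merge : σ ⊑ merge
  σ⊑merge = ⊑⟨ inj₁ ⟩

  merge⊑ : ∀ {τ} → σ ⊑ τ → τ [ s ~ t ] → merge ⊑ τ
  merge⊑ {τ} σ⊑τ s~t = ⊑⟨ [ apply σ⊑τ , (λ (p , q) → ~-trans τ (~-sym τ (s~ p)) (s~ q)) ]′ ⟩
    where
    s~ : ∀ {u} → In u → τ [ s ~ u ]
    s~ = [ apply σ⊑τ , (λ r → ~-trans τ s~t (apply σ⊑τ r)) ]′

  private
    label : ∀ x y → ¬ σ [ x ~ y ] → (∀ {z} → In z → σ [ x ~ z ] ⊎ σ [ y ~ z ]) →
            (∀ {z} → σ [ x ~ z ] ⊎ σ [ y ~ z ] → In z) → (∀ {z} → In z → x Fin.≤ z) →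
            ∃[ ℓ ] Step σ merge ℓ
    label x y x≁y In⇒ ⇒In x-min with greatest
      (λ i → ~-dec σ x i ×-dec Finₚ.all? (λ z → ~-dec σ y z →-dec (i Finₚ.<? z)))
      (x , ~-refl σ , λ z y~z → ℕₚ.≤∧≢⇒< (x-min (⇒In (inj₂ y~z)))
        (λ x≡z → x≁y (~-sym σ (~-trans σ y~z (~-reflexive σ (sym (Finₚ.toℕ-injective x≡z)))))))
    ... | i , (x~i , i<) , i-greatest = suc (toℕ i) , record
      { isLabel = record
        { x = x ; y = y ; B₁≢B₂ = x≁y
        ; B⊆B₁∪B₂ = λ z → [ inj₁ , In⇒ ∘ proj₂ ]′
        ; B₁∪B₂⊆B = λ z p → inj₂ (⇒In (inj₁ (~-refl σ)) , ⇒In p)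
        ; x-minimum = λ z → [ (λ x~z → x-min (⇒In (inj₁ x~z))) , x-min ∘ proj₂ ]′
        ; i = i ; i∈B₁ = x~i ; i<B₂ = i<
        ; i-largest = λ i′ x~i′ i′< → i-greatest (x~i′ , i′<)
        ; ℓ≡i = refl
        }
      ; σ⊑τ = σ⊑merge
      ; local = [ inj₁ , (λ (p , q) → inj₂ (inj₂ (⇒In (inj₁ (~-refl σ)) , p) , inj₂ (⇒In (inj₁ (~-refl σ)) , q))) ]′
      }

  step : ∃[ ℓ ] Step σ merge ℓ
  -- `IsLabel` calls `B₁` the block with the minimum of the union, which may be that of `s` or that
  -- of `t`.
  step with least In? (s , inj₁ (~-refl σ))
  ... | x , inj₁ s~x , x-least = label x t (λ x~t → s≁t (~-trans σ s~x x~t))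
    [ (λ p → inj₁ (~-trans σ (~-sym σ s~x) p)) , inj₂ ]′
    [ (λ p → inj₁ (~-trans σ s~x p)) , inj₂ ]′ x-least
  ... | x , inj₂ t~x , x-least = label x s (λ x~s → s≁t (~-sym σ (~-trans σ t~x x~s)))
    [ inj₂ , (λ p → inj₁ (~-trans σ (~-sym σ t~x) p)) ]′
    [ (λ p → inj₂ (~-trans σ t~x p)) , inj₁ ]′ x-least

-- PosetPF as a convex marked order

crossing-index : (Q : Fin (suc L) → Set) → (∀ i → Dec (Q i)) → ¬ Q Fin.zero → Q (fromℕ L) →
                 ∃[ i ] ¬ Q (inject₁ i) × Q (Fin.suc i)
crossing-index {zero} Q Q? ¬Q₀ Qₗ = contradiction Qₗ ¬Q₀
crossing-index {suc L} Q Q? ¬Q₀ Qₗ with Q? (Fin.suc Fin.zero)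
... | yes Q₁ = Fin.zero , ¬Q₀ , Q₁
... | no ¬Q₁ = let i , p , q = crossing-index (Q ∘ Fin.suc) (Q? ∘ Fin.suc) ¬Q₁ Qₗ in Fin.suc i , p , q

downward : (P : Fin (suc L) → Set) → P (fromℕ L) → (∀ i → P (Fin.suc i) → P (inject₁ i)) → ∀ i → P i
downward {zero}  P Pₗ step Fin.zero = Pₗ
downward {suc L} P Pₗ step Fin.zero = step Fin.zero (downward (P ∘ Fin.suc) Pₗ (step ∘ Fin.suc) Fin.zero)
downward {suc L} P Pₗ step (Fin.suc i) = downward (P ∘ Fin.suc) Pₗ (step ∘ Fin.suc) i

chain-mono : {A : Set₁} (_≤ᴬ_ : A → A → Set) → (∀ {x} → x ≤ᴬ x) → (∀ {x y z} → x ≤ᴬ y → y ≤ᴬ z → x ≤ᴬ z) →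
             (e : Fin (suc L) → A) → (∀ i → e (inject₁ i) ≤ᴬ e (Fin.suc i)) →
             ∀ {i j} → i Fin.≤ j → e i ≤ᴬ e j
chain-mono _≤ᴬ_ r t e s {Fin.zero} {Fin.zero} _ = r
chain-mono {suc L} _≤ᴬ_ r t e s {Fin.zero} {Fin.suc j} _ =
  t (s Fin.zero) (chain-mono _≤ᴬ_ r t (e ∘ Fin.suc) (s ∘ Fin.suc) {Fin.zero} {j} z≤n)
chain-mono {suc L} _≤ᴬ_ r t e s {Fin.suc i} {Fin.suc j} (s≤s i≤j) =
  chain-mono _≤ᴬ_ r t (e ∘ Fin.suc) (s ∘ Fin.suc) i≤j

module LabelledChain {n L : ℕ} (e : Fin (suc L) → NoncrossingPartition (suc n)) (ℓ : Fin L → ℕ)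
                     (steps : ∀ i → Step (e (inject₁ i)) (e (Fin.suc i)) (ℓ i)) where
  module M i = Merged (merged (steps i))
  open M public using (m; label≤)

  e-mono : ∀ {i j} → i Fin.≤ j → e i ⊑ e j
  e-mono = chain-mono _⊑_ ⊑-refl ⊑-trans e (λ i → Step.σ⊑τ (steps i))

  m<n : ∀ i → toℕ (m i) < n
  m<n i = ℕₚ.<-≤-trans (M.m<m⁺ i) (Finₚ.toℕ≤pred[n] (M.m⁺ i))

  -- From step `i` on, the block of `m i` contains the larger `m⁺ i`, so `m i` is never a maximum
  -- again.
  m≢m : ∀ {i j} → i Fin.< j → m i ≢ m j
  m≢m {i} {j} i<j mi≡mj = ℕₚ.<⇒≱ (M.m<m⁺ i) (subst (M.m⁺ i Fin.≤_) (sym mi≡mj)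
    (M.m-max j (subst (λ z → e (inject₁ j) [ z ~ M.m⁺ i ]) mi≡mj
      (apply (e-mono (subst (suc (toℕ i) ≤_) (sym (Finₚ.toℕ-inject₁ j)) i<j)) (M.m~m⁺ i)))))

  m-injective : ∀ {i j} → m i ≡ m j → i ≡ j
  m-injective {i} {j} mi≡mj with Finₚ.<-cmp i j
  ... | tri< i<j _ _ = contradiction mi≡mj (m≢m i<j)
  ... | tri≈ _ i≡j _ = i≡j
  ... | tri> _ _ j<i = contradiction (sym mi≡mj) (m≢m j<i)

  m′ : Fin L → Fin n
  m′ i = fromℕ< (m<n i)

  m′-injective : ∀ {i j} → m′ i ≡ m′ j → i ≡ j
  m′-injective {i} {j} e = m-injective (Finₚ.toℕ-injective
    (trans (sym (Finₚ.toℕ-fromℕ< (m<n i))) (trans (cong toℕ e) (Finₚ.toℕ-fromℕ< (m<n j)))))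

  L≤n : L ≤ n
  L≤n = Finₚ.injective⇒≤ m′-injective

  module _ (bottom : e Fin.zero ⊑ 0̂) (top : 1̂ ⊑ e (fromℕ L)) where
    -- z stops being the maximum of its block at some step.
    m-surjective : ∀ z → toℕ z < n → ∃[ i ] m i ≡ z
    m-surjective z z<n = i , sym (M.unique i z-max (proj₁ (proj₂ ∃w)) (proj₂ (proj₂ ∃w)))
      where
      Q : Fin (suc L) → Set
      Q i = ∃[ w ] z Fin.< w × e i [ z ~ w ]
      change = crossing-index Q (λ i → Finₚ.any? λ w → (z Finₚ.<? w) ×-dec ~-dec (e i) z w)
        (λ (w , z<w , z~w) → ℕₚ.<-irrefl (cong toℕ (apply bottom z~w)) z<w)
        (fromℕ n , subst (toℕ z <_) (sym (Finₚ.toℕ-fromℕ n)) z<n , apply top tt)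
      i = proj₁ change
      z-max : IsMaxOf (e (inject₁ i)) z
      z-max {w} z~w = ℕₚ.≮⇒≥ λ z<w → proj₁ (proj₂ change) (w , z<w , z~w)
      ∃w = proj₂ (proj₂ change)

    -- Every element but the last must stop being a maximum, each at its own step. With `L≤n` this
    -- gives the exact length that `MaximalChain` prescribes.
    n≤L : n ≤ L
    n≤L = Finₚ.injective⇒≤ {f = stop} λ {x} {y} eq → Finₚ.inject₁-injective
      (trans (sym (stop-m x)) (trans (cong m eq) (stop-m y)))
      where
      bound : ∀ z → toℕ (inject₁ z) < n
      bound z = subst (_< n) (sym (Finₚ.toℕ-inject₁ z)) (Finₚ.toℕ<n z)
      stop : Fin n → Fin L
      stop z = proj₁ (m-surjective (inject₁ z) (bound z))
      stop-m : ∀ z → m (stop z) ≡ inject₁ z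
      stop-m z = proj₂ (m-surjective (inject₁ z) (bound z))

-- No block with an element ≥ v is nested in a gap of another block: with v = k + 1
-- this holds along the chains of PF(n,k), where the labels k + 1, …, n occur once.
record Convex (v : Fin N) (σ : NoncrossingPartition N) : Set where
  constructor convex⟨_⟩
  field convex : ∀ {a b c} → a Fin.≤ b → b Fin.≤ c → v Fin.≤ b → σ [ a ~ c ] → σ [ a ~ b ]

open Convex

module Marked {N : ℕ} (u v : Fin N) (v≡1+u : toℕ v ≡ suc (toℕ u)) where
  u<v : u Fin.< v
  u<v = ℕₚ.≤-reflexive (sym v≡1+u)

  <v⇒≤u : {y : Fin N} → y Fin.< v → y Fin.≤ u
  <v⇒≤u {y} y<v = ℕₚ.m<1+n⇒m≤n (subst (toℕ y <_) v≡1+u y<v)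

  u<⇒v≤ : {y : Fin N} → u Fin.< y → v Fin.≤ y
  u<⇒v≤ {y} u<y = subst (_≤ toℕ y) (sym v≡1+u) u<y

  infix 4 _≼_

  record _≼_ (σ τ : NoncrossingPartition N) : Set where
    constructor ≼⟨_,_,_,_⟩
    field
      ≼⇒⊑  : σ ⊑ τ
      convˡ : Convex v σ
      convʳ : Convex v τ
      ¬bad  : ¬ BadPair u v σ τ

  open _≼_ public

  module _ {σ τ : NoncrossingPartition N} {ℓ : ℕ} (S : Step σ τ ℓ) where
    open Step S
    open Merged (merged S)

    -- A smaller label would put `m ≥ v` under a chord of another block, against the convexity of σ.
    step-label : σ ≼ τ → v Fin.≤ m → ℓ ≡ suc (toℕ m)
    step-label p v≤m with label
    ... | inj₁ ℓ≡m = ℓ≡m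
    ... | inj₂ (_ , a , b , a<m , m<b , a~b , a≁m) =
      contradiction (convex (convˡ p) (ℕₚ.<⇒≤ a<m) (ℕₚ.<⇒≤ m<b) v≤m a~b) a≁m

    -- With this label, a nested merge would have `m ≥ v`, which `step-label` excludes, so `m` is
    -- `u`. Convexity of τ then draws `v` into the merged block, where it is the minimum of `B₂`:
    -- the step is a bad pair.
    step-label≢ : σ ≼ τ → ℓ ≢ suc (toℕ u)
    step-label≢ p ℓ≡u with label
    ... | inj₂ (ℓ<m , _) = contradiction
      (step-label p (u<⇒v≤ (ℕₚ.≤-pred (subst (_< suc (toℕ m)) ℓ≡u ℓ<m)))) (ℕₚ.<⇒≢ ℓ<m)
    ... | inj₁ ℓ≡m = ¬bad p record
      { v-min = λ v~y → u<⇒v≤ (subst (Fin._< _) i≡u (i<B₂ _ (~-trans σ y~v v~y)))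
      ; u~v = u~v ; x = x ; x~u = x~u
      ; x-min = λ {w} u~w → x-minimum w (~-trans τ (B₁∪B₂⊆B u (inj₁ x~u)) u~w)
      }
      where
      m≡u : m ≡ u
      m≡u = Finₚ.toℕ-injective (ℕₚ.suc-injective (trans (sym ℓ≡m) ℓ≡u))
      i≡u : i ≡ u
      i≡u = Finₚ.toℕ-injective (ℕₚ.suc-injective (trans (sym ℓ≡i) ℓ≡u))
      x~u : σ [ x ~ u ]
      x~u = subst (λ w → σ [ x ~ w ]) i≡u i∈B₁
      u~v : τ [ u ~ v ]
      u~v = convex (convʳ p) (ℕₚ.<⇒≤ u<v) (u<⇒v≤ (subst (Fin._< m⁺) m≡u m<m⁺)) ℕₚ.≤-refl
        (subst (λ w → τ [ w ~ m⁺ ]) m≡u m~m⁺)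
      y~v : σ [ y ~ v ]
      y~v = [ (λ x~v → contradiction
                (subst (v Fin.≤_) m≡u (m-max (subst (λ w → σ [ w ~ v ]) (sym m≡u) (~-trans σ (~-sym σ x~u) x~v))))
                (ℕₚ.<⇒≱ u<v))
            , id ]′
        (B⊆B₁∪B₂ v (~-trans τ (B₁∪B₂⊆B u (inj₁ x~u)) u~v))

    -- Suppose the merge brings a nested `b` in `B₂` together with the chord from `a` to `c` over
    -- it. The maximum `z` of the block of `b` lies below `c`, so it is `m`; the label then forces
    -- `i` to be `z`, although `i` lies below all of `B₂`. A nested `b` in `B₁` would be crossed,
    -- because `i` lies to the left of `a`.
    step-convex : Convex v τ → (v Fin.≤ m → ℓ ≡ suc (toℕ m)) → Convex v σ
    step-convex conv v≤m⇒ = convex⟨ (λ a≤b b≤c v≤b a~c → go a≤b b≤c v≤b a~c) ⟩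
      where
      go : ∀ {a b c} → a Fin.≤ b → b Fin.≤ c → v Fin.≤ b → σ [ a ~ c ] → σ [ a ~ b ]
      go {a} {b} {c} a≤b b≤c v≤b a~c with local (convex conv a≤b b≤c v≤b (apply σ⊑τ a~c))
      ... | inj₁ a~b = a~b
      ... | inj₂ (xa , xb) with B⊆B₁∪B₂ a xa | B⊆B₁∪B₂ b xb
      ... | inj₁ p | inj₁ q = ~-trans σ (~-sym σ p) q
      ... | inj₂ p | inj₂ q = ~-trans σ (~-sym σ p) q
      ... | inj₂ y~a | inj₁ x~b = let i~b = ~-trans σ (~-sym σ i∈B₁) x~b in
        ~-trans σ (~-sym σ (cross σ (ℕₚ.<⇒≤ (i<B₂ a y~a)) a≤b b≤c i~b a~c)) i~b
      ... | inj₁ x~a | inj₂ y~b with greatest (~-dec σ b) (b , ~-refl σ)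
      ... | z , b~z , z-max with c Finₚ.≤? z
      ... | yes c≤z = cross σ a≤b b≤c c≤z a~c b~z
      ... | no c≰z with unique {z} {c} (λ z~w → z-max (~-trans σ b~z z~w)) (ℕₚ.≰⇒> c≰z)
                     (~-trans τ (apply σ⊑τ (~-sym σ b~z)) (~-trans τ (~-sym τ xb) (~-trans τ xa (apply σ⊑τ a~c))))
      ... | z≡m = contradiction (i<B₂ z (~-trans σ y~b b~z)) (ℕₚ.<-irrefl (trans
        (ℕₚ.suc-injective (trans (sym ℓ≡i) (v≤m⇒ (subst (v Fin.≤_) z≡m (ℕₚ.≤-trans v≤b (z-max (~-refl σ)))))))
        (cong toℕ (sym z≡m))))

    -- In a bad step `u` is in `B₁`, together with the minimum, and `v` is the minimum of `B₂`. So
    -- `u` is the largest element of `B₁` below `B₂`, and the label would be `suc (toℕ u)`.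
    step-¬bad : ℓ ≢ suc (toℕ u) → ¬ BadPair u v σ τ
    step-¬bad ℓ≢ B = ℓ≢ (trans ℓ≡i (cong suc (ℕₚ.≤-antisym i≤u u≤i)))
      where
      module B′ = BadPair B
      u≁v : ¬ σ [ u ~ v ]
      u≁v u~v = ℕₚ.<⇒≱ u<v (B′.v-min (~-sym σ u~v))
      x~uτ : τ [ x ~ u ]
      x~uτ = [ (λ p → contradiction p u≁v) , proj₁ ]′ (local B′.u~v)
      x≡ : x ≡ B′.x
      x≡ = Finₚ.toℕ-injective (ℕₚ.≤-antisym
        (x-minimum _ (~-trans τ x~uτ (~-sym τ (apply σ⊑τ B′.x~u)))) (B′.x-min (~-sym τ x~uτ)))
      x~u : σ [ x ~ u ]
      x~u = subst (λ w → σ [ w ~ u ]) (sym x≡) B′.x~u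
      y~v : σ [ y ~ v ]
      y~v = [ (λ x~v → contradiction (~-trans σ (~-sym σ x~u) x~v) u≁v) , id ]′
        (B⊆B₁∪B₂ v (~-trans τ x~uτ B′.u~v))
      i≤u : i Fin.≤ u
      i≤u = <v⇒≤u (i<B₂ v y~v)
      u≤i : u Fin.≤ i
      u≤i = i-largest u x~u (λ z y~z → ℕₚ.<-≤-trans u<v (B′.v-min (~-trans σ (~-sym σ y~v) y~z)))

IsMaxOf? : (σ : NoncrossingPartition N) (z : Fin N) → Dec (IsMaxOf σ z)
IsMaxOf? σ z = map′ (λ p {w} → p w) (λ p w → p {w}) (Finₚ.all? λ w → ~-dec σ z w →-dec (w Finₚ.≤? z))

maxima : NoncrossingPartition N → Subset N
maxima σ = tabulate λ z → does (IsMaxOf? σ z)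

∈maxima⁺ : (σ : NoncrossingPartition N) {z : Fin N} → IsMaxOf σ z → z ∈ˢ maxima σ
∈maxima⁺ σ {z} p = lookup⇒[]= z (maxima σ)
  (trans (lookup∘tabulate (λ z → does (IsMaxOf? σ z)) z) (dec-true (IsMaxOf? σ z) p))

∈maxima⁻ : (σ : NoncrossingPartition N) {z : Fin N} → z ∈ˢ maxima σ → IsMaxOf σ z
∈maxima⁻ σ {z} p = does-true (IsMaxOf? σ z)
  (trans (sym (lookup∘tabulate (λ z → does (IsMaxOf? σ z)) z)) ([]=⇒lookup p))

-- The set of block maxima is the termination measure of `refine`: a step loses the element `m` from
-- it.
step⇒maxima⊂ : {σ ρ : NoncrossingPartition N} {ℓ : ℕ} → Step σ ρ ℓ → maxima ρ ⊂ maxima σ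
step⇒maxima⊂ {σ = σ} {ρ} S =
  (λ z∈ → ∈maxima⁺ σ (λ z~w → ∈maxima⁻ ρ z∈ (apply (Step.σ⊑τ S) z~w))) ,
  m , ∈maxima⁺ σ m-max , λ m∈ → ℕₚ.<⇒≱ m<m⁺ (∈maxima⁻ ρ m∈ m~m⁺)
  where open Merged (merged S)

-- Refining `σ ≼ τ` into single steps

module Refinement {N : ℕ} (u v : Fin N) (v≡1+u : toℕ v ≡ suc (toℕ u)) where
  open Marked u v v≡1+u

  NextStep : (σ τ : NoncrossingPartition N) → Set₁
  NextStep σ τ = ∃[ ρ ] ∃[ ℓ ] Step σ ρ ℓ × σ ≼ ρ × ρ ≼ τ

  module _ {σ τ : NoncrossingPartition N} (σ≼τ : σ ≼ τ) where
    private
      σ⊑τ   = ≼⇒⊑ σ≼τ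
      convσ = convˡ σ≼τ
      convτ = convʳ σ≼τ

      v-min⇒u≁v : (∀ {y} → σ [ v ~ y ] → v Fin.≤ y) → ¬ σ [ u ~ v ]
      v-min⇒u≁v v-min u~v = ℕₚ.<⇒≱ u<v (v-min (~-sym σ u~v))

    module _ {j j′ : Fin N} (v≤j : v Fin.≤ j) (j′≡1+j : toℕ j′ ≡ suc (toℕ j))
             (τj~j′ : τ [ j ~ j′ ]) (j≁j′ : ¬ σ [ j ~ j′ ]) where
      private
        j<j′ : j Fin.< j′
        j<j′ = ℕₚ.≤-reflexive (sym j′≡1+j)

        module 𝓂 = Merge σ j j′ j<j′ j≁j′
          (λ {w} _ j<w w<j′ _ → contradiction (ℕₚ.m<1+n⇒m≤n (subst (toℕ w <_) j′≡1+j w<j′)) (ℕₚ.<⇒≱ j<w))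
        open 𝓂 using (In; merge)

        conv : Convex v merge
        conv = convex⟨ go ⟩
          where
          In-below : ∀ {a b} → a Fin.≤ b → b Fin.≤ j → v Fin.≤ b → In a → In b
          In-below a≤b b≤j v≤b (inj₁ j~a) =
            inj₁ (~-trans σ j~a (convex convσ a≤b b≤j v≤b (~-sym σ j~a)))
          In-below a≤b b≤j v≤b (inj₂ j′~a) =
            inj₂ (~-trans σ j′~a (convex convσ a≤b (ℕₚ.≤-trans b≤j (ℕₚ.<⇒≤ j<j′)) v≤b (~-sym σ j′~a)))

          In-above : ∀ {b c} → j Fin.< b → b Fin.≤ c → v Fin.≤ b → In c → In b
          In-above j<b b≤c v≤b (inj₁ j~c) = inj₁ (convex convσ (ℕₚ.<⇒≤ j<b) b≤c v≤b j~c)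
          In-above {b} j<b b≤c v≤b (inj₂ j′~c) =
            inj₂ (convex convσ (subst (_≤ toℕ b) (sym j′≡1+j) j<b) b≤c v≤b j′~c)

          go : ∀ {a b c} → a Fin.≤ b → b Fin.≤ c → v Fin.≤ b → merge [ a ~ c ] → merge [ a ~ b ]
          go a≤b b≤c v≤b (inj₁ a~c) = inj₁ (convex convσ a≤b b≤c v≤b a~c)
          go {b = b} a≤b b≤c v≤b (inj₂ (Ia , Ic)) with b Finₚ.≤? j
          ... | yes b≤j = inj₂ (Ia , In-below a≤b b≤j v≤b Ia)
          ... | no b≰j  = inj₂ (Ia , In-above (ℕₚ.≰⇒> b≰j) b≤c v≤b Ic)

        u∉ : (∀ {y} → σ [ v ~ y ] → v Fin.≤ y) → ¬ In u
        u∉ v-min (inj₁ j~u) =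
          v-min⇒u≁v v-min (convex convσ (ℕₚ.<⇒≤ u<v) v≤j ℕₚ.≤-refl (~-sym σ j~u))
        u∉ v-min (inj₂ j′~u) =
          v-min⇒u≁v v-min (convex convσ (ℕₚ.<⇒≤ u<v) (ℕₚ.≤-trans v≤j (ℕₚ.<⇒≤ j<j′)) ℕₚ.≤-refl (~-sym σ j′~u))

      -- If `v` is the minimum of its block, convexity keeps `u` out of both merged blocks. So this
      -- merge neither joins `u` to `v` nor puts a new minimum into the block of `u`.
      tailStep : NextStep σ τ
      tailStep = merge , proj₁ 𝓂.step , proj₂ 𝓂.step ,
        ≼⟨ 𝓂.σ⊑merge , convσ , conv , ¬bad₁ ⟩ , ≼⟨ 𝓂.merge⊑ σ⊑τ τj~j′ , conv , convτ , ¬bad₂ ⟩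
        where
        ¬bad₁ : ¬ BadPair u v σ merge
        ¬bad₁ B = [ v-min⇒u≁v B.v-min , u∉ B.v-min ∘ proj₁ ]′ B.u~v
          where module B = BadPair B
        ¬bad₂ : ¬ BadPair u v merge τ
        ¬bad₂ B = [ (λ x~u → ¬bad σ≼τ record
                      { v-min = B.v-min ∘ inj₁ ; u~v = B.u~v ; x = B.x ; x~u = x~u ; x-min = B.x-min })
                  , u∉ (B.v-min ∘ inj₁) ∘ proj₂ ]′ B.x~u
          where module B = BadPair B

    module _ (tail : ∀ {s t} → v Fin.≤ s → s Fin.≤ t → τ [ s ~ t ] → σ [ s ~ t ])
             {x y : Fin N} (x-min : ∀ {z} → τ [ x ~ z ] → x Fin.≤ z) (x~y : τ [ x ~ y ]) (x≁y : ¬ σ [ x ~ y ])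
             (y-greatest : ∀ {z} → τ [ x ~ z ] × ¬ σ [ x ~ z ] → z Fin.≤ y) where
      private
        x<y : x Fin.< y
        x<y = ℕₚ.≤∧≢⇒< (x-min x~y) (λ x≡y → x≁y (~-reflexive σ (Finₚ.toℕ-injective x≡y)))

        beyond : ∀ {w} → y Fin.< w → τ [ x ~ w ] → σ [ x ~ w ]
        beyond {w} y<w x~w = decidable-stable (~-dec σ x w) λ x≁w → ℕₚ.<⇒≱ y<w (y-greatest (x~w , x≁w))

        -- A chord to the left of `x` would put a smaller element into its τ-block. A chord to the
        -- right of `y` ends in that τ-block beyond `y`, hence, by the choice of `y`, in the σ-block
        -- of `x`.
        chord : ∀ {a w} → σ [ a ~ w ] → x Fin.< a → a Fin.< y → w Fin.< x ⊎ y Fin.< w →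
                σ [ x ~ a ] ⊎ σ [ y ~ a ]
        chord a~w x<a a<y (inj₁ w<x) = contradiction
          (x-min (~-sym τ (cross τ (ℕₚ.<⇒≤ w<x) (ℕₚ.<⇒≤ x<a) (ℕₚ.<⇒≤ a<y) (apply σ⊑τ (~-sym σ a~w)) x~y)))
          (ℕₚ.<⇒≱ w<x)
        chord a~w x<a a<y (inj₂ y<w) = inj₁ (~-trans σ (beyond y<w (~-trans τ
          (cross τ (ℕₚ.<⇒≤ x<a) (ℕₚ.<⇒≤ a<y) (ℕₚ.<⇒≤ y<w) x~y (apply σ⊑τ a~w)) (apply σ⊑τ a~w)))
          (~-sym σ a~w))

        module 𝓂 = Merge σ x y x<y x≁y chord
        open 𝓂 using (In; merge)

        x~In : ∀ {z} → In z → τ [ x ~ z ]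
        x~In = [ apply σ⊑τ , (λ y~z → ~-trans τ x~y (apply σ⊑τ y~z)) ]′

        conv : Convex v merge
        conv = convex⟨ go ⟩
          where
          go : ∀ {a b c} → a Fin.≤ b → b Fin.≤ c → v Fin.≤ b → merge [ a ~ c ] → merge [ a ~ b ]
          go a≤b b≤c v≤b (inj₁ a~c) = inj₁ (convex convσ a≤b b≤c v≤b a~c)
          -- By `tail` the blocks of σ and τ agree from `v` on, so `b` is with `c` already in σ.
          go a≤b b≤c v≤b (inj₂ (Ia , Ic)) =
            let a~c = ~-trans τ (~-sym τ (x~In Ia)) (x~In Ic)
                b~c = tail v≤b b≤c (~-trans τ (~-sym τ (convex convτ a≤b b≤c v≤b a~c)) a~c)
            in inj₂ (Ia , 𝓂.In-resp (~-sym σ b~c) Ic)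

      -- Since `x` is the minimum of the whole τ-block, a bad pair from σ to the merge would also be
      -- bad for τ. In the second half, `v` would have to stay a minimum, which the merge of `x`
      -- with a block reaching beyond `v` does not allow unless σ and τ were bad before.
      minStep : NextStep σ τ
      minStep = merge , proj₁ 𝓂.step , proj₂ 𝓂.step ,
        ≼⟨ 𝓂.σ⊑merge , convσ , conv , ¬bad₁ ⟩ , ≼⟨ 𝓂.merge⊑ σ⊑τ x~y , conv , convτ , ¬bad₂ ⟩
        where
        ¬bad₁ : ¬ BadPair u v σ merge
        ¬bad₁ B with BadPair.u~v B
        ... | inj₁ u~v = v-min⇒u≁v (BadPair.v-min B) u~v
        ... | inj₂ (Iu , Iv) = ¬bad σ≼τ record
          { v-min = B.v-min ; u~v = ~-trans τ (~-sym τ (x~In Iu)) (x~In Iv) ; x = B.x ; x~u = B.x~u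
          ; x-min = λ u~z → ℕₚ.≤-trans (B.x-min (inj₂ (Iu , inj₁ (~-refl σ)))) (x-min (~-trans τ (x~In Iu) u~z))
          }
          where module B = BadPair B

        ¬bad₂ : ¬ BadPair u v merge τ
        ¬bad₂ B with BadPair.x~u B
        ... | inj₁ w~u = ¬bad σ≼τ record
          { v-min = B.v-min ∘ inj₁ ; u~v = B.u~v ; x = B.x ; x~u = w~u ; x-min = B.x-min }
          where module B = BadPair B
        ... | inj₂ (_ , Iu) = [ at-x , at-y ]′ Iu
          where
          module B = BadPair B
          x~v : τ [ x ~ v ]
          x~v = ~-trans τ (x~In Iu) B.u~v
          -- `v` competes for `y`: it is in the τ-block of `x`, but as the minimum of its own block
          -- it cannot be with the smaller `x` in σ.
          v≤y : v Fin.≤ y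
          v≤y = y-greatest (x~v , λ x~v′ → ℕₚ.<⇒≱ (ℕₚ.≤-<-trans (x-min (x~In Iu)) u<v)
            (B.v-min (inj₁ (~-sym σ x~v′))))
          at-x : ¬ σ [ x ~ u ]
          at-x x~u = ¬bad σ≼τ record
            { v-min = B.v-min ∘ inj₁ ; u~v = B.u~v ; x = x ; x~u = x~u
            ; x-min = λ u~z → x-min (~-trans τ (x~In Iu) u~z) }
          at-y : ¬ σ [ y ~ u ]
          at-y y~u = v-min⇒u≁v (B.v-min ∘ inj₁) (convex convσ (ℕₚ.<⇒≤ u<v) v≤y ℕₚ.≤-refl (~-sym σ y~u))

    -- First the consecutive elements ≥ v are joined; then the minimum x of a block of
    -- τ is joined to the greatest element of that block outside the σ-block of x.
    nextStep : τ ⊑ σ ⊎ NextStep σ τ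
    nextStep with Finₚ.any? (λ j → Finₚ.any? λ j′ →
      (v Finₚ.≤? j) ×-dec (toℕ j′ ℕₚ.≟ suc (toℕ j)) ×-dec ~-dec τ j j′ ×-dec ¬? (~-dec σ j j′))
    ... | yes (j , j′ , v≤j , j′≡1+j , j~j′ , j≁j′) = inj₂ (tailStep v≤j j′≡1+j j~j′ j≁j′)
    ... | no ¬tailStep with Finₚ.any? (λ x → Finₚ.any? λ y →
      Finₚ.all? (λ z → ~-dec τ x z →-dec (x Finₚ.≤? z)) ×-dec ~-dec τ x y ×-dec ¬? (~-dec σ x y))
    ... | yes (x , y , x-min , x~y , x≁y) =
      let y′ , (x~y′ , x≁y′) , y′-greatest = greatest (λ z → ~-dec τ x z ×-dec ¬? (~-dec σ x z)) (y , x~y , x≁y)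
      in inj₂ (minStep tail (λ {z} → x-min z) x~y′ x≁y′ y′-greatest)
      where
      tail : ∀ {s t} → v Fin.≤ s → s Fin.≤ t → τ [ s ~ t ] → σ [ s ~ t ]
      tail {s} {t} v≤s s≤t = go (toℕ t ℕ.∸ toℕ s) s v≤s (sym (ℕₚ.m∸n+n≡m s≤t))
        where
        go : ∀ d s → v Fin.≤ s → toℕ t ≡ d + toℕ s → τ [ s ~ t ] → σ [ s ~ t ]
        go zero s _ t≡s _ = ~-reflexive σ (sym (Finₚ.toℕ-injective t≡s))
        go (suc d) s v≤s t≡ s~t = ~-trans σ s~s′ (go d s′ v≤s′ t≡d+s′ (~-trans τ (~-sym τ τs~s′) s~t))
          where
          s<t : s Fin.< t
          s<t = subst (toℕ s <_) (sym t≡) (s≤s (ℕₚ.m≤n+m (toℕ s) d))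
          s′ = proj₁ (successor s<t)
          s′≡1+s : toℕ s′ ≡ suc (toℕ s)
          s′≡1+s = proj₂ (successor s<t)
          s≤s′ : s Fin.≤ s′
          s≤s′ = subst (toℕ s ≤_) (sym s′≡1+s) (ℕₚ.n≤1+n _)
          v≤s′ : v Fin.≤ s′
          v≤s′ = ℕₚ.≤-trans v≤s s≤s′
          t≡d+s′ : toℕ t ≡ d + toℕ s′
          t≡d+s′ = trans t≡ (trans (sym (ℕₚ.+-suc d (toℕ s))) (cong (d +_) (sym s′≡1+s)))
          τs~s′ : τ [ s ~ s′ ]
          τs~s′ = convex convτ s≤s′ (subst (_≤ toℕ t) (sym s′≡1+s) s<t) v≤s′ s~t
          s~s′ : σ [ s ~ s′ ]
          s~s′ = decidable-stable (~-dec σ s s′) λ s≁s′ →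
            ¬tailStep (s , s′ , v≤s , s′≡1+s , τs~s′ , s≁s′)
    ... | no ¬minStep = inj₁ ⊑⟨ τ⊑σ ⟩
      where
      τ⊑σ : ∀ {a b} → τ [ a ~ b ] → σ [ a ~ b ]
      τ⊑σ {a} {b} a~b with least (~-dec τ a) (a , ~-refl τ)
      ... | z , a~z , z-least = ~-trans σ (~-sym σ (z~ (~-sym τ a~z))) (z~ (~-trans τ (~-sym τ a~z) a~b))
        where
        z~ : ∀ {w} → τ [ z ~ w ] → σ [ z ~ w ]
        z~ {w} z~w = decidable-stable (~-dec σ z w) λ z≁w →
          ¬minStep (z , w , (λ w′ z~w′ → z-least (~-trans τ a~z z~w′)) , z~w , z≁w)

  infixr 5 _◂_ _++_

  data Path : NoncrossingPartition N → NoncrossingPartition N → ℕ → Set₁ where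
    []  : ∀ {σ} → Path σ σ 0
    _◂_ : ∀ {σ ρ τ L} → (∃[ ℓ ] Step σ ρ ℓ × σ ≼ ρ) → Path ρ τ L → Path σ τ (suc L)

  _++_ : ∀ {σ ρ τ} → Path σ ρ L → Path ρ τ L′ → Path σ τ (L + L′)
  []      ++ Q = Q
  (s ◂ P) ++ Q = s ◂ (P ++ Q)

  -- Partitions are given by relations, so the endpoint is reached only up to mutual refinement;
  -- hence `τ′`.
  refine : ∀ {σ τ} → σ ≼ τ → ∃[ τ′ ] ∃[ L ] Path σ τ′ L × τ′ ⊑ τ × τ ⊑ τ′
  refine {σ} = go σ (⊂-wellFounded (maxima σ))
    where
    go : ∀ σ {τ} → Acc _⊂_ (maxima σ) → σ ≼ τ → ∃[ τ′ ] ∃[ L ] Path σ τ′ L × τ′ ⊑ τ × τ ⊑ τ′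
    go σ (acc rs) σ≼τ with nextStep σ≼τ
    ... | inj₁ τ⊑σ = σ , 0 , [] , ≼⇒⊑ σ≼τ , τ⊑σ
    ... | inj₂ (ρ , ℓ , S , σ≼ρ , ρ≼τ) =
      let τ′ , L , P , τ′≈τ = go ρ (rs (step⇒maxima⊂ S)) ρ≼τ
      in τ′ , suc L , (ℓ , S , σ≼ρ) ◂ P , τ′≈τ

  elem : ∀ {σ τ} → Path σ τ L → Fin (suc L) → NoncrossingPartition N
  elem {σ = σ} P Fin.zero    = σ
  elem (_ ◂ P) (Fin.suc i) = elem P i

  elem-last : ∀ {σ τ} (P : Path σ τ L) → elem P (fromℕ L) ≡ τ
  elem-last []      = refl
  elem-last (_ ◂ P) = elem-last P

  labels : ∀ {σ τ} → Path σ τ L → Fin L → ℕ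
  labels ((ℓ , _) ◂ P) Fin.zero    = ℓ
  labels (_ ◂ P)       (Fin.suc i) = labels P i

  steps : ∀ {σ τ} (P : Path σ τ L) i →
          Step (elem P (inject₁ i)) (elem P (Fin.suc i)) (labels P i) ×
          elem P (inject₁ i) ≼ elem P (Fin.suc i)
  steps ((_ , S) ◂ P) Fin.zero    = S
  steps (_ ◂ P)       (Fin.suc i) = steps P i

  elem-++ : ∀ {σ ρ τ} (P : Path σ ρ L) (Q : Path ρ τ L′) → ∃[ i ] elem (P ++ Q) i ≡ ρ
  elem-++ []      Q = Fin.zero , refl
  elem-++ (_ ◂ P) Q = let i , e = elem-++ P Q in Fin.suc i , e

  edge-++ : ∀ {σ π ρ τ} (P : Path σ π L) s (Q : Path ρ τ L′) →
            ∃[ i ] elem (P ++ s ◂ Q) (inject₁ i) ≡ π × elem (P ++ s ◂ Q) (Fin.suc i) ≡ ρ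
  edge-++ []      s Q = Fin.zero , refl , refl
  edge-++ (_ ◂ P) s Q = let i , e = edge-++ P s Q in Fin.suc i , e

ConvexPoset : ∀ {N} (u v : Fin N) → toℕ v ≡ suc (toℕ u) → Poset (lsuc 0ℓ) 0ℓ 0ℓ
ConvexPoset u v v≡1+u = On.poset ⟦ mark u v v≡1+u ⟧ (proj₁ {B = Convex v})

-- Chains of PF(n,k) as paths between convex partitions

module PFChains (n k : ℕ) (u v : Fin (suc n)) (v≡1+u : toℕ v ≡ suc (toℕ u)) (v≡k : toℕ v ≡ k) where
  open Marked u v v≡1+u
  open Refinement u v v≡1+u

  private
    -- Elements are indexed from 0: `u` stands for the integer k and `v`, with index k, for k + 1.
    k≡1+u : k ≡ suc (toℕ u)
    k≡1+u = trans (sym v≡k) v≡1+u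

    NCₙ = NoncrossingPartition (suc n)

  pfChain : ∀ {τ : NCₙ} (P : Path 0̂ τ n) → 1̂ ⊑ τ →
            Σ[ (c , _) ∈ PFChain n k ] ∀ i → element c i ≡ elem P i
  pfChain {τ} P 1̂⊑τ = (chain , labels P , pf , λ i → Step.isLabel (proj₁ (steps P i))) , λ _ → refl
    where
    chain : MaximalChain n
    chain = record
      { element = elem P
      ; bottom  = λ σ → apply (0̂-minimum {σ = σ})
      ; top     = λ _ _ → subst (λ π → ∀ {x y} → π [ x ~ y ]) (sym (elem-last P)) (λ {x} {y} → apply 1̂⊑τ tt)
      ; covers  = λ i → step⇒cover (proj₁ (steps P i))
      }

    module C = LabelledChain (elem P) (labels P) (λ i → proj₁ (steps P i))

    pf : PF n k (labels P)
    pf = record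
      { isParkingFunction = isParkingFunction (labels P) C.m′ C.m′-injective
          (λ i → subst (1 ≤_) (sym (Step.ℓ≡i (proj₁ (steps P i)))) (s≤s z≤n))
          (λ i → subst (labels P i ≤_) (cong suc (sym (Finₚ.toℕ-fromℕ< (C.m<n i)))) (C.label≤ i))
      ; k-missing = λ (i , ℓ≡k) → step-label≢ (proj₁ (steps P i)) (proj₂ (steps P i)) (trans ℓ≡k k≡1+u)
      ; others-present = present
      }
      where
      -- The label `suc j` occurs where the element of index `j` stops being a maximum: this element
      -- is at or above `v`, so its label is exact.
      present : ∀ j → k < j → j ≤ n → j isEntryOf labels P
      present (suc j) (s≤s k≤j) j<n = i , trans
        (step-label (proj₁ (steps P i)) (proj₂ (steps P i))
          (subst₂ _≤_ (sym v≡k) (sym (trans (cong toℕ mi≡z) z≡j)) k≤j))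
        (cong suc (trans (cong toℕ mi≡z) z≡j))
        where
        z : Fin (suc n)
        z = fromℕ< (ℕₚ.<-trans j<n (ℕₚ.n<1+n n))
        z≡j : toℕ z ≡ j
        z≡j = Finₚ.toℕ-fromℕ< _
        stop = C.m-surjective ⊑-refl (subst (1̂ ⊑_) (sym (elem-last P)) 1̂⊑τ) z (subst (_< n) (sym z≡j) j<n)
        i = proj₁ stop
        mi≡z = proj₂ stop

  length≡n : ∀ {τ L} (P : Path 0̂ τ L) → 1̂ ⊑ τ → L ≡ n
  length≡n P 1̂⊑τ = ℕₚ.≤-antisym C.L≤n (C.n≤L ⊑-refl (subst (1̂ ⊑_) (sym (elem-last P)) 1̂⊑τ))
    where module C = LabelledChain (elem P) (labels P) (λ i → proj₁ (steps P i))

  private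
    open Poset (NC (suc n)) using (_≈_)

    ≡⇒≈ : {σ τ : NCₙ} → σ ≡ τ → σ ≈ τ
    ≡⇒≈ refl = id , id

    onChain′ : ∀ {σ τ L} (P : Path 0̂ τ L) → L ≡ n → 1̂ ⊑ τ → ∃[ i ] elem P i ≡ σ → OnPFChain n k σ
    onChain′ P refl 1̂⊑τ (i , e) = let c , c≡ = pfChain P 1̂⊑τ in c , i , ≡⇒≈ (sym (trans (c≡ i) e))

    edge′ : ∀ {τ L} (P : Path 0̂ τ L) → L ≡ n → 1̂ ⊑ τ → (σ ρ : PFElement n k) →
            ∃[ i ] elem P (inject₁ i) ≡ proj₁ σ × elem P (Fin.suc i) ≡ proj₁ ρ → PFEdge n k σ ρ
    edge′ P refl 1̂⊑τ σ ρ (i , e , e′) = let c , c≡ = pfChain P 1̂⊑τ in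
      c , i , ≡⇒≈ (sym (trans (c≡ (inject₁ i)) e)) , ≡⇒≈ (sym (trans (c≡ (Fin.suc i)) e′))

  onPFChain : ∀ {σ τ L L′} → Path 0̂ σ L → Path σ τ L′ → 1̂ ⊑ τ → OnPFChain n k σ
  onPFChain P Q 1̂⊑τ = onChain′ (P ++ Q) (length≡n (P ++ Q) 1̂⊑τ) 1̂⊑τ (elem-++ P Q)

  -- An edge has to be shown on a full chain from bottom to top. So `P` below and `R` above are
  -- carried along, and the steps consumed from `Q` move over to the path below.
  pfOrder : ∀ {σ π τ L L′ L″} (P : Path 0̂ σ L) (Q : Path σ π L′) (R : Path π τ L″) → 1̂ ⊑ τ →
            ∀ pσ pπ → PFOrder n k (σ , pσ) (π , pπ)
  pfOrder P [] R 1̂⊑τ _ _ = inj₁ (id , id) ◅ ε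
  pfOrder {σ} {π} P (_◂_ {ρ = ρ} s Q) R 1̂⊑τ pσ pπ =
    inj₂ (edge′ (P ++ s ◂ Q ++ R) (length≡n (P ++ s ◂ Q ++ R) 1̂⊑τ) 1̂⊑τ (σ , pσ) (ρ , pρ)
      (edge-++ P s (Q ++ R)))
    ◅ pfOrder P′ Q R 1̂⊑τ pρ pπ
    where
    P′ = P ++ s ◂ []
    pρ : OnPFChain n k ρ
    pρ = onPFChain P′ (Q ++ R) 1̂⊑τ

  module _ (C : PFChain n k) where
    private
      c = proj₁ C
      a = proj₁ (proj₂ C)
      pf = proj₁ (proj₂ (proj₂ C))
      corresponds = proj₂ (proj₂ (proj₂ C))
      module pf = PF pf

      step : ∀ i → Step (element c (inject₁ i)) (element c (Fin.suc i)) (a i)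
      step i = cover⇒step (covers c i) (corresponds i)

      module L = LabelledChain (element c) a step

      -- Descending induction: every j > k is a label a p ≤ m p + 1, and the
      -- values m p + 1 > j are taken by other labels.
      label≡m : ∀ d j → n ≤ j + d → k < j → j ≤ n → ∀ p → suc (toℕ (L.m p)) ≡ j → a p ≡ j
      label≡m d j n≤j+d k<j j≤n p mp≡j with pf.others-present j k<j j≤n
      ... | p₀ , ap₀≡j with ℕₚ.m≤n⇒m<n∨m≡n (subst (_≤ suc (toℕ (L.m p₀))) ap₀≡j (L.label≤ p₀))
      ... | inj₂ j≡mp₀ = subst (λ i → a i ≡ j)
        (L.m-injective (Finₚ.toℕ-injective (ℕₚ.suc-injective (trans (sym j≡mp₀) (sym mp≡j))))) ap₀≡j
      label≡m zero j n≤j+d k<j j≤n p mp≡j | p₀ , ap₀≡j | inj₁ j<mp₀ =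
        contradiction (ℕₚ.<-≤-trans j<mp₀ (L.m<n p₀)) (ℕₚ.≤⇒≯ (subst (n ≤_) (ℕₚ.+-identityʳ j) n≤j+d))
      label≡m (suc d) j n≤j+d k<j j≤n p mp≡j | p₀ , ap₀≡j | inj₁ j<mp₀ =
        contradiction (trans (sym ap₀≡j) (label≡m d (suc (toℕ (L.m p₀)))
          (ℕₚ.≤-trans n≤j+d (subst (_≤ suc (toℕ (L.m p₀)) + d) (sym (ℕₚ.+-suc j d)) (ℕₚ.+-monoˡ-≤ d j<mp₀)))
          (ℕₚ.<-trans k<j j<mp₀) (L.m<n p₀) p₀ refl))
          (ℕₚ.<⇒≢ j<mp₀)

      v≤m⇒ : ∀ i → v Fin.≤ L.m i → a i ≡ suc (toℕ (L.m i))
      v≤m⇒ i v≤m = label≡m n (suc (toℕ (L.m i))) (ℕₚ.m≤n+m n _) (s≤s (subst (_≤ toℕ (L.m i)) v≡k v≤m)) (L.m<n i) i refl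

      ≢u : ∀ i → a i ≢ suc (toℕ u)
      ≢u i ai≡ = pf.k-missing (i , trans ai≡ (sym k≡1+u))

    -- `step-convex` passes convexity from the coarser to the finer partition, so the induction
    -- starts at the top of the chain.
    element-convex : ∀ i → Convex v (element c i)
    element-convex = downward (λ i → Convex v (element c i))
      convex⟨ (λ _ _ _ _ → MaximalChain.top c 1̂ tt) ⟩
      (λ i conv → step-convex (step i) conv (v≤m⇒ i))

    edge-≼ : ∀ i → element c (inject₁ i) ≼ element c (Fin.suc i)
    edge-≼ i = ≼⟨ Step.σ⊑τ (step i) , element-convex (inject₁ i) , element-convex (Fin.suc i)
                , step-¬bad (step i) (≢u i) ⟩

    element-mono : ∀ {i j} → i Fin.≤ j → Poset._≤_ ⟦ mark u v v≡1+u ⟧ (element c i) (element c j)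
    element-mono = chain-mono ⟦M⟧._≤_ (λ {σ} → ⟦M⟧.refl {σ})
      (λ {σ} {π} {τ} → ⟦M⟧.trans {σ} {π} {τ}) (element c) (λ i → ≼⇒⊑ (edge-≼ i) , ¬bad (edge-≼ i))
      where module ⟦M⟧ = Poset ⟦ mark u v v≡1+u ⟧

  0̂ᶜ 1̂ᶜ : Poset.Carrier (ConvexPoset u v v≡1+u)
  0̂ᶜ = 0̂ , convex⟨ (λ { a≤b b≤c _ refl → Finₚ.toℕ-injective (ℕₚ.≤-antisym a≤b b≤c) }) ⟩
  1̂ᶜ = 1̂ , convex⟨ (λ _ _ _ _ → tt) ⟩

  -- A convex partition lies on a chain of PF(n,k) when it can be reached from `0̂` and can reach
  -- `1̂` without a forbidden merge. Passing to the interval discards the partitions for which one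
  -- of these two pairs is bad.
  PosetPF≃ : PosetPF n k ≃ Interval (ConvexPoset u v v≡1+u) 0̂ᶜ 1̂ᶜ
  PosetPF≃ = mk≃ (PosetPF n k) (Interval (ConvexPoset u v v≡1+u) 0̂ᶜ 1̂ᶜ) to from
    (λ {σ} {τ} → mono {σ} {τ})
    (λ {σ} {τ} → cancel {σ} {τ})
    (λ _ → ⊑-refl , ⊑-refl)
    where
    module M = Poset ⟦ mark u v v≡1+u ⟧

    wrap : {σ τ : NCₙ} → σ ≈ τ → σ M.≈ τ
    wrap (p , q) = ⊑⟨ p ⟩ , ⊑⟨ q ⟩

    unwrap : {σ τ : NCₙ} → σ ⊑ τ → τ ⊑ σ → σ ≈ τ
    unwrap p q = apply p , apply q

    convex-resp : {σ τ : NCₙ} → σ M.≈ τ → Convex v τ → Convex v σ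
    convex-resp (p , q) conv =
      convex⟨ (λ a≤b b≤c v≤b a~c → apply q (convex conv a≤b b≤c v≤b (apply p a~c))) ⟩

    mk≼ : {σ τ : NCₙ} → Convex v σ → Convex v τ → σ M.≤ τ → σ ≼ τ
    mk≼ c c′ (p , ¬b) = ≼⟨ p , c , c′ , ¬b ⟩

    to : PFElement n k → Poset.Carrier (Interval (ConvexPoset u v v≡1+u) 0̂ᶜ 1̂ᶜ)
    to (σ , C@(c , _) , i , σ≈) =
      (σ , convex-resp (wrap σ≈) (element-convex C i)) ,
      M.trans (M.reflexive (0̂-minimum , ⊑⟨ MaximalChain.bottom c 0̂ ⟩))
        (M.trans (element-mono C {Fin.zero} {i} z≤n) (M.reflexive (M.Eq.sym (wrap σ≈)))) ,
      M.trans (M.reflexive (wrap σ≈))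
        (M.trans (element-mono C (Finₚ.≤fromℕ i)) (M.reflexive (1̂-maximum , ⊑⟨ MaximalChain.top c 1̂ ⟩)))

    from : Poset.Carrier (Interval (ConvexPoset u v v≡1+u) 0̂ᶜ 1̂ᶜ) → PFElement n k
    from ((σ , conv) , 0≤σ , σ≤1) with refine (mk≼ (proj₂ 0̂ᶜ) conv 0≤σ)
    ... | σ′ , _ , P , p , q with refine (mk≼ (convex-resp (p , q) conv) (proj₂ 1̂ᶜ) (M.trans (M.reflexive (p , q)) σ≤1))
    ... | τ′ , _ , Q , _ , 1⊑τ′ =
      let C , i , σ′⊑ , ⊑σ′ = onPFChain P Q 1⊑τ′
      in σ , C , i , (λ r → σ′⊑ (apply q r)) , (λ r → apply p (⊑σ′ r))

    edge : (σ τ : PFElement n k) → PFEdge n k σ τ → proj₁ σ M.≤ proj₁ τ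
    edge _ _ (C , i , σ≈ , τ≈) = M.trans (M.reflexive (wrap σ≈))
      (M.trans (≼⇒⊑ (edge-≼ C i) , ¬bad (edge-≼ C i)) (M.reflexive (M.Eq.sym (wrap τ≈))))

    mono : {σ τ : PFElement n k} → PFOrder n k σ τ → proj₁ σ M.≤ proj₁ τ
    mono ε = M.refl
    mono {σ} (_◅_ {j = π} r rs) = M.trans ([ (λ e → M.reflexive (wrap e)) , edge σ π ]′ r) (mono rs)

    -- Refining from `0̂` to σ, on to τ and on to `1̂` gives one chain through both. It meets them
    -- only up to mutual refinement, which the two `inj₁` links make good.
    cancel : {σ τ : PFElement n k} → proj₁ σ M.≤ proj₁ τ → PFOrder n k σ τ
    cancel {σ , pσ} {τ , pτ} σ≤τ with refine (mk≼ (proj₂ 0̂ᶜ) (proj₂ (proj₁ (to (σ , pσ))))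
                                           (proj₁ (proj₂ (to (σ , pσ)))))
    ... | σ′ , _ , P , p , q with refine (mk≼ (convex-resp (p , q) (proj₂ (proj₁ (to (σ , pσ)))))
                                          (proj₂ (proj₁ (to (τ , pτ)))) (M.trans (M.reflexive (p , q)) σ≤τ))
    ... | τ′ , _ , Q , p′ , q′ with refine (mk≼ (convex-resp (p′ , q′) (proj₂ (proj₁ (to (τ , pτ)))))
                                            (proj₂ 1̂ᶜ) (M.trans (M.reflexive (p′ , q′)) (proj₂ (proj₂ (to (τ , pτ))))))
    ... | _ , _ , R , _ , 1⊑ =
      inj₁ (unwrap q p) ◅ (pfOrder P Q R 1⊑ (onPFChain P (Q ++ R) 1⊑) (onPFChain (P ++ Q) R 1⊑) ◅◅
        (inj₁ (unwrap p′ q′) ◅ ε))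

-- Intervals of the marked orders

Interval-unmarked : (𝓜 : Marking N) {σ τ : NoncrossingPartition N} →
                    (∀ {π ρ} → σ ⊑ π → ρ ⊑ τ → ¬ Bad 𝓜 π ρ) →
                    Interval ⟦ 𝓜 ⟧ σ τ ≃ Interval ⟦ unmarked ⟧ σ τ
Interval-unmarked 𝓜 {σ} {τ} ¬bad = mk≃ (Interval ⟦ 𝓜 ⟧ σ τ) (Interval ⟦ unmarked ⟧ σ τ)
  (λ (π , (p , _) , (q , _)) → π , (p , id) , (q , id))
  (λ (π , (p , _) , (q , _)) → π , (p , ¬bad ⊑-refl q) , (q , ¬bad p ⊑-refl))
  (λ (p , _) → p , id)
  (λ { {_ , (σ⊑π , _) , _} {_ , _ , (ρ⊑τ , _)} (p , _) → p , ¬bad σ⊑π ρ⊑τ })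
  (λ _ → ⊑-refl , ⊑-refl)

consecutive : {u v : Fin N} → u Fin.< v → (∀ {x} → x Fin.< v → x Fin.≤ u) → toℕ v ≡ suc (toℕ u)
consecutive {u = u} {v} u<v below with successor u<v
... | w , w≡1+u = ℕₚ.≤-antisym
  (ℕₚ.≮⇒≥ λ 1+u<v → ℕₚ.<⇒≱ (ℕₚ.≤-reflexive (sym w≡1+u)) (below (subst (_< toℕ v) (sym w≡1+u) 1+u<v)))
  u<v

module WindowMark {N : ℕ} (I J : Fin N) (I<J : I Fin.< J) where
  open Window I J I<J

  module _ {u v : Fin c} (J≤u : J Fin.≤ g u) (u<v : g u Fin.< g v) {π ρ : NoncrossingPartition N} where
    private
      j≡ : ∀ (τ : NoncrossingPartition N) {x} → τ [ x ~ J ] → τ [ x ~ g j ]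
      j≡ τ {x} = subst (λ w → τ [ x ~ w ]) (sym gj≡J)

    -- If the minimum `x` lies in the window, its block runs through `I` and `J`, and `J` takes over
    -- as minimum: an outer element that is not below `I` is at or above `J`.
    bad-∣g : (Linked π × Linked ρ) ⊎ Separated ρ → π ⊑ ρ →
             BadPair (g u) (g v) π ρ → BadPair u v (π ∣g) (ρ ∣g)
    bad-∣g D π⊑ρ B with side? (BadPair.x B)
    ... | inj₂ n = record
      { v-min = λ v~y → Out.reflects-≤ (B.v-min v~y) ; u~v = B.u~v
      ; x = h B.x ; x~u = subst (λ w → π [ w ~ g u ]) (sym (g∘h n)) B.x~u
      ; x-min = λ {y} u~y → Out.reflects-≤ (subst (Fin._≤ g y) (sym (g∘h n)) (B.x-min u~y)) }
      where module B = BadPair B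
    ... | inj₁ p = [ linked , (λ separated → ⊥-elim (separated _ _ p (Out.at∈ u) (apply π⊑ρ B.x~u))) ]′ D
      where
      module B = BadPair B
      linked : Linked π × Linked ρ → BadPair u v (π ∣g) (ρ ∣g)
      linked (I~J , _) = record
        { v-min = λ v~y → Out.reflects-≤ (B.v-min v~y) ; u~v = B.u~v
        ; x = j
        ; x~u = ~-sym π (j≡ π (~-trans π (~-trans π (~-sym π B.x~u) (bridge π p (Out.at∈ u) I~J B.x~u)) I~J))
        ; x-min = λ {y} u~y → Out.reflects-≤ (subst (Fin._≤ g y) (sym gj≡J)
            ([ (λ gy<I → contradiction (ℕₚ.≤-trans (I-min p) (B.x-min u~y)) (ℕₚ.<⇒≱ gy<I)) , id ]′
              (outside {g y} (Out.at∈ y))))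
        }

    -- In the linked case the minimum `j` of the outer factor is replaced by `I`. Any other minimum
    -- stays, for if the block enters the window it contains `J`, and its outer minimum lies to the
    -- left of `I`.
    bad-∣g⁻¹ : (Linked π × Linked ρ) ⊎ Separated ρ → π ⊑ ρ →
               BadPair u v (π ∣g) (ρ ∣g) → BadPair (g u) (g v) π ρ
    bad-∣g⁻¹ D π⊑ρ B = [ linked , separated ]′ D
      where
      module B = BadPair B
      separated : Separated ρ → BadPair (g u) (g v) π ρ
      separated sep = record
        { v-min = v-min ; u~v = B.u~v ; x = g B.x ; x~u = B.x~u ; x-min = x-min }
        where
        v-min : ∀ {y} → π [ g v ~ y ] → g v Fin.≤ y
        v-min {y} v~y with side? y
        ... | inj₁ p = ⊥-elim (sep y (g v) p (Out.at∈ v) (~-sym ρ (apply π⊑ρ v~y)))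
        ... | inj₂ n = subst (g v Fin.≤_) (g∘h n)
          (Out.preserves-≤ (B.v-min (subst (λ w → π [ g v ~ w ]) (sym (g∘h n)) v~y)))
        x-min : ∀ {y} → ρ [ g u ~ y ] → g B.x Fin.≤ y
        x-min {y} u~y with side? y
        ... | inj₁ p = ⊥-elim (sep y (g u) p (Out.at∈ u) (~-sym ρ u~y))
        ... | inj₂ n = subst (g B.x Fin.≤_) (g∘h n)
          (Out.preserves-≤ (B.x-min (subst (λ w → ρ [ g u ~ w ]) (sym (g∘h n)) u~y)))

      linked : Linked π × Linked ρ → BadPair (g u) (g v) π ρ
      linked (πI~J , ρI~J) = cases (B.x Finₚ.≟ j)
        where
        to-J : ∀ τ → Linked τ → ∀ {z y} → side y ≡ true → τ [ g z ~ y ] → τ [ g z ~ g j ]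
        to-J τ I~J {z} p z~y =
          j≡ τ (~-trans τ z~y (~-trans τ (bridge τ p (Out.at∈ z) I~J (~-sym τ z~y)) I~J))

        v-min : ∀ {y} → π [ g v ~ y ] → g v Fin.≤ y
        v-min {y} v~y with side? y
        ... | inj₁ p = contradiction (Out.preserves-≤ (B.v-min (to-J π πI~J p v~y)))
          (ℕₚ.<⇒≱ (ℕₚ.≤-<-trans (subst (Fin._≤ g u) (sym gj≡J) J≤u) u<v))
        ... | inj₂ n = subst (g v Fin.≤_) (g∘h n)
          (Out.preserves-≤ (B.v-min (subst (λ w → π [ g v ~ w ]) (sym (g∘h n)) v~y)))

        min-out : ∀ {y} → side y ≡ false → ρ [ g u ~ y ] → g B.x Fin.≤ y
        min-out n u~y = subst (g B.x Fin.≤_) (g∘h n)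
          (Out.preserves-≤ (B.x-min (subst (λ w → ρ [ g u ~ w ]) (sym (g∘h n)) u~y)))

        cases : Dec (B.x ≡ j) → BadPair (g u) (g v) π ρ
        cases (yes x≡j) = record
          { v-min = v-min ; u~v = B.u~v ; x = I
          ; x~u = ~-trans π (j≡ π πI~J) (subst (λ w → π [ g w ~ g u ]) x≡j B.x~u)
          ; x-min = λ {y} u~y → x-min (side? y) u~y }
          where
          x-min : ∀ {y} → side y ≡ true ⊎ side y ≡ false → ρ [ g u ~ y ] → I Fin.≤ y
          x-min (inj₁ p) _ = I-min p
          x-min {y} (inj₂ n) u~y = ℕₚ.≤-trans (ℕₚ.<⇒≤ I<J)
            (subst (Fin._≤ y) (trans (cong g x≡j) gj≡J) (min-out n u~y))
        cases (no x≢j) = record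
          { v-min = v-min ; u~v = B.u~v ; x = g B.x ; x~u = B.x~u
          ; x-min = λ {y} u~y → x-min (side? y) u~y }
          where
          x-min : ∀ {y} → side y ≡ true ⊎ side y ≡ false → ρ [ g u ~ y ] → g B.x Fin.≤ y
          x-min (inj₂ n) u~y = min-out n u~y
          x-min {y} (inj₁ p) u~y = ℕₚ.≤-trans (ℕₚ.<⇒≤ gx<I) (I-min p)
            where
            gx<J : g B.x Fin.< J
            gx<J = subst (g B.x Fin.<_) gj≡J (Out.mono
              (ℕₚ.≤∧≢⇒< (B.x-min (to-J ρ ρI~J p u~y)) (x≢j ∘ Finₚ.toℕ-injective)))
            gx<I : g B.x Fin.< I
            gx<I = [ id , (λ J≤gx → contradiction J≤gx (ℕₚ.<⇒≱ gx<J)) ]′ (outside {g B.x} (Out.at∈ B.x))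

  Interval-marked : ∀ {u v : Fin c} (gv≡1+gu : toℕ (g v) ≡ suc (toℕ (g u))) (v≡1+u : toℕ v ≡ suc (toℕ u)) →
    J Fin.≤ g u → {σ τ : NoncrossingPartition N} → Linked σ ⊎ Separated τ → σ ⊑ τ →
    ¬ BadPair (g u) (g v) σ τ →
    ¬ BadPair u v (σ ∣g) (τ ∣g) ×
    Interval ⟦ mark (g u) (g v) gv≡1+gu ⟧ σ τ ≃
      ×-poset (Interval ⟦ unmarked ⟧ (σ ∣f) (τ ∣f)) (Interval ⟦ mark u v v≡1+u ⟧ (σ ∣g) (τ ∣g))
  Interval-marked {u} {v} gv≡1+gu v≡1+u J≤u {σ} {τ} D σ⊑τ ¬bad =
    ¬bad ∘ proj₂ (bad⇔bad ⊑-refl σ⊑τ ⊑-refl) ,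
    Interval-cut cut (mark (g u) (g v) gv≡1+gu) (mark u v v≡1+u) σ τ D bad⇔bad σ⊑τ
    where
    D′ : ∀ {π ρ} → σ ⊑ π → π ⊑ ρ → ρ ⊑ τ → (Linked π × Linked ρ) ⊎ Separated ρ
    D′ p q r = [ (λ l → inj₁ (apply p l , apply q (apply p l)))
               , (λ s → inj₂ (λ x y x∈ y∉ x~y → s x y x∈ y∉ (apply r x~y))) ]′ D

    bad⇔bad : ∀ {π ρ} → σ ⊑ π → π ⊑ ρ → ρ ⊑ τ →
              (BadPair (g u) (g v) π ρ → BadPair u v (π ∣g) (ρ ∣g)) ×
              (BadPair u v (π ∣g) (ρ ∣g) → BadPair (g u) (g v) π ρ)
    bad⇔bad p q r = bad-∣g J≤u u<v (D′ p q r) q , bad-∣g⁻¹ J≤u u<v (D′ p q r) q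
      where
      u<v : g u Fin.< g v
      u<v = ℕₚ.≤-reflexive (sym gv≡1+gu)

convex-last : {v : Fin N} → ((x : Fin N) → x Fin.≤ v) → {σ : NoncrossingPartition N} → Convex v σ
convex-last v-last {σ} = convex⟨ (λ {a} {b} {c} _ b≤c v≤b a~c → subst (λ w → σ [ a ~ w ])
  (Finₚ.toℕ-injective (ℕₚ.≤-antisym (ℕₚ.≤-trans (v-last c) v≤b) b≤c)) a~c) ⟩

-- With `v` last, convexity holds for every partition, so this is Poset(PF(n,n)) on n + 1 points.
-- `¬bad` gives n ≥ 2: if `u` had index 0 it would itself be the minimum.
Interval-base : {u v : Fin N} (v≡1+u : toℕ v ≡ suc (toℕ u)) → ((x : Fin N) → x Fin.≤ v) →
                ¬ BadPair u v 0̂ 1̂ → Decomposes (Interval ⟦ mark u v v≡1+u ⟧ 0̂ 1̂)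
Interval-base {suc n} {u} {v} v≡1+u v-last ¬bad = Decomposes-resp-≃
  (≃-sym (≃-trans PosetPF≃ Convex≃))
  (Decomposes-PosetPF (subst (2 ≤_) (trans (sym v≡1+u) v≡n) (s≤s 1≤u)))
  where
  v≡n : toℕ v ≡ n
  v≡n = ℕₚ.≤-antisym (Finₚ.toℕ≤pred[n] v) (subst (_≤ toℕ v) (Finₚ.toℕ-fromℕ n) (v-last (fromℕ n)))

  open PFChains n n u v v≡1+u v≡n

  1≤u : 1 ≤ toℕ u
  1≤u = ℕₚ.≮⇒≥ λ u<1 → ¬bad record
    { v-min = λ { refl → ℕₚ.≤-refl } ; u~v = tt ; x = u ; x~u = refl
    ; x-min = λ {y} _ → subst (_≤ toℕ y) (sym (ℕₚ.n<1⇒n≡0 u<1)) z≤n }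

  Convex≃ : Interval (ConvexPoset u v v≡1+u) 0̂ᶜ 1̂ᶜ ≃ Interval ⟦ mark u v v≡1+u ⟧ 0̂ 1̂
  Convex≃ = mk≃ (Interval (ConvexPoset u v v≡1+u) 0̂ᶜ 1̂ᶜ) (Interval ⟦ mark u v v≡1+u ⟧ 0̂ 1̂)
    (λ ((π , _) , p , q) → π , p , q) (λ (π , p , q) → (π , convex-last v-last) , p , q)
    id id (λ _ → ⊑-refl , ⊑-refl)

MarkedDecomposes : ℕ → Set₁
MarkedDecomposes N = {u v : Fin N} (v≡1+u : toℕ v ≡ suc (toℕ u)) → ((x : Fin N) → x Fin.≤ v) →
  (σ τ : NoncrossingPartition N) → σ ⊑ τ → ¬ BadPair u v σ τ →
  Decomposes (Interval ⟦ mark u v v≡1+u ⟧ σ τ)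

window-decomposes : (∀ {M} → M < N → MarkedDecomposes M) →
  (I J : Fin N) (I<J : I Fin.< J) {u v : Fin N} (v≡1+u : toℕ v ≡ suc (toℕ u)) →
  ((x : Fin N) → x Fin.≤ v) → J Fin.≤ u →
  (σ τ : NoncrossingPartition N) → Window.Linked I J I<J σ ⊎ Window.Separated I J I<J τ →
  σ ⊑ τ → ¬ BadPair u v σ τ → Decomposes (Interval ⟦ mark u v v≡1+u ⟧ σ τ)
window-decomposes {N} ih I J I<J {u} {v} v≡1+u v-last J≤u σ τ D σ⊑τ ¬bad =
  -- `go` abstracts over `u` and `v`, so that the equations with their preimages under `g` can be
  -- matched with `refl`.
  go (Out.index (∉ J≤u)) (Out.index (∉ (v-last J))) v≡1+u v-last J≤u ¬bad
  where
  open Window I J I<J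

  ∉ : ∀ {x} → J Fin.≤ x → side x ≡ false
  ∉ {x} J≤x = dec-false (window? x) (λ (_ , x<J) → ℕₚ.<⇒≱ x<J J≤x)

  go : {u v : Fin N} → ∃[ u′ ] g u′ ≡ u → ∃[ v′ ] g v′ ≡ v → (v≡1+u : toℕ v ≡ suc (toℕ u)) →
       ((x : Fin N) → x Fin.≤ v) → J Fin.≤ u → ¬ BadPair u v σ τ →
       Decomposes (Interval ⟦ mark u v v≡1+u ⟧ σ τ)
  go (u′ , refl) (v′ , refl) gv≡1+gu v-last J≤u ¬bad = Decomposes-resp-≃
    (≃-trans (proj₂ split) (×-comm-≃ (Interval ⟦ unmarked ⟧ (σ ∣f) (τ ∣f)) (Interval ⟦ mark u′ v′ v≡1+u′ ⟧ (σ ∣g) (τ ∣g))))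
    (Decomposes-×
      (ih c<N v≡1+u′ (λ x → Out.reflects-≤ (v-last (g x))) (σ ∣g) (τ ∣g) (∣g-mono σ⊑τ) (proj₁ split))
      (unmarkedInterval (σ ∣f) (τ ∣f) (1≤size i) (∣f-mono σ⊑τ)))
    where
    v≡1+u′ : toℕ v′ ≡ suc (toℕ u′)
    v≡1+u′ = consecutive
      (ℕₚ.≰⇒> λ v′≤u′ → ℕₚ.1+n≰n (subst (_≤ toℕ (g u′)) gv≡1+gu (Out.preserves-≤ v′≤u′)))
      (λ {x} x<v′ → Out.reflects-≤ (ℕₚ.m<1+n⇒m≤n (subst (toℕ (g x) <_) gv≡1+gu (Out.mono x<v′))))
    split = WindowMark.Interval-marked I J I<J gv≡1+gu v≡1+u′ J≤u D σ⊑τ ¬bad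

markedInterval : MarkedDecomposes N
markedInterval {N} = go (<-wellFounded N)
  where
  go : ∀ {N} → Acc _<_ N → MarkedDecomposes N
  go {N} (acc rs) {u} {v} v≡1+u v-last σ τ σ⊑τ ¬bad = cases
    (Finₚ.all? λ y → ~-dec σ v y →-dec (v Finₚ.≤? y)) (~-dec τ u v)
    (linkedPair? σ) (Finₚ.any? λ x → ¬? (~-dec τ x v))
    where
    <v⇒≤u : {y : Fin N} → y Fin.< v → y Fin.≤ u
    <v⇒≤u {y} y<v = ℕₚ.m<1+n⇒m≤n (subst (toℕ y <_) v≡1+u y<v)

    windowed : (I J : Fin N) (I<J : I Fin.< J) → J Fin.≤ u →
               Window.Linked I J I<J σ ⊎ Window.Separated I J I<J τ → Decomposes (Interval ⟦ mark u v v≡1+u ⟧ σ τ)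
    windowed I J I<J J≤u D = window-decomposes (λ M<N → go (rs M<N)) I J I<J v≡1+u v-last J≤u σ τ D σ⊑τ ¬bad

    plain : (∀ {π ρ} → σ ⊑ π → ρ ⊑ τ → ¬ BadPair u v π ρ) → Decomposes (Interval ⟦ mark u v v≡1+u ⟧ σ τ)
    plain never = inj₂ (IsNCProduct-resp-≃ (Interval-unmarked (mark u v v≡1+u) never)
      (unmarkedInterval σ τ (1≤size u) σ⊑τ))

    cases : Dec (∀ y → σ [ v ~ y ] → v Fin.≤ y) → Dec (τ [ u ~ v ]) →
            Dec (∃[ x ] ∃[ y ] x Fin.< y × σ [ x ~ y ]) → Dec (∃[ x ] ¬ τ [ x ~ v ]) →
            Decomposes (Interval ⟦ mark u v v≡1+u ⟧ σ τ)
    -- Both of the first two failures are inherited by the whole interval: a smaller element in the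
    -- block of `v` stays there in every coarser partition, and `u` and `v` stay apart in every
    -- finer one.
    cases (no ¬v-min) _ _ _ =
      plain λ σ⊑π _ B → ¬v-min (λ y v~y → BadPair.v-min B (apply σ⊑π v~y))
    cases (yes _) (no u≁v) _ _ = plain λ _ ρ⊑τ B → u≁v (apply ρ⊑τ (BadPair.u~v B))
    cases (yes v-min) (yes _) (yes (I , J , I<J , I~J)) _ = windowed I J I<J J≤u (inj₁ I~J)
      where
      -- `v` is the minimum of its σ-block, so the larger end of a related pair of σ cannot be `v`.
      J≤u : J Fin.≤ u
      J≤u with ≤⇒<∨≡ (v-last J)
      ... | inj₁ J<v  = <v⇒≤u J<v
      ... | inj₂ refl = contradiction (v-min I (~-sym σ I~J)) (ℕₚ.<⇒≱ I<J)
    cases (yes _) (yes u~v) (no _) (yes apart) with separate τ v-last apart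
    ... | I , J , I<J , separated , y , y≁v , J≡1+y = windowed I J I<J J≤u (inj₂ separated)
      where
      y≤u : y Fin.≤ u
      y≤u = <v⇒≤u (ℕₚ.≤∧≢⇒< (v-last y) λ y≡v → y≁v (~-reflexive τ (Finₚ.toℕ-injective y≡v)))
      -- `u` is in the τ-block of `v` and `y` is not, so `y` is strictly below `u`, and there is
      -- room for `J = y + 1`.
      J≤u : J Fin.≤ u
      J≤u = subst (_≤ toℕ u) (sym J≡1+y) (ℕₚ.≤∧≢⇒< y≤u λ y≡u →
        y≁v (subst (λ w → τ [ w ~ v ]) (sym (Finₚ.toℕ-injective y≡u)) u~v))
    cases (yes _) (yes _) (no ¬linked) (no ¬apart) = Decomposes-resp-≃
      (Interval-≈ ⟦ mark u v v≡1+u ⟧ σ≈0̂ τ≈1̂)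
      (Interval-base v≡1+u v-last λ b → ¬bad (proj₁-bad b))
      where
      module M = Poset ⟦ mark u v v≡1+u ⟧
      σ≈0̂ : σ M.≈ 0̂
      σ≈0̂ = unlinked⇒⊑0̂ ¬linked , 0̂-minimum
      τ≈1̂ : τ M.≈ 1̂
      τ≈1̂ = 1̂-maximum , all~⇒1̂⊑ ¬apart
      proj₁-bad : BadPair u v 0̂ 1̂ → BadPair u v σ τ
      proj₁-bad b = record
        { v-min = b.v-min ∘ apply (proj₁ σ≈0̂) ; u~v = apply (proj₂ τ≈1̂) tt ; x = b.x
        ; x~u = apply (proj₂ σ≈0̂) b.x~u ; x-min = λ _ → b.x-min tt }
        where module b = BadPair b

-- Splitting off the last point

module Last {N : ℕ} (p l : Fin N) (l≡1+p : toℕ l ≡ suc (toℕ p)) (l-last : (x : Fin N) → x Fin.≤ l) where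
  p<l : p Fin.< l
  p<l = ℕₚ.≤-reflexive (sym l≡1+p)

  side : Fin N → Bool
  side x = does (x Finₚ.≟ l)

  ∈⇒≡ : ∀ {x} → side x ≡ true → x ≡ l
  ∈⇒≡ {x} = does-true (x Finₚ.≟ l)

  ∉⇒≤ : ∀ {x} → side x ≡ false → x Fin.≤ p
  ∉⇒≤ {x} n = ℕₚ.m<1+n⇒m≤n (subst (toℕ x <_) l≡1+p
    (ℕₚ.≤∧≢⇒< (l-last x) (does-false (x Finₚ.≟ l) n ∘ Finₚ.toℕ-injective)))

  ≤⇒∉ : ∀ {x} → x Fin.≤ p → side x ≡ false
  ≤⇒∉ {x} x≤p = dec-false (x Finₚ.≟ l) λ { refl → ℕₚ.<⇒≱ p<l x≤p }

  -- Here the inner side is the single point `l` and the junction `p` comes before it. The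
  -- restriction to the inner side carries no information, and `_∣pair` records instead whether `l`
  -- and `p` are linked.
  cut : Cut N
  cut = record
    { side        = side
    ; convex      = λ {x} {y} x≤y _ x∈ _ → dec-true (y Finₚ.≟ l) (Finₚ.toℕ-injective
        (ℕₚ.≤-antisym (l-last y) (subst (Fin._≤ y) (∈⇒≡ x∈) x≤y)))
    ; I           = l
    ; J           = p
    ; I∈          = dec-true (l Finₚ.≟ l) refl
    ; J∉          = ≤⇒∉ ℕₚ.≤-refl
    ; I-min       = λ x∈ → ℕₚ.≤-reflexive (cong toℕ (sym (∈⇒≡ x∈)))
    ; J-adjacentʳ = λ {x} {y} x∈ y∉ x≤y →
        contradiction (subst (Fin._≤ y) (∈⇒≡ x∈) x≤y) (ℕₚ.<⇒≱ (ℕₚ.≤-<-trans (∉⇒≤ y∉) p<l))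
    ; J-adjacentˡ = λ _ y∉ _ → ∉⇒≤ y∉
    ; bridge      = λ π x∈ _ _ _ → ~-reflexive π (∈⇒≡ x∈)
    }

  open Cut cut public hiding (side; convex)

  pair : Fin 2 → Fin N
  pair Fin.zero    = p
  pair (Fin.suc _) = l

  pair-mono : ∀ {x y} → x Fin.≤ y → pair x Fin.≤ pair y
  pair-mono {Fin.zero}  {Fin.zero}  _ = ℕₚ.≤-refl
  pair-mono {Fin.zero}  {Fin.suc _} _ = ℕₚ.<⇒≤ p<l
  pair-mono {Fin.suc _} {Fin.suc _} _ = ℕₚ.≤-refl

  _∣pair : NoncrossingPartition N → NoncrossingPartition 2
  π ∣pair = pullback pair pair-mono π

  -- If `l` is related to some `y`, then `p` lies between them at or above `v`, and convexity puts
  -- it into the same block. So `l` is linked to `p` or isolated.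
  determined : ∀ {v} → v Fin.≤ p → (π : NoncrossingPartition N) → Convex v π → Determined π
  determined v≤p π conv with ~-dec π l p
  ... | yes l~p = inj₁ l~p
  ... | no l≁p  = inj₂ λ x y x∈ y∉ x~y → l≁p (~-trans π
    (~-trans π (~-sym π (~-reflexive π (∈⇒≡ x∈))) x~y)
    (convex conv (∉⇒≤ y∉) (ℕₚ.<⇒≤ p<l) v≤p (~-sym π (subst (λ w → π [ w ~ y ]) (∈⇒≡ x∈) x~y))))

  module _ {u v : Fin c} (gv≡1+gu : toℕ (g v) ≡ suc (toℕ (g u))) (v≡1+u : toℕ v ≡ suc (toℕ u)) where
    private
      module 𝓂 = Poset (ConvexPoset u v v≡1+u)

      v≤p : g v Fin.≤ p
      v≤p = ∉⇒≤ (Out.at∈ v)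

      g≤l : ∀ z → g z Fin.≤ l
      g≤l z = l-last (g z)

      bad-∣g : ∀ {π ρ} → BadPair (g u) (g v) π ρ → BadPair u v (π ∣g) (ρ ∣g)
      bad-∣g {π} {ρ} B with side? (BadPair.x B)
      ... | inj₂ n = record
        { v-min = λ v~y → Out.reflects-≤ (B.v-min v~y) ; u~v = B.u~v
        ; x = h B.x ; x~u = subst (λ w → π [ w ~ g u ]) (sym (g∘h n)) B.x~u
        ; x-min = λ {y} u~y → Out.reflects-≤ (subst (Fin._≤ g y) (sym (g∘h n)) (B.x-min u~y)) }
        where module B = BadPair B
      ... | inj₁ x∈ = contradiction (subst (Fin._≤ g u) (∈⇒≡ x∈) (BadPair.x-min B (~-refl ρ)))
        (ℕₚ.<⇒≱ (ℕₚ.≤-<-trans (∉⇒≤ (Out.at∈ u)) p<l))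

      bad-∣g⁻¹ : ∀ {π ρ} → BadPair u v (π ∣g) (ρ ∣g) → BadPair (g u) (g v) π ρ
      bad-∣g⁻¹ {π} {ρ} B = record
        { v-min = λ {y} → min π B.v-min ; u~v = B.u~v ; x = g B.x ; x~u = B.x~u ; x-min = min ρ B.x-min }
        where
        module B = BadPair B
        min : ∀ τ {z x} → (∀ {y} → τ [ g z ~ g y ] → x Fin.≤ y) → ∀ {y} → τ [ g z ~ y ] → g x Fin.≤ y
        min τ {z} {x} x-min {y} z~y with side? y
        ... | inj₁ y∈ = subst (g x Fin.≤_) (sym (∈⇒≡ y∈)) (g≤l x)
        ... | inj₂ y∉ = subst (g x Fin.≤_) (g∘h y∉)
          (Out.preserves-≤ (x-min (subst (λ w → τ [ g z ~ w ]) (sym (g∘h y∉)) z~y)))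

      linked? : (γ : NoncrossingPartition 2) → Dec (γ [ Fin.zero ~ Fin.suc Fin.zero ])
      linked? γ = ~-dec γ Fin.zero (Fin.suc Fin.zero)

      join : NoncrossingPartition c → NoncrossingPartition 2 → NoncrossingPartition N
      join β γ = glue 1̂ β (linked? γ)

      join-convex : ∀ {β} γ → Convex v β → Convex (g v) (join β γ)
      join-convex {β} γ conv = convex⟨ go ⟩
        where
        π = join β γ

        low : ∀ {a b c} → a Fin.≤ b → b Fin.≤ c → c Fin.≤ p → g v Fin.≤ b → π [ a ~ c ] → π [ a ~ b ]
        low {a} {b} {c} a≤b b≤c c≤p v≤b a~c = subst₂ (π [_~_]) (g∘h a∉) (g∘h b∉)
          (apply (proj₂ π∣g) (convex conv (h-mono a≤b) (h-mono b≤c)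
            (Out.reflects-≤ (subst (g v Fin.≤_) (sym (g∘h b∉)) v≤b))
            (apply (proj₁ π∣g) (subst₂ (π [_~_]) (sym (g∘h a∉)) (sym (g∘h c∉)) a~c))))
          where
          π∣g = glue-∣g 1̂ β (linked? γ)
          c∉ = ≤⇒∉ c≤p
          b∉ = ≤⇒∉ (ℕₚ.≤-trans b≤c c≤p)
          a∉ = ≤⇒∉ (ℕₚ.≤-trans a≤b (ℕₚ.≤-trans b≤c c≤p))

        go : ∀ {a b c} → a Fin.≤ b → b Fin.≤ c → g v Fin.≤ b → π [ a ~ c ] → π [ a ~ b ]
        go {a} {b} {c} a≤b b≤c v≤b a~c with side? b | side? c
        ... | inj₂ b∉ | inj₂ c∉ = low a≤b b≤c (∉⇒≤ c∉) v≤b a~c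
        ... | inj₁ b∈ | _ = subst (λ w → π [ a ~ w ])
          (Finₚ.toℕ-injective (ℕₚ.≤-antisym (subst (c Fin.≤_) (sym (∈⇒≡ b∈)) (l-last c)) b≤c)) a~c
        ... | inj₂ b∉ | inj₁ c∈ with glue-determined 1̂ β (linked? γ)
        ... | inj₂ separated = contradiction (~-sym π a~c)
          (separated c a c∈ (≤⇒∉ (ℕₚ.≤-trans a≤b (∉⇒≤ b∉))))
        -- `p` replaces `l` as the right end of the chord, which then lies within the outer side.
        ... | inj₁ l~p = low a≤b (∉⇒≤ b∉) ℕₚ.≤-refl v≤b
          (~-trans π (subst (λ w → π [ a ~ w ]) (∈⇒≡ c∈) a~c) l~p)

    -- A bad pair concerns `u`, `v` and minima of blocks. The point `l` lies above `v`, and adding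
    -- it to a block of smaller points never changes the minimum, so badness is decided on the outer
    -- side.
    peel : ConvexPoset (g u) (g v) gv≡1+gu ≃ ×-poset (ConvexPoset u v v≡1+u) ⟦ unmarked ⟧
    peel = mk≃ (ConvexPoset (g u) (g v) gv≡1+gu) (×-poset (ConvexPoset u v v≡1+u) ⟦ unmarked ⟧)
      (λ (π , conv) → (π ∣g , convex⟨ (λ a≤b b≤c v≤b → convex conv (Out.preserves-≤ a≤b)
        (Out.preserves-≤ b≤c) (Out.preserves-≤ v≤b)) ⟩) , π ∣pair)
      (λ ((β , conv) , γ) → join β γ , join-convex γ conv)
      (λ (π⊑ρ , ¬bad) → (∣g-mono π⊑ρ , ¬bad ∘ bad-∣g⁻¹) , ⊑⟨ apply π⊑ρ ⟩ , id)
      (λ { {π , conv} {ρ , _} ((πg , ¬bad) , (πρ , _)) →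
        determined-⊑ (determined v≤p π conv) (apply πρ {Fin.suc Fin.zero} {Fin.zero})
          ⊑⟨ (λ {x} {y} _ → ~-reflexive ρ (trans (∈⇒≡ (In.at∈ x)) (sym (∈⇒≡ (In.at∈ y))))) ⟩ πg ,
        ¬bad ∘ bad-∣g })
      (λ ((β , _) , γ) → glue-∣g 1̂ β (linked? γ) , pair⊑ β γ , ⊑pair β γ)
      where
      pair⊑ : ∀ β γ → join β γ ∣pair ⊑ γ
      pair⊑ β γ = ⊑⟨ (λ {x} {y} → go x y) ⟩
        where
        go : ∀ x y → join β γ [ pair x ~ pair y ] → γ [ x ~ y ]
        go Fin.zero Fin.zero _ = ~-refl γ
        go Fin.zero (Fin.suc Fin.zero) r = glue-linked⁻¹ 1̂ β (linked? γ) (~-sym (join β γ) r)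
        go (Fin.suc Fin.zero) Fin.zero r = ~-sym γ (glue-linked⁻¹ 1̂ β (linked? γ) r)
        go (Fin.suc Fin.zero) (Fin.suc Fin.zero) _ = ~-refl γ
      ⊑pair : ∀ β γ → γ ⊑ join β γ ∣pair
      ⊑pair β γ = ⊑⟨ (λ {x} {y} → go x y) ⟩
        where
        go : ∀ x y → γ [ x ~ y ] → join β γ [ pair x ~ pair y ]
        go Fin.zero Fin.zero _ = ~-refl (join β γ)
        go Fin.zero (Fin.suc Fin.zero) r = ~-sym (join β γ) (glue-linked 1̂ β (linked? γ) r)
        go (Fin.suc Fin.zero) Fin.zero r = glue-linked 1̂ β (linked? γ) (~-sym γ r)
        go (Fin.suc Fin.zero) (Fin.suc Fin.zero) _ = ~-refl (join β γ)

-- Intervals of convex partitions by induction on the number of points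

IntervalsDecompose : ∀ {N} {u v : Fin N} → toℕ v ≡ suc (toℕ u) → Set₁
IntervalsDecompose {u = u} {v} v≡1+u =
  ∀ σ τ → Poset._≤_ (ConvexPoset u v v≡1+u) σ τ → Decomposes (Interval (ConvexPoset u v v≡1+u) σ τ)

peel-decomposes : {p l : Fin N} → toℕ l ≡ suc (toℕ p) → ((x : Fin N) → x Fin.≤ l) →
  (∀ {M} → M < N → {u v : Fin M} (v≡1+u : toℕ v ≡ suc (toℕ u)) → IntervalsDecompose v≡1+u) →
  {u v : Fin N} (v≡1+u : toℕ v ≡ suc (toℕ u)) → v Fin.≤ p → IntervalsDecompose v≡1+u
peel-decomposes {N} {p} {l} l≡1+p l-last ih {u} {v} v≡1+u v≤p =
  go (Out.index (≤⇒∉ (ℕₚ.≤-trans u≤v v≤p))) (Out.index (≤⇒∉ v≤p)) v≡1+u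
  where
  open Last p l l≡1+p l-last

  u≤v : u Fin.≤ v
  u≤v = subst (toℕ u ≤_) (sym v≡1+u) (ℕₚ.n≤1+n _)

  go : {u v : Fin N} → ∃[ u′ ] g u′ ≡ u → ∃[ v′ ] g v′ ≡ v → (v≡1+u : toℕ v ≡ suc (toℕ u)) →
       IntervalsDecompose v≡1+u
  go (u′ , refl) (v′ , refl) gv≡1+gu σ τ σ≤τ = Decomposes-resp-≃
    (≃-trans (Interval-≃ peel′ σ τ)
      (Interval-× (ConvexPoset u′ v′ v≡1+u′) ⟦ unmarked ⟧ (to σ) (to τ)))
    (Decomposes-× (ih c<N v≡1+u′ (proj₁ (to σ)) (proj₁ (to τ)) (proj₁ σ≤τ′))
      (unmarkedInterval (proj₂ (to σ)) (proj₂ (to τ)) (s≤s z≤n) (proj₁ (proj₂ σ≤τ′))))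
    where
    v≡1+u′ : toℕ v′ ≡ suc (toℕ u′)
    v≡1+u′ = consecutive
      (ℕₚ.≰⇒> λ v′≤u′ → ℕₚ.1+n≰n (subst (_≤ toℕ (g u′)) gv≡1+gu (Out.preserves-≤ v′≤u′)))
      (λ {x} x<v′ → Out.reflects-≤ (ℕₚ.m<1+n⇒m≤n (subst (toℕ (g x) <_) gv≡1+gu (Out.mono x<v′))))
    peel′ = peel gv≡1+gu v≡1+u′
    to = proj₁ (iso peel′)
    σ≤τ′ = IsOrderIsomorphism.mono (proj₂ (iso peel′)) {σ} {τ} σ≤τ

convexInterval : {u v : Fin N} (v≡1+u : toℕ v ≡ suc (toℕ u)) → IntervalsDecompose v≡1+u
convexInterval {N} = go (<-wellFounded N)
  where
  go : ∀ {N} → Acc _<_ N → {u v : Fin N} (v≡1+u : toℕ v ≡ suc (toℕ u)) → IntervalsDecompose v≡1+u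
  go {suc n} (acc rs) {u} {v} v≡1+u with ≤⇒<∨≡ (Finₚ.≤fromℕ v)
  ... | inj₂ refl = λ (σ , cσ) (τ , cτ) (σ⊑τ , ¬bad) → Decomposes-resp-≃
    (mk≃ (Interval (ConvexPoset u v v≡1+u) (σ , cσ) (τ , cτ)) (Interval ⟦ mark u v v≡1+u ⟧ σ τ)
      (λ ((π , _) , p , q) → π , p , q) (λ (π , p , q) → (π , convex-last Finₚ.≤fromℕ) , p , q)
      id id (λ _ → ⊑-refl , ⊑-refl))
    (markedInterval v≡1+u Finₚ.≤fromℕ σ τ σ⊑τ ¬bad)
  go {suc (suc n)} (acc rs) {u} {v} v≡1+u | inj₁ v<l = peel-decomposes {p = inject₁ (fromℕ n)} {fromℕ (suc n)}
    (cong suc (sym (Finₚ.toℕ-inject₁ (fromℕ n)))) Finₚ.≤fromℕ (λ M<N → go (rs M<N)) v≡1+u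
    (subst (toℕ v ≤_) (sym (Finₚ.toℕ-inject₁ (fromℕ n))) (ℕₚ.≤-pred v<l))
  go {suc zero} (acc rs) {u} {Fin.zero} () | inj₁ v<l

unwrap : {P : Poset p₁ p₂ p₃} → Decomposes P →
  (∃[ r ] ∃[ j ] Σ[ m ∈ (Fin j → ℕ) ]
    2 ≤ r × 1 ≤ j × ((i : Fin j) → 1 ≤ m i) × P ≅ ×-poset (PosetPF r r) (∏ (λ i → NC (m i)))) ⊎
  (∃[ j ] Σ[ m ∈ (Fin j → ℕ) ] 1 ≤ j × ((i : Fin j) → 1 ≤ m i) × P ≅ ∏ (λ i → NC (m i)))
unwrap (inj₁ (r , j , m , r≥2 , j≥1 , m≥1 , e)) = inj₁ (r , j , m , r≥2 , j≥1 , m≥1 , iso e)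
unwrap (inj₂ (j , m , j≥1 , m≥1 , e)) = inj₂ (j , m , j≥1 , m≥1 , iso e)

theorem1 : (n k : ℕ) → 1 < k → k ≤ n →
    (σ τ : Poset.Carrier (PosetPF n k)) → Poset._≤_ (PosetPF n k) σ τ →
    (∃[ r ] ∃[ j ] Σ[ m ∈ (Fin j → ℕ) ]
    2 ≤ r × 1 ≤ j × ((i : Fin j) → 1 ≤ m i) ×
    Interval (PosetPF n k) σ τ ≅ ×-poset (PosetPF r r) (∏ (λ i → NC (m i))))
    ⊎
    (∃[ j ] Σ[ m ∈ (Fin j → ℕ) ]
    1 ≤ j × ((i : Fin j) → 1 ≤ m i) ×
    Interval (PosetPF n k) σ τ ≅ ∏ (λ i → NC (m i)))
theorem1 n (suc k) _ k<n σ τ σ≤τ = unwrap decomposes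
  where
  -- After the match on `suc k`, the element `u` has index `k` and `v` has index `suc k`.
  u v : Fin (suc n)
  u = fromℕ< (ℕₚ.<-trans k<n (ℕₚ.n<1+n n))
  v = fromℕ< (s≤s k<n)
  v≡1+k : toℕ v ≡ suc k
  v≡1+k = Finₚ.toℕ-fromℕ< (s≤s k<n)
  v≡1+u : toℕ v ≡ suc (toℕ u)
  v≡1+u = trans v≡1+k (cong suc (sym (Finₚ.toℕ-fromℕ< (ℕₚ.<-trans k<n (ℕₚ.n<1+n n)))))
  open PFChains n (suc k) u v v≡1+u v≡1+k
  module F = IsOrderIsomorphism (proj₂ (iso PosetPF≃))
  f = proj₁ (iso PosetPF≃)
  decomposes : Decomposes (Interval (PosetPF n (suc k)) σ τ)
  decomposes = Decomposes-resp-≃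
    (≃-trans (Interval-≃ PosetPF≃ σ τ) (Interval-Interval (ConvexPoset u v v≡1+u) {0̂ᶜ} {1̂ᶜ} (f σ) (f τ)))
    (convexInterval v≡1+u (proj₁ (f σ)) (proj₁ (f τ)) (F.mono {σ} {τ} σ≤τ))
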